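{- Let $p$ be a prime. Suppose $G$ is a graph on $n$ vertices such that $p$ divides $e(G)$, the minimum degree of $G$ is at least $1$, and there exists a $2$-packing $S$ of $G$ with $|S|=p-1$. Let $$s_0=\left|\{v\in S:\deg(v)\equiv 0 \pmod p\}\right|,$$ and let $c=0$ if $V(G)\neq \bigcup_{v\in S}N[v]$ or $\deg(v)=1$ for all $v\in S$, and $c=1$ otherwise. Then $$R(G,\mathbb{Z}_p)\leq \begin{cases} n+p-1+c & \text{if } s_0=0,\\ n+5p-9+s_0+c & \text{if } s_0\neq 0.\end{cases}$$ Moreover, in the case $s_0=c=0$, equality $R(G,\mathbb{Z}_p)=n+p-1$ holds if there exists an integer $d\not\equiv 0\pmod p$ such that $\deg(v)\equiv d\pmod p$ for all $v\in V(G)$.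
   Context: For a vertex $u$, $N[u]=N(u)\cup\{u\}$ is its closed neighborhood. A $2$-packing of a graph $G$ is a set $S\subseteq V(G)$ such that $N[u]\cap N[v]=\emptyset$ for all distinct $u,v\in S$. For a positive integer $k$ and a graph $G$, the $\mathbb{Z}_k$-Ramsey number $R(G,\mathbb{Z}_k)$ is the least $N$ (if it exists) such that every coloring $f:E(K_N)\to\mathbb{Z}_k$ contains a copy $G'$ of $G$ with $\sum_{e\in E(G')}f(e)=0$ (a zero-sum copy). It exists if and only if $k$ divides $e(G)$. -}

module Defs where

open import Data.Nat using (ℕ; zero; suc; _+_; _*_; _∸_; _≤_; _<ᵇ_; _≡ᵇ_; _%_)
open import Data.Nat.Divisibility using (_∣_; _∣?_)
open import Data.Nat.Primality using (Prime)
open import Data.Bool using (Bool; true; false; if_then_else_; _∧_; _∨_; not)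
open import Data.Fin using (Fin; toℕ; _≟_)
open import Data.Fin.Subset using (Subset; _∈_; ∣_∣)
open import Data.Product using (Σ; _×_; _,_; ∃)
open import Data.Sum using (_⊎_)
open import Relation.Nullary using (¬_; does)
open import Relation.Binary.PropositionalEquality using (_≡_; _≢_)
open import Function.Definitions using (Injective)
open import Data.Fin.Subset.Properties using (_∈?_)

record Graph (n : ℕ) : Set where
  field
    adj   : Fin n → Fin n → Bool
    sym   : ∀ u v → adj u v ≡ adj v u
    irrefl : ∀ u → adj u u ≡ false
open Graph public

sumFin : {n : ℕ} → (Fin n → ℕ) → ℕ
sumFin {zero}  f = 0
sumFin {suc n} f = f Fin.zero + sumFin (λ i → f (Fin.suc i))

allFin : {n : ℕ} → (Fin n → Bool) → Bool
allFin {zero}  f = true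
allFin {suc n} f = f Fin.zero ∧ allFin (λ i → f (Fin.suc i))

anyFin : {n : ℕ} → (Fin n → Bool) → Bool
anyFin {zero}  f = false
anyFin {suc n} f = f Fin.zero ∨ anyFin (λ i → f (Fin.suc i))

count : {n : ℕ} → (Fin n → Bool) → ℕ
count P = sumFin (λ i → if P i then 1 else 0)

sumPairs : {n : ℕ} → (Fin n → Fin n → ℕ) → ℕ
sumPairs w = sumFin (λ i → sumFin (λ j → if toℕ i <ᵇ toℕ j then w i j else 0))

deg : {n : ℕ} → Graph n → Fin n → ℕ
deg G u = count (adj G u)

e : {n : ℕ} → Graph n → ℕ
e G = sumPairs (λ i j → if adj G i j then 1 else 0)

inN[_] : {n : ℕ} → Graph n → Fin n → Fin n → Bool
inN[ G ] u w = does (w ≟ u) ∨ adj G u w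

Is2Packing : {n : ℕ} → Graph n → Subset n → Set
Is2Packing G S = ∀ u v → u ∈ S → v ∈ S → u ≢ v →
  ∀ w → ¬ (inN[ G ] u w ≡ true × inN[ G ] v w ≡ true)

memb : {n : ℕ} → Subset n → Fin n → Bool
memb S v = does (v ∈? S)

s₀ : {n : ℕ} → Graph n → Subset n → (p : ℕ) → ℕ
s₀ G S p = count (λ v → memb S v ∧ does (p ∣? deg G v))

cS : {n : ℕ} → Graph n → Subset n → ℕ
cS G S =
  if covers ∧ not allDeg1 then 1 else 0
  where
  covers   = allFin (λ w → anyFin (λ v → memb S v ∧ inN[ G ] v w))
  allDeg1  = allFin (λ v → not (memb S v) ∨ (deg G v ≡ᵇ 1))

-- A Z_p-colouring of E(K_N): a symmetric function on pairs of distinct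
-- vertices (diagonal values are irrelevant and never used).
IsColouring : (N p : ℕ) → (Fin N → Fin N → Fin p) → Set
IsColouring N p f = ∀ a b → f a b ≡ f b a

copyWeight : {n N p : ℕ} → Graph n → (Fin N → Fin N → Fin p) → (Fin n → Fin N) → ℕ
copyWeight G f φ = sumPairs (λ i j → if adj G i j then toℕ (f (φ i) (φ j)) else 0)

ZeroSumProperty : {n : ℕ} → Graph n → (p N : ℕ) → Set
ZeroSumProperty {n} G p N =
  (f : Fin N → Fin N → Fin p) → IsColouring N p f →
  Σ (Fin n → Fin N) λ φ → Injective _≡_ _≡_ φ × (p ∣ copyWeight G f φ)

IsZRamseyNumber : {n : ℕ} → Graph n → (p R : ℕ) → Set
IsZRamseyNumber G p R = ZeroSumProperty G p R × (∀ N → ZeroSumProperty G p N → R ≤ N)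

-- Upper bound. Moving a single vertex v of the 2-packing S to a spare vertex changes the weight of
-- a copy by an amount depending only on the images of N(v); such moves for different vertices of S
-- are independent, so by Cauchy–Davenport p − 1 moves with nonzero effect realise every weight.
-- If p ∤ deg v, such a move can be made from any non-monochromatic triangle. Either K_N contains
-- p − 1 disjoint such triangles, or for some colour κ the edges of other colours have no matching of
-- size p − 1; then Gallai's lemma lets one place G, using S as filler, inside colour κ, and p ∣ e(G).
-- If p ∣ deg v, the move is made from an alternating 4-cycle with nonzero sum; if there are too few
-- of these, the colouring is h x + h y + κ on a large set, the weight of a copy is Σ deg(v) h(φ v),
-- and this is made zero as in a weighted Erdős–Ginzburg–Ziv theorem.
-- Lower bound. Colour by h x + h y, where h is 1 on p − 1 vertices and 0 on the other n − 1.
module Submission where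

open import Defs
open import Data.Nat using (ℕ; zero; suc; _+_; _*_; _∸_; _≤_; _<_; _%_; z≤n; s≤s; s≤s⁻¹; NonZero)
import Data.Nat as ℕ
open import Data.Nat.Properties hiding (_≟_)
open import Data.Nat.DivMod
open import Data.Nat.Divisibility
open import Data.Nat.Primality using (Prime; euclidsLemma; prime⇒nonZero; prime⇒nonTrivial)
open import Data.Nat.ListAction using (sum)
open import Data.Nat.Tactic.RingSolver using (solve-∀)
open import Data.Bool using (Bool; true; false; if_then_else_; _∧_; _∨_; not)
import Data.Bool as Bool
open import Data.Nat.ListAction.Properties using (sum-↭)
open import Data.Fin using (Fin; toℕ; fromℕ<)
import Data.Fin as Fin
open import Data.Fin.Subset using (Subset; ∣_∣)
import Data.Fin.Subset as Subset
open import Data.Fin.Subset.Properties using () renaming (_∈?_ to _∈ˢ?_)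
open import Data.Vec using (Vec; []; _∷_; tabulate) renaming (lookup to lookupᵛ)
open import Data.Vec.Properties using (lookup∘tabulate)
open import Data.Bool.Properties using (not-injective)
import Data.Fin.Properties as Finₚ
open import Data.Fin.Properties using (pigeonhole; toℕ-injective; toℕ<n; fromℕ<-injective)
open import Data.List using (List; []; _∷_; _++_; map; filter; length; lookup; [_]; take; drop; concatMap)
open import Data.List.Properties using (length-map; length-++; filter-notAll; map-++; take++drop≡id; length-take; length-drop)
import Data.List.Properties as Listₚ
open import Data.List.Relation.Unary.All using (All; []; _∷_; all?)
import Data.List.Relation.Unary.All as All
import Data.List.Relation.Unary.All.Properties as Allₚ
open import Data.List.Relation.Unary.Any using (Any; here; there; any?; index)
import Data.List.Relation.Unary.Any as Any
import Data.List.Relation.Unary.Any.Properties as Anyₚ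
open import Data.List.Relation.Unary.AllPairs using (AllPairs; []; _∷_)
import Data.List.Relation.Unary.AllPairs as AllPairs
import Data.List.Relation.Unary.AllPairs.Properties as AllPairsₚ
open import Data.List.Relation.Unary.Unique.Propositional using (Unique)
import Data.List.Relation.Unary.Unique.Propositional.Properties as Uniqueₚ
import Data.List as List
open import Data.List.Relation.Binary.Permutation.Propositional
  using (_↭_; ↭-refl; ↭-sym; ↭-trans; ↭-prep; ↭-swap; ↭⇒↭ₛ; ↭-reflexive)
open import Data.List.Relation.Binary.Permutation.Propositional.Properties
  using (∈-resp-↭; All-resp-↭; ↭-length; ++-commutativeMonoid; shift; drop-∷)
  renaming (++⁺ to ↭-++⁺; ++⁺ˡ to ↭-++⁺ˡ; ++⁺ʳ to ↭-++⁺ʳ; map⁺ to ↭-map⁺)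
import Data.List.Relation.Binary.Permutation.Propositional as ↭
import Data.List.Relation.Binary.Permutation.Setoid.Properties as ↭ₛ
open import Data.List.Relation.Binary.Pointwise using (Pointwise; []; _∷_)
open import Data.List.Membership.Propositional using (_∈_; _∉_; find; lose)
open import Data.List.Membership.Propositional.Properties using (∈-map⁺; ∈-map⁻; ∈-++⁺ˡ; ∈-++⁺ʳ; ∈-++⁻; ∈-filter⁺; ∈-filter⁻; ∈-lookup; ∈-∃++; ∈-allFin; ∈-concatMap⁻; ∈-upTo⁺)
open import Data.Product using (Σ; ∃; ∃₂; _×_; _,_; proj₁; proj₂; uncurry)
import Data.Sum
open import Data.Sum using (_⊎_; inj₁; inj₂)
open import Data.Empty using (⊥; ⊥-elim)
open import Function using (_∘_; id; case_of_)
open import Function.Definitions using (Injective)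
open import Relation.Nullary using (does; ¬_; Dec; yes; no; ¬?; contradiction; _×-dec_; _→-dec_; map′)
open import Relation.Nullary.Decidable using (dec-true)
open import Relation.Binary using (Setoid)
open import Relation.Binary.PropositionalEquality using (_≡_; _≢_; refl; trans; cong; cong₂; subst; subst₂) renaming (sym to ≡-sym)
import Relation.Binary.PropositionalEquality as ≡
import Algebra.Solver.CommutativeMonoid as CMSolver
open import Relation.Binary.Definitions using (DecidableEquality)

-- Residues modulo p and Cauchy–Davenport

-- The bound n + p - 1 leaves nothing to waste. A vertex v of S is moved between two ends x, y
-- against a set A of deg v images of its neighbours; the triangle supplies x, y and one element of
-- A, the other deg v - 1 come from a common pool. As n = 2(p - 1) + Σ (deg v - 1) + (number of
-- vertices outside all N[v]), for c = 0 the p - 1 triangles leave exactly the vertices still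
-- required. For p = 3 and the path on four vertices, with S its two ends, the two triangles fill
-- K₆. So the alternative between disjoint triangles and a colour whose complement has no large
-- matching must hold on 3(p - 1) vertices exactly, which is why matching theory takes up so much of
-- the proof.
--
-- The summand c pays for one spare vertex: if deg v > 1, completing A may require trading one
-- element for another. Vertices of G outside all N[v] provide this room if there are any, and one
-- spare serves all switches in turn.
--
-- A Ramsey number is a least element, so having a zero-sum copy in every colouring must be
-- decidable; this and the case distinctions on matchings rest on exhaustive search.

length-filter-split : {A : Set} {P : A → Set} (P? : ∀ x → Dec (P x)) (xs : List A) →
  length (filter (¬? ∘ P?) xs) + length (filter P? xs) ≡ length xs
length-filter-split P? [] = refl
length-filter-split P? (x ∷ xs) with P? x
... | yes _ = trans (+-suc _ _) (cong suc (length-filter-split P? xs))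
... | no _ = cong suc (length-filter-split P? xs)

lookup-AllPairs : {A : Set} {R : A → A → Set} {xs : List A} → AllPairs R xs →
  ∀ {i j} → i Fin.< j → R (lookup xs i) (lookup xs j)
lookup-AllPairs (r ∷ rs) {Fin.zero} {Fin.suc j} i<j = All.lookup r (∈-lookup j)
lookup-AllPairs (r ∷ rs) {Fin.suc i} {Fin.suc j} (s≤s i<j) = lookup-AllPairs rs i<j

module Residues (p : ℕ) (pp : Prime p) where

  instance
    p≢0 : NonZero p
    p≢0 = prime⇒nonZero pp

  infix 4 _≈_ _≉_ _≈?_

  -- A record rather than a bare equation, so that unification can recover `x` and `y`: `_%_` is not
  -- injective.
  record _≈_ (x y : ℕ) : Set where
    constructor mod≡
    field rem≡ : x % p ≡ y % p
  open _≈_ public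

  _≉_ : ℕ → ℕ → Set
  x ≉ y = ¬ (x ≈ y)

  _≈?_ : ∀ x y → Dec (x ≈ y)
  x ≈? y with x % p ℕ.≟ y % p
  ... | yes q = yes (mod≡ q)
  ... | no q = no (q ∘ rem≡)

  ≈-refl : ∀ {x} → x ≈ x
  ≈-refl = mod≡ refl

  ≈-sym : ∀ {x y} → x ≈ y → y ≈ x
  ≈-sym (mod≡ q) = mod≡ (≡-sym q)

  ≈-trans : ∀ {x y z} → x ≈ y → y ≈ z → x ≈ z
  ≈-trans (mod≡ q) (mod≡ r) = mod≡ (trans q r)

  ≡⇒≈ : ∀ {x y} → x ≡ y → x ≈ y
  ≡⇒≈ refl = ≈-refl

  ≈-setoid : Setoid _ _
  ≈-setoid = record { Carrier = ℕ ; _≈_ = _≈_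
    ; isEquivalence = record { refl = ≈-refl ; sym = ≈-sym ; trans = ≈-trans } }

  +-cong : ∀ {a b c d} → a ≈ b → c ≈ d → a + c ≈ b + d
  +-cong {a} {b} {c} {d} (mod≡ q) (mod≡ r) = mod≡ (trans (%-distribˡ-+ a c p)
    (trans (cong₂ (λ x y → (x + y) % p) q r) (≡-sym (%-distribˡ-+ b d p))))

  *-congˡ : ∀ k {a b} → a ≈ b → k * a ≈ k * b
  *-congˡ zero q = ≈-refl
  *-congˡ (suc k) q = +-cong q (*-congˡ k q)

  p*≈0 : ∀ k → p * k ≈ 0
  p*≈0 k = mod≡ (trans (cong (_% p) (*-comm p k)) (trans (m*n%n≡0 k p) (≡-sym (0%n p))))
    where
    0%n : ∀ n .{{_ : NonZero n}} → 0 % n ≡ 0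
    0%n (suc n) = refl

  ≈0⇒∣ : ∀ {x} → x ≈ 0 → p ∣ x
  ≈0⇒∣ {x} (mod≡ q) = m%n≡0⇒n∣m x p (trans q (n∣m⇒m%n≡0 0 p (p ∣0)))

  ∣⇒≈0 : ∀ {x} → p ∣ x → x ≈ 0
  ∣⇒≈0 {x} d = mod≡ (trans (n∣m⇒m%n≡0 x p d) (≡-sym (n∣m⇒m%n≡0 0 p (p ∣0))))

  -- -x modulo p as (p - 1) x, so that differences of residues stay within ℕ.
  neg : ℕ → ℕ
  neg x = (p ∸ 1) * x

  neg-inverse : ∀ x → x + neg x ≈ 0
  neg-inverse x = ≈-trans (≡⇒≈ (lem p x)) (p*≈0 x)
    where
    lem : ∀ q x .{{_ : NonZero q}} → x + (q ∸ 1) * x ≡ q * x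
    lem (suc q) x = refl

  +-cancelʳ-≈ : ∀ c {a b} → a + c ≈ b + c → a ≈ b
  +-cancelʳ-≈ c {a} {b} q = begin
    a                ≡⟨ ≡-sym (+-identityʳ a) ⟩
    a + 0            ≈⟨ +-cong ≈-refl (≈-sym (neg-inverse c)) ⟩
    a + (c + neg c)  ≡⟨ ≡-sym (+-assoc a c (neg c)) ⟩
    (a + c) + neg c  ≈⟨ +-cong q ≈-refl ⟩
    (b + c) + neg c  ≡⟨ +-assoc b c (neg c) ⟩
    b + (c + neg c)  ≈⟨ +-cong ≈-refl (neg-inverse c) ⟩
    b + 0            ≡⟨ +-identityʳ b ⟩
    b ∎
    where open import Relation.Binary.Reasoning.Setoid ≈-setoid

  +-cancelˡ-≈ : ∀ c {a b} → c + a ≈ c + b → a ≈ b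
  +-cancelˡ-≈ c {a} {b} q = +-cancelʳ-≈ c (subst₂ _≈_ (+-comm c a) (+-comm c b) q)

  private
    cancel-ordered : ∀ {k} → ¬ p ∣ k → ∀ {a b} → a ≤ b → k * b ≈ k * a → b ≈ a
    cancel-ordered {k} k≉0 {a} {b} a≤b q with euclidsLemma k (b ∸ a) pp (≈0⇒∣ {k * (b ∸ a)}
        (+-cancelˡ-≈ (k * a)
          (≈-trans (≡⇒≈ (trans (≡-sym (*-distribˡ-+ k a (b ∸ a))) (cong (k *_) (m+[n∸m]≡n a≤b))))
            (≈-trans q (≡⇒≈ (≡-sym (+-identityʳ _)))))))
    ... | inj₁ d = contradiction d k≉0
    ... | inj₂ d = ≈-trans (≡⇒≈ (≡-sym (m+[n∸m]≡n a≤b)))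
                     (≈-trans (+-cong (≈-refl {a}) (∣⇒≈0 d)) (≡⇒≈ (+-identityʳ a)))

  *-cancelˡ-≈ : ∀ {k} → ¬ p ∣ k → ∀ {a b} → k * a ≈ k * b → a ≈ b
  *-cancelˡ-≈ k≉0 {a} {b} q with ≤-total a b
  ... | inj₁ a≤b = ≈-sym (cancel-ordered k≉0 a≤b (≈-sym q))
  ... | inj₂ b≤a = cancel-ordered k≉0 b≤a q

  ≈⇒≡ : ∀ {a b} → a < p → b < p → a ≈ b → a ≡ b
  ≈⇒≡ a<p b<p (mod≡ q) = trans (≡-sym (m<n⇒m%n≡m a<p)) (trans q (m<n⇒m%n≡m b<p))

  -- A subset of ℤ/p is represented by a list of pairwise incongruent numbers; its length is the
  -- cardinality.
  Incongruent : List ℕ → Set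
  Incongruent = AllPairs _≉_

  private
    residue : ℕ → Fin p
    residue x = fromℕ< (m%n<n x p)

  incongruent-length : ∀ {L} → Incongruent L → length L ≤ p
  incongruent-length {L} inc with length L ℕ.≤? p
  ... | yes q = q
  ... | no q with pigeonhole (≰⇒> q) (λ i → residue (lookup L i))
  ...   | i , j , i<j , r = contradiction (mod≡ (fromℕ<-injective _ _ _ _ r)) (lookup-AllPairs inc i<j)

  -- Otherwise `x ∷ L` would be a list of more than p pairwise incongruent numbers.
  full-incongruent : ∀ {L} → Incongruent L → p ≤ length L → ∀ x → Any (x ≈_) L
  full-incongruent {L} inc p≤ x with any? (x ≈?_) L
  ... | yes q = q
  ... | no q = contradiction (incongruent-length (Allₚ.¬Any⇒All¬ L q ∷ inc)) (<⇒≱ (s≤s p≤))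

  private
    orbit : ∀ {A a δ} → a ∈ A → All (λ x → Any (x + δ ≈_) A) A → ∀ i → Any (i * δ + a ≈_) A
    orbit a∈A closed zero = lose a∈A ≈-refl
    orbit {A} {a} {δ} a∈A closed (suc i) with find (orbit a∈A closed i)
    ... | x , x∈A , q = Any.map (≈-trans (≈-trans (≡⇒≈ (lem (i * δ) δ a)) (+-cong q ≈-refl)))
                          (All.lookup closed x∈A)
      where
      lem : ∀ u v w → v + u + w ≡ u + w + v
      lem = solve-∀

  -- For p ∤ δ the numbers a + iδ with i < p are pairwise incongruent, and closure puts each of them
  -- in A up to congruence; in a shorter A two of them would share a position.
  translation-closed-full : ∀ {A a δ} → ¬ p ∣ δ → a ∈ A →
    All (λ x → Any (x + δ ≈_) A) A → p ≤ length A
  translation-closed-full {A} {a} {δ} δ≉0 a∈A closed with p ℕ.≤? length A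
  ... | yes q = q
  ... | no q with pigeonhole (≰⇒> q) (λ i → index (orbit {δ = δ} a∈A closed (toℕ i)))
  ...   | i , j , i<j , r = ⊥-elim (<⇒≢ i<j (≈⇒≡ (toℕ<n i) (toℕ<n j)
            (*-cancelˡ-≈ δ≉0 (subst₂ _≈_ (*-comm (toℕ i) δ) (*-comm (toℕ j) δ) (+-cancelʳ-≈ a same)))))
    where
    hit : ∀ i → toℕ i * δ + a ≈ lookup A (index (orbit {δ = δ} a∈A closed (toℕ i)))
    hit i = Anyₚ.lookup-index (orbit {δ = δ} a∈A closed (toℕ i))
    same : toℕ i * δ + a ≈ toℕ j * δ + a
    same = ≈-trans (hit i) (≈-trans (≡⇒≈ (cong (lookup A) r)) (≈-sym (hit j)))

  Sumset : List ℕ → List ℕ → ℕ → Set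
  Sumset A B c = ∃₂ λ a b → a ∈ A × b ∈ B × c ≈ a + b

  incongruent-translate : ∀ {L} ε → Incongruent L → Incongruent (map (_+ ε) L)
  incongruent-translate ε inc = AllPairsₚ.map⁺ (AllPairs.map (λ x≉y q → x≉y (+-cancelʳ-≈ ε q)) inc)

  nonempty⇒∈ : {A : Set} {L : List A} → 1 ≤ length L → ∃ (_∈ L)
  nonempty⇒∈ {L = x ∷ L} _ = x , here refl

  ∈⇒nonempty : {A : Set} {x : A} {L : List A} → x ∈ L → 1 ≤ length L
  ∈⇒nonempty (here _) = s≤s z≤n
  ∈⇒nonempty (there _) = s≤s z≤n

  -- Cauchy–Davenport, by the e-transform: with ε = a − b, the elements of B + ε missing from A
  -- are moved into A; this keeps |A| + |B| and shrinks B.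
  cauchy-davenport : ∀ k A B → length B ≤ k → 1 ≤ length A → 1 ≤ length B →
    Incongruent A → Incongruent B →
    ∃ λ C → Incongruent C × All (Sumset A B) C × (p ≤ length C ⊎ length A + length B ≤ suc (length C))
  cauchy-davenport k A (b ∷ []) _ _ _ incA _ =
    map (_+ b) A , incongruent-translate b incA ,
    Allₚ.map⁺ (All.tabulate (λ {x} x∈A → x , b , x∈A , here refl , ≈-refl)) ,
    inj₂ (≤-reflexive (trans (+-comm _ 1) (cong suc (≡-sym (length-map _ A)))))
  cauchy-davenport (suc k) A B@(b ∷ b′ ∷ B″) (s≤s |B|≤k) 1≤A _ incA incB@((b≉b′ ∷ _) ∷ _)
    with all? (λ x → any? (x + (b′ + neg b) ≈?_) A) A
  -- A is invariant under translation by b′ - b, hence is everything, and A + b already has p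
  -- residues.
  ... | yes closed = map (_+ b) A , incongruent-translate b incA ,
    Allₚ.map⁺ (All.tabulate (λ {x} x∈A → x , b , x∈A , here refl , ≈-refl)) ,
    inj₁ (subst (p ≤_) (≡-sym (length-map _ A))
      (translation-closed-full δ≉0 (proj₂ (nonempty⇒∈ 1≤A)) closed))
    where
    δ≉0 : ¬ p ∣ b′ + neg b
    δ≉0 d = b≉b′ (≈-sym (+-cancelʳ-≈ (neg b) (≈-trans (∣⇒≈0 d) (≈-sym (neg-inverse b)))))
  ... | no ¬closed with find (Allₚ.¬All⇒Any¬ (λ x → any? (x + (b′ + neg b) ≈?_) A) A ¬closed)
  ... | a , a∈A , a+δ∉A = finish (cauchy-davenport k (A ++ map (_+ ε) Out) In
      (s≤s⁻¹ (≤-trans In< (s≤s |B|≤k)))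
      (subst (1 ≤_) (≡-sym (length-++ A)) (≤-trans (∈⇒nonempty a∈A) (m≤m+n _ _)))
      (∈⇒nonempty b∈In)
      incA++ (AllPairsₚ.filter⁺ in? incB))
    where
    -- b + ε = a lies in A, so b stays in `In`; b′ + ε = a + (b′ - b) does not, so b′ leaves. Hence
    -- `In` is nonempty and shorter than B.
    ε = a + neg b
    in? : ∀ x → Dec (Any (x + ε ≈_) A)
    in? x = any? (x + ε ≈?_) A
    In = filter in? B
    Out = filter (¬? ∘ in?) B
    back : ∀ u v w → u + (v + w) ≡ v + (u + w)
    back = solve-∀
    b+ε≈a : b + ε ≈ a
    b+ε≈a = ≈-trans (≡⇒≈ (back b a (neg b))) (≈-trans (+-cong ≈-refl (neg-inverse b)) (≡⇒≈ (+-identityʳ a)))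
    b∈In : b ∈ In
    b∈In = ∈-filter⁺ in? (here refl) (lose a∈A b+ε≈a)
    In< : length In < length B
    In< = filter-notAll in? B (there (here (λ q → a+δ∉A (Any.map (≈-trans (≡⇒≈ (back a b′ (neg b)))) q))))
    incA++ : Incongruent (A ++ map (_+ ε) Out)
    incA++ = AllPairsₚ.++⁺ incA (incongruent-translate ε (AllPairsₚ.filter⁺ (¬? ∘ in?) incB))
      (All.tabulate λ {x} x∈A → All.tabulate λ {y} y∈ x≈y → case ∈-map⁻ _ y∈ of λ where
        (z , z∈Out , refl) → proj₂ (∈-filter⁻ (¬? ∘ in?) {xs = B} z∈Out) (lose x∈A (≈-sym x≈y)))
    size : length (A ++ map (_+ ε) Out) + length In ≡ length A + length B
    size = trans (cong (_+ length In) (trans (length-++ A) (cong (length A +_) (length-map _ Out))))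
             (trans (+-assoc (length A) _ _) (cong (length A +_) (length-filter-split in? B)))
    -- The transform creates no new sums: for z moved into A and y kept in B, (z + ε) + y = (y + ε)
    -- + z with y + ε in A and z in B.
    sub : ∀ {c} → Sumset (A ++ map (_+ ε) Out) In c → Sumset A B c
    sub (x , y , x∈ , y∈In , c≈) with ∈-filter⁻ in? {xs = B} y∈In | ∈-++⁻ A x∈
    ... | y∈B , _ | inj₁ x∈A = x , y , x∈A , y∈B , c≈
    ... | y∈B , y+ε∈A | inj₂ x∈map with ∈-map⁻ _ x∈map | find y+ε∈A
    ...   | z , z∈Out , refl | w , w∈A , y+ε≈w = w , z , w∈A , proj₁ (∈-filter⁻ (¬? ∘ in?) {xs = B} z∈Out) ,
            ≈-trans c≈ (≈-trans (≡⇒≈ (rot z ε y)) (+-cong y+ε≈w ≈-refl))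
      where
      rot : ∀ u v w → u + v + w ≡ w + v + u
      rot = solve-∀
    finish : _ → _
    finish (C , incC , C⊆ , bound) = C , incC , All.map sub C⊆ ,
      Data.Sum.map id (subst (_≤ suc (length C)) size) bound

  -- Iterated Cauchy-Davenport bounds the size of a sum of sets from below by min(p, 1 + `excess`).
  excess : List (List ℕ) → ℕ
  excess [] = 0
  excess (B ∷ Bs) = (length B ∸ 1) + excess Bs

  choices-sumset : ∀ Bs → All (λ B → Incongruent B × 1 ≤ length B) Bs →
    ∃ λ C → Incongruent C × 1 ≤ length C × (p ≤ length C ⊎ suc (excess Bs) ≤ length C) ×
      All (λ c → ∃ λ bs → Pointwise _∈_ bs Bs × c ≈ sum bs) C
  choices-sumset [] [] = [ 0 ] , [] ∷ [] , s≤s z≤n , inj₂ ≤-refl , ([] , [] , ≈-refl) ∷ []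
  choices-sumset (B ∷ Bs) ((incB , 1≤B) ∷ ok) with choices-sumset Bs ok
  ... | C , incC , 1≤C , bound , C⊆ with cauchy-davenport (length C) B C ≤-refl 1≤B 1≤C incB incC
  ... | D , incD , D⊆ , boundD = D , incD , 1≤D , size bound boundD , All.map expand D⊆
    where
    expand : ∀ {d} → Sumset B C d → ∃ λ bs → Pointwise _∈_ bs (B ∷ Bs) × d ≈ sum bs
    expand (b , c , b∈B , c∈C , d≈) with All.lookup C⊆ c∈C
    ... | bs , bs∈ , c≈ = b ∷ bs , b∈B ∷ bs∈ , ≈-trans d≈ (+-cong ≈-refl c≈)
    1≤D : 1 ≤ length D
    1≤D = Data.Sum.[ ≤-trans (ℕ.>-nonZero⁻¹ p) , (λ q → s≤s⁻¹ (≤-trans (+-mono-≤ 1≤B 1≤C) q)) ] boundD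
    drop-one : ∀ {x y z} → 1 ≤ x → x + y ≤ suc z → x ∸ 1 + y ≤ z
    drop-one {suc x} _ (s≤s q) = q
    size : _ → _ → p ≤ length D ⊎ suc (excess (B ∷ Bs)) ≤ length D
    size _ (inj₁ q) = inj₁ q
    size (inj₁ p≤C) (inj₂ q) = inj₁ (≤-trans p≤C (≤-trans (m≤n+m (length C) (length B ∸ 1)) (drop-one 1≤B q)))
    size (inj₂ C≥) (inj₂ q) = inj₂ (≤-trans (≤-reflexive (≡-sym (+-suc (length B ∸ 1) _)))
      (≤-trans (+-monoʳ-≤ (length B ∸ 1) C≥) (drop-one 1≤B q)))

  choices-hit-everything : ∀ Bs → All (λ B → Incongruent B × 1 ≤ length B) Bs → p ∸ 1 ≤ excess Bs →
    ∀ t → ∃ λ bs → Pointwise _∈_ bs Bs × t ≈ sum bs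
  choices-hit-everything Bs ok big t with choices-sumset Bs ok
  ... | C , incC , _ , bound , C⊆ with find (full-incongruent incC p≤C t)
    where
    p≤C : p ≤ length C
    p≤C = Data.Sum.[ id , ≤-trans (≤-trans (≤-reflexive (≡-sym (m+[n∸m]≡n (ℕ.>-nonZero⁻¹ p)))) (s≤s big)) ] bound
  ... | c , c∈C , t≈c with All.lookup C⊆ c∈C
  ... | bs , bs∈ , c≈ = bs , bs∈ , ≈-trans t≈c c≈

-- Lists, matchings and the exchange argument

Unique-resp-↭ : {A : Set} {K L : List A} → K ↭ L → Unique K → Unique L
Unique-resp-↭ {A} q = ↭ₛ.Unique-resp-↭ (≡.setoid A) (↭⇒↭ₛ q)

Unique-++-disjoint : {A : Set} (K : List A) {L : List A} → Unique (K ++ L) → ∀ {x} → x ∈ K → x ∉ L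
Unique-++-disjoint (_ ∷ K) (u ∷ _) (here refl) x∈L = All.lookup u (∈-++⁺ʳ K x∈L) refl
Unique-++-disjoint (_ ∷ K) (_ ∷ u) (there x∈K) x∈L = Unique-++-disjoint K u x∈K x∈L

Unique-++⁻ˡ : {A : Set} (K : List A) {L : List A} → Unique (K ++ L) → Unique K
Unique-++⁻ˡ [] _ = []
Unique-++⁻ˡ (_ ∷ K) (u ∷ us) = Allₚ.++⁻ˡ K u ∷ Unique-++⁻ˡ K us

Unique-++⁻ʳ : {A : Set} (K : List A) {L : List A} → Unique (K ++ L) → Unique L
Unique-++⁻ʳ [] u = u
Unique-++⁻ʳ (_ ∷ K) (_ ∷ us) = Unique-++⁻ʳ K us

∈⇒↭∷ : {A : Set} {x : A} {L : List A} → x ∈ L → ∃ λ L′ → L ↭ x ∷ L′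
∈⇒↭∷ {x = x} x∈L with ∈-∃++ x∈L
... | K , K′ , refl = K ++ K′ , shift x K K′

-- Finite sets are handled as lists up to permutation. For duplicate-free V, `L ++ R ↭ V` says at
-- once that L consists of distinct elements of V, that R is the rest, and how the sizes add up.
complement : {A : Set} (L V : List A) → Unique L → (∀ {x} → x ∈ L → x ∈ V) → ∃ λ R → L ++ R ↭ V
complement [] V _ _ = V , ↭-refl
complement (x ∷ L) V (x∉L ∷ uL) L⊆V with ∈⇒↭∷ (L⊆V (here refl))
... | V′ , V↭ with complement L V′ uL
  (λ y∈L → case ∈-resp-↭ V↭ (L⊆V (there y∈L)) of λ where
    (here refl) → ⊥-elim (All.lookup x∉L y∈L refl)
    (there y∈V′) → y∈V′)
... | R , LR↭ = R , ↭-trans (↭-prep x LR↭) (↭-sym V↭)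

unique-⊆-length : {A : Set} {L V : List A} → Unique L → (∀ {x} → x ∈ L → x ∈ V) → length L ≤ length V
unique-⊆-length {L = L} {V} uL L⊆V with complement L V uL L⊆V
... | R , q = ≤-trans (m≤m+n (length L) (length R)) (≤-reflexive (trans (≡-sym (length-++ L)) (↭-length q)))

module ↭-Solver {A : Set} where
  open CMSolver (++-commutativeMonoid {A = A}) public using (solve; _⊕_; _⊜_) renaming (id to ε)

-- Exhaustive search, in a form that passes to pairs and to lists of fixed length; it makes the
-- existence of a matching of given size decidable.
Searchable : Set → Set₁
Searchable A = ∀ {P : A → Set} → (∀ a → Dec (P a)) → Dec (∃ P)

search-× : {A B : Set} → Searchable A → Searchable B → Searchable (A × B)
search-× sA sB P? = map′ (λ (a , b , q) → (a , b) , q) (λ ((a , b) , q) → a , b , q)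
  (sA (λ a → sB (λ b → P? (a , b))))

search-List : {A : Set} → Searchable A → ∀ m {P : List A → Set} → (∀ l → Dec (P l)) →
  Dec (∃ λ l → length l ≡ m × P l)
search-List sA zero P? = map′ (λ q → [] , refl , q) (λ where ([] , _ , q) → q) (P? [])
search-List sA (suc m) P? = map′ (λ (a , l , k , q) → a ∷ l , cong suc k , q)
  (λ where (a ∷ l , k , q) → a , l , suc-injective k , q)
  (sA (λ a → search-List sA m (λ l → P? (a ∷ l))))

cov : {A : Set} → List (A × A) → List A
cov [] = []
cov ((x , y) ∷ M) = x ∷ y ∷ cov M

cov-++ : {A : Set} (M : List (A × A)) {M′ : List (A × A)} → cov (M ++ M′) ≡ cov M ++ cov M′
cov-++ [] = refl
cov-++ (_ ∷ M) = cong (λ l → _ ∷ _ ∷ l) (cov-++ M)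

cov-↭ : {A : Set} {M M′ : List (A × A)} → M ↭ M′ → cov M ↭ cov M′
cov-↭ ↭.refl = ↭-refl
cov-↭ (↭.prep (x , y) p) = ↭-prep x (↭-prep y (cov-↭ p))
cov-↭ (↭.swap (x , y) (z , w) p) =
  ↭-trans (↭-prep x (↭-prep y (↭-prep z (↭-prep w (cov-↭ p)))))
    (solve 5 (λ x y z w m → x ⊕ (y ⊕ (z ⊕ (w ⊕ m))) ⊜ z ⊕ (w ⊕ (x ⊕ (y ⊕ m)))) ↭-refl [ x ] [ y ] [ z ] [ w ] _)
  where open ↭-Solver
cov-↭ (↭.trans p q) = ↭-trans (cov-↭ p) (cov-↭ q)

length-cov : {A : Set} (M : List (A × A)) → length (cov M) ≡ length M + length M
length-cov [] = refl
length-cov (_ ∷ M) = cong suc (trans (cong suc (length-cov M)) (≡-sym (+-suc _ _)))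

extract : {A : Set} {H : A → A → Set} → (∀ {x y} → H x y → H y x) → ∀ {M x} → All (uncurry H) M → x ∈ cov M →
  ∃₂ λ y M′ → H x y × All (uncurry H) M′ × length M ≡ suc (length M′) × cov M ↭ x ∷ y ∷ cov M′
extract H-sym {(x , y) ∷ M} (h ∷ hs) (here refl) = y , M , h , hs , refl , ↭-refl
extract H-sym {(x , y) ∷ M} (h ∷ hs) (there (here refl)) = x , M , H-sym h , hs , refl , ↭-swap x y ↭-refl
extract H-sym {(x , y) ∷ M} {z} (h ∷ hs) (there (there z∈)) with extract H-sym hs z∈
... | w , M′ , hzw , hs′ , k , q = w , (x , y) ∷ M′ , hzw , h ∷ hs′ , cong suc k ,
  ↭-trans (↭-prep x (↭-prep y q))
    (solve 5 (λ x y z w m → x ⊕ (y ⊕ (z ⊕ (w ⊕ m))) ⊜ z ⊕ (w ⊕ (x ⊕ (y ⊕ m)))) ↭-refl [ x ] [ y ] [ z ] [ w ] (cov M′))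
  where open ↭-Solver

module Matchings {A : Set} (_≟_ : DecidableEquality A) (search : Searchable A)
  (H : A → A → Set) (H? : ∀ x y → Dec (H x y)) (H-sym : ∀ {x y} → H x y → H y x) where

  open import Data.List.Membership.DecPropositional _≟_ using (_∈?_)
  open import Data.List.Relation.Unary.Unique.DecPropositional _≟_ using (unique?)

  Edges : List (A × A) → Set
  Edges = All (uncurry H)

  -- `X` is part of the permutation, so its vertices lie in V and stay uncovered.
  MatchingAvoiding : List A → ℕ → List A → Set
  MatchingAvoiding X m V = ∃₂ λ M R → Edges M × length M ≡ m × cov M ++ X ++ R ↭ V

  Matching : ℕ → List A → Set
  Matching = MatchingAvoiding []

  matchingAvoiding? : ∀ X m {V} → Unique V → Dec (MatchingAvoiding X m V)
  matchingAvoiding? X m {V} uV = map′ sound complete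
    (search-List (search-× search search) m {P = λ M → Edges M × Unique (cov M ++ X) × All (_∈ V) (cov M ++ X)}
      (λ M → all? (uncurry H?) M ×-dec unique? (cov M ++ X) ×-dec all? (_∈? V) (cov M ++ X)))
    where
    open import Data.List.Properties using (++-assoc)
    sound : _ → MatchingAvoiding X m V
    sound (M , k , h , u , s) with complement (cov M ++ X) V u (All.lookup s)
    ... | R , q = M , R , h , k , ↭-trans (↭-reflexive (≡-sym (++-assoc (cov M) X R))) q
    complete : MatchingAvoiding X m V → _
    complete (M , R , h , k , q) = M , k , h ,
      Unique-++⁻ˡ (cov M ++ X) (Unique-resp-↭ (↭-sym q′) uV) ,
      All.tabulate (λ x∈ → ∈-resp-↭ q′ (∈-++⁺ˡ x∈))
      where
      q′ : (cov M ++ X) ++ R ↭ V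
      q′ = ↭-trans (↭-reflexive (++-assoc (cov M) X R)) q

  module Deficient {V : List A} (uV : Unique V) {m : ℕ} (maximum : ¬ Matching (suc m) V) where

    -- Gallai's relation. No matching in V has more than m edges, so vertices are linked when no
    -- maximum matching misses both. Its transitivity is the core of Gallai's lemma.
    Linked : A → A → Set
    Linked x y = ¬ MatchingAvoiding (x ∷ y ∷ []) m V

    open ↭-Solver

    adjacent⇒linked : ∀ {x y} → H x y → Linked x y
    adjacent⇒linked {x} {y} h (M , R , hM , k , q) = maximum ((x , y) ∷ M , R , h ∷ hM , cong suc k ,
      ↭-trans (solve 4 (λ x y m r → x ⊕ (y ⊕ (m ⊕ r)) ⊜ m ⊕ (x ⊕ (y ⊕ r))) ↭-refl [ x ] [ y ] (cov M) R) q)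

    -- The two maximum matchings are E ∪ F (missing x and y) and D ∪ E (missing t).
    -- Each round trades an edge of D for an edge of F, so that the common part E grows.
    exchange : ∀ d D E F x y t {R₁ R₂} → length D ≡ d → Edges D → Edges E → Edges F →
      length F ≡ length D → length D + length E ≡ m →
      cov E ++ cov F ++ x ∷ y ∷ R₁ ↭ V → cov D ++ cov E ++ t ∷ R₂ ↭ V →
      Linked x t → Linked t y → ⊥
    exchange d D E F x y t {R₁} {R₂} |D|≡d hD hE hF |F|≡|D| |DE| pEF pDE xt ty =
      case traded of λ where
        (z , z∈F , z∉tD) → swap-edge z∈F z∉tD
      where
      uEF : Unique (cov E ++ cov F ++ x ∷ y ∷ R₁)
      uEF = Unique-resp-↭ (↭-sym pEF) uV
      uFxy : Unique (cov F ++ x ∷ y ∷ R₁)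
      uFxy = Unique-++⁻ʳ (cov E) uEF
      data Place (z : A) : Set where
        inD : z ∈ cov D → Place z
        inE : z ∈ cov E → Place z
        isT : z ≡ t → Place z
        inR : ∀ {R} → R₂ ↭ z ∷ R → Place z
      place : ∀ {z} → z ∈ V → Place z
      place z∈V with ∈-++⁻ (cov D) (∈-resp-↭ (↭-sym pDE) z∈V)
      ... | inj₁ z∈D = inD z∈D
      ... | inj₂ z∈ with ∈-++⁻ (cov E) z∈
      ...   | inj₁ z∈E = inE z∈E
      ...   | inj₂ (here z≡t) = isT z≡t
      ...   | inj₂ (there z∈R) = inR (proj₂ (∈⇒↭∷ z∈R))
      ∉E : ∀ {z} → z ∈ cov F ++ x ∷ y ∷ R₁ → z ∉ cov E
      ∉E z∈ z∈E = Unique-++-disjoint (cov E) uEF z∈E z∈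
      x∈ : x ∈ cov F ++ x ∷ y ∷ R₁
      x∈ = ∈-++⁺ʳ (cov F) (here refl)
      y∈ : y ∈ cov F ++ x ∷ y ∷ R₁
      y∈ = ∈-++⁺ʳ (cov F) (there (here refl))
      inV : ∀ {z} → z ∈ cov F ++ x ∷ y ∷ R₁ → z ∈ V
      inV z∈ = ∈-resp-↭ pEF (∈-++⁺ʳ (cov E) z∈)
      DE : List (A × A)
      DE = D ++ E
      hDE : Edges DE
      hDE = Allₚ.++⁺ hD hE
      |DE|≡m : length DE ≡ m
      |DE|≡m = trans (length-++ D) |DE|
      EF-misses-xy : MatchingAvoiding (x ∷ y ∷ []) m V
      EF-misses-xy = E ++ F , R₁ , Allₚ.++⁺ hE hF ,
        trans (length-++ E) (trans (cong (length E +_) |F|≡|D|) (trans (+-comm (length E) _) |DE|)) ,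
        ↭-trans (↭-reflexive (cong (_++ x ∷ y ∷ R₁) (cov-++ E)))
          (↭-trans (solve 3 (λ e f r → (e ⊕ f) ⊕ r ⊜ e ⊕ (f ⊕ r)) ↭-refl (cov E) (cov F) (x ∷ y ∷ R₁)) pEF)
      DE-misses : ∀ {z R} → R₂ ↭ z ∷ R → MatchingAvoiding (t ∷ z ∷ []) m V
      DE-misses {z} {R} q = DE , R , hDE , |DE|≡m ,
        ↭-trans (↭-reflexive (cong (_++ t ∷ z ∷ R) (cov-++ D)))
          (↭-trans (solve 3 (λ e f r → (e ⊕ f) ⊕ r ⊜ e ⊕ (f ⊕ r)) ↭-refl (cov D) (cov E) (t ∷ z ∷ R))
            (↭-trans (↭-++⁺ˡ (cov D) (↭-++⁺ˡ (cov E) (↭-prep t (↭-sym q)))) pDE))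
      flip : ∀ {a b} → MatchingAvoiding (a ∷ b ∷ []) m V → MatchingAvoiding (b ∷ a ∷ []) m V
      flip {a} {b} (M , R , h , k , q) = M , R , h , k , ↭-trans (↭-++⁺ˡ (cov M) (↭-swap b a ↭-refl)) q
      -- D covers x: otherwise D ∪ E misses x and t together or, if x = t, E ∪ F misses t and y
      -- together.
      x∈D : x ∈ cov D
      x∈D with place (inV x∈)
      ... | inD q = q
      ... | inE q = ⊥-elim (∉E x∈ q)
      ... | isT refl = ⊥-elim (ty EF-misses-xy)
      ... | inR q = ⊥-elim (xt (flip (DE-misses q)))
      y∈D : y ∈ cov D
      y∈D with place (inV y∈)
      ... | inD q = q
      ... | inE q = ⊥-elim (∉E y∈ q)
      ... | isT refl = ⊥-elim (xt EF-misses-xy)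
      ... | inR q = ⊥-elim (ty (DE-misses q))
      traded : ∃ λ z → z ∈ cov F × z ∉ t ∷ cov D
      traded with all? (_∈? (t ∷ cov D)) (cov F)
      ... | no ¬all with find (Allₚ.¬All⇒Any¬ (_∈? (t ∷ cov D)) (cov F) ¬all)
      ...   | z , z∈F , z∉ = z , z∈F , z∉
      -- Otherwise x, y and the vertices of F, all distinct, would fit into t and the vertices of D,
      -- although F and D have equally many edges.
      traded | yes all⊆ = ⊥-elim (<⇒≱ (n<1+n (suc (length (cov D))))
        (subst (λ k → suc (suc k) ≤ suc (length (cov D))) |covF|≡
          (unique-⊆-length {L = x ∷ y ∷ cov F} {V = t ∷ cov D}
            (Unique-++⁻ˡ (x ∷ y ∷ cov F) (Unique-resp-↭
              (solve 4 (λ f x y r → f ⊕ (x ⊕ (y ⊕ r)) ⊜ x ⊕ (y ⊕ (f ⊕ r))) ↭-refl (cov F) [ x ] [ y ] R₁) uFxy))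
            (λ where
              (here refl) → there x∈D
              (there (here refl)) → there y∈D
              (there (there z∈F)) → All.lookup all⊆ z∈F))))
        where
        |covF|≡ : length (cov F) ≡ length (cov D)
        |covF|≡ = trans (length-cov F) (trans (cong (λ k → k + k) |F|≡|D|) (≡-sym (length-cov D)))
      swap-edge : ∀ {z} → z ∈ cov F → z ∉ t ∷ cov D → ⊥
      swap-edge {z} z∈F z∉tD with place (inV (∈-++⁺ˡ z∈F))
      ... | inD q = z∉tD (there q)
      ... | inE q = ∉E (∈-++⁺ˡ z∈F) q
      ... | isT q = z∉tD (here q)
      -- z is missed by D ∪ E. Its partner w in F must be covered by D: if w were t, the adjacent
      -- vertices t and z would be missed together; if w were another missed vertex, wz would
      -- enlarge D ∪ E.
      ... | inR {R} q with extract H-sym hF z∈F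
      ... | w , F′ , hzw , hF′ , |F|≡ , F↭ with place (inV (∈-++⁺ˡ (∈-resp-↭ (↭-sym F↭) (there (here refl)))))
      ...   | inE r = ∉E (∈-++⁺ˡ (∈-resp-↭ (↭-sym F↭) (there (here refl)))) r
      ...   | isT refl = adjacent⇒linked (H-sym hzw) (DE-misses q)
      ...   | inR {R′} r with ∈-resp-↭ r (∈-resp-↭ (↭-sym q) (here refl))
      ...     | here refl = Unique-self (Unique-resp-↭ (↭-++⁺ F↭ ↭-refl) uFxy)
        where
        Unique-self : ∀ {z : A} {L} → ¬ Unique (z ∷ z ∷ L)
        Unique-self ((z≢z ∷ _) ∷ _) = z≢z refl
      ...     | there z∈R′ with ∈⇒↭∷ z∈R′
      ...       | R″ , R′↭ = maximum ((w , z) ∷ DE , t ∷ R″ , H-sym hzw ∷ hDE , cong suc |DE|≡m ,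
        ↭-trans (↭-reflexive (cong (λ c → w ∷ z ∷ c ++ t ∷ R″) (cov-++ D)))
          (↭-trans (solve 6 (λ w z d e t r → w ⊕ (z ⊕ ((d ⊕ e) ⊕ (t ⊕ r))) ⊜ d ⊕ (e ⊕ (t ⊕ (w ⊕ (z ⊕ r))))) ↭-refl
              [ w ] [ z ] (cov D) (cov E) [ t ] R″)
            (↭-trans (↭-++⁺ˡ (cov D) (↭-++⁺ˡ (cov E) (↭-prep t (↭-sym (↭-trans r (↭-prep w R′↭)))))) pDE)))
      swap-edge {z} z∈F z∉tD | inR {R} q | w , F′ , hzw , hF′ , |F|≡ , F↭ | inD w∈D = trade d |D|≡d (extract H-sym hD w∈D)
        where
        trade : ∀ d → length D ≡ d → _ → ⊥
        trade zero |D|≡0 (_ , _ , _ , _ , |D|≡ , _) with trans (≡-sym |D|≡) |D|≡0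
        ... | ()
        -- Exchanging the edge wv of D for wz keeps D ∪ E maximum and missing t, and wz is now
        -- common to both matchings.
        trade (suc d) |D|≡d (v , D′ , _ , hD′ , |D|≡ , D↭) =
          exchange d D′ ((z , w) ∷ E) F′ x y t {R₁} {v ∷ R}
            (suc-injective (trans (≡-sym |D|≡) |D|≡d)) hD′ (hzw ∷ hE) hF′
            (suc-injective (trans (≡-sym |F|≡) (trans |F|≡|D| |D|≡)))
            (trans (+-suc _ _) (trans (cong (_+ length E) (≡-sym |D|≡)) |DE|))
            (↭-trans (solve 5 (λ z w e f r → z ⊕ (w ⊕ (e ⊕ (f ⊕ r))) ⊜ e ⊕ ((z ⊕ (w ⊕ f)) ⊕ r)) ↭-refl
                [ z ] [ w ] (cov E) (cov F′) (x ∷ y ∷ R₁))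
              (↭-trans (↭-++⁺ˡ (cov E) (↭-++⁺ʳ (x ∷ y ∷ R₁) (↭-sym F↭))) pEF))
            (↭-trans (solve 7 (λ z w v d e t r → d ⊕ ((z ⊕ (w ⊕ e)) ⊕ (t ⊕ (v ⊕ r))) ⊜ (w ⊕ (v ⊕ d)) ⊕ (e ⊕ (t ⊕ (z ⊕ r)))) ↭-refl
                [ z ] [ w ] [ v ] (cov D′) (cov E) [ t ] R)
              (↭-trans (↭-++⁺ (↭-sym D↭) (↭-++⁺ˡ (cov E) (↭-prep t (↭-sym q)))) pDE))
            xt ty

    -- The exchange starts with nothing in common: D misses t, while F misses x and y.
    linked-trans : ∀ {x t y} → MatchingAvoiding [ t ] m V → Linked x t → Linked t y → Linked x y
    linked-trans {x} {t} {y} (D , R₂ , hD , |D| , pD) xt ty (F , R₁ , hF , |F| , pF) =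
      exchange (length D) D [] F x y t refl hD [] hF (trans |F| (≡-sym |D|)) (trans (+-identityʳ _) |D|)
        pF pD xt ty

-- Packing G against a graph with small matching number

pairing : {A B : Set} → ∀ (L : List B) (V : List A) → length L ≤ length V →
  ∃₂ λ P Q → map proj₁ P ≡ L × map proj₂ P ++ Q ≡ V
pairing [] V _ = [] , V , refl , refl
pairing (u ∷ L) (x ∷ V) (s≤s le) with pairing L V le
... | P , Q , q , r = (u , x) ∷ P , Q , cong (u ∷_) q , cong (x ∷_) r

-- `H` will be the edges of K_N whose colour is not κ and `Adj` the edges of G; a placement keeps
-- the edges of G off `H`.
module Packing {A B : Set} (_≟_ : DecidableEquality A) (search : Searchable A)
  (H : A → A → Set) (H? : ∀ x y → Dec (H x y)) (H-sym : ∀ {x y} → H x y → H y x)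
  (Adj : B → B → Set) (Adj? : ∀ u v → Dec (Adj u v)) (Adj-sym : ∀ {u v} → Adj u v → Adj v u)
  (Adj-irrefl : ∀ {u} → ¬ Adj u u) where

  open Matchings _≟_ search H H? H-sym
  open ↭-Solver

  split-edges : {Q : A → Set} (Q? : ∀ x → Dec (Q x)) → ∀ M → Edges M →
    (∀ {x y} → x ∈ cov M → H x y → y ∈ cov M → Q x → Q y) →
    ∃₂ λ M₁ M₂ → Edges M₁ × Edges M₂ × All Q (cov M₁) × All (¬_ ∘ Q) (cov M₂) ×
      cov M ↭ cov M₁ ++ cov M₂
  split-edges Q? [] [] _ = [] , [] , [] , [] , [] , [] , ↭-refl
  split-edges Q? ((x , y) ∷ M) (h ∷ hs) closed
    with split-edges Q? M hs (λ x∈ h y∈ → closed (there (there x∈)) h (there (there y∈))) | Q? x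
  ... | M₁ , M₂ , h₁ , h₂ , q₁ , q₂ , p | yes qx =
    (x , y) ∷ M₁ , M₂ , h ∷ h₁ , h₂ , qx ∷ closed (here refl) h (there (here refl)) qx ∷ q₁ , q₂ ,
    ↭-prep x (↭-prep y p)
  ... | M₁ , M₂ , h₁ , h₂ , q₁ , q₂ , p | no ¬qx =
    M₁ , (x , y) ∷ M₂ , h₁ , h ∷ h₂ , q₁ ,
    ¬qx ∷ (¬qx ∘ closed (there (here refl)) (H-sym h) (here refl)) ∷ q₂ ,
    ↭-trans (↭-prep x (↭-prep y p))
      (solve 4 (λ x y k l → x ⊕ (y ⊕ (k ⊕ l)) ⊜ k ⊕ (x ⊕ (y ⊕ l))) ↭-refl [ x ] [ y ] (cov M₁) (cov M₂))

  -- Gallai's lemma: if no vertex is essential, a linkage class is a union of components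
  -- and every maximum matching covers all but exactly one of its vertices.
  gallai : ∀ {V m} → Unique V → ¬ Matching (suc m) V → All (λ t → MatchingAvoiding [ t ] m V) V →
    ∀ {x} → x ∈ V → ∃₂ λ M L → Edges M × length M ≤ m × (x ∷ cov M) ++ L ↭ V ×
      (∀ {y z} → y ∈ x ∷ cov M → z ∈ L → ¬ H y z)
  gallai {V} {m} uV maximum inessential {x} x∈V with All.lookup inessential x∈V
  ... | M , R , hM , |M| , pM with split-edges (λ y → ¬? (matchingAvoiding? (x ∷ y ∷ []) m uV)) M hM
      (λ {y} {z} y∈ h _ xy → linked-trans (All.lookup inessential (∈-resp-↭ pM (∈-++⁺ˡ y∈))) xy (adjacent⇒linked h))
    where open Deficient uV maximum
  ... | M₁ , M₂ , h₁ , h₂ , q₁ , q₂ , p = M₁ , cov M₂ ++ R , h₁ , |M₁|≤m , V↭ , separated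
    where
    open Deficient uV maximum
    V↭ : (x ∷ cov M₁) ++ cov M₂ ++ R ↭ V
    V↭ = ↭-trans (solve 4 (λ x k l r → (x ⊕ k) ⊕ (l ⊕ r) ⊜ (k ⊕ l) ⊕ (x ⊕ r)) ↭-refl [ x ] (cov M₁) (cov M₂) R)
           (↭-trans (↭-++⁺ʳ (x ∷ R) (↭-sym p)) pM)
    half : ∀ {a b} → a + a ≤ b + b → a ≤ b
    half {a} {b} q with a ℕ.≤? b
    ... | yes r = r
    ... | no r = contradiction q (<⇒≱ (+-mono-< (≰⇒> r) (≰⇒> r)))
    |M₁|≤m : length M₁ ≤ m
    |M₁|≤m = half (subst₂ _≤_ (length-cov M₁) (trans (length-cov M) (cong (λ k → k + k) |M|))
      (≤-trans (m≤m+n (length (cov M₁)) (length (cov M₂)))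
        (≤-reflexive (trans (≡-sym (length-++ (cov M₁))) (≡-sym (↭-length p))))))
    x-linked : ∀ {y} → y ∈ x ∷ cov M₁ → Linked x y
    x-linked (there y∈) = All.lookup q₁ y∈
    x-linked (here refl) (N , R′ , _ , _ , pN) with Unique-++⁻ʳ (cov N) (Unique-resp-↭ (↭-sym pN) uV)
    ... | (x≢x ∷ _) ∷ _ = x≢x refl
    -- M misses x together with each other vertex that it misses, so these lie outside the class of
    -- x, which is therefore exactly x and `cov M₁`.
    not-linked : ∀ {z} → z ∈ cov M₂ ++ R → ¬ Linked x z
    not-linked z∈ with ∈-++⁻ (cov M₂) z∈
    ... | inj₁ z∈M₂ = All.lookup q₂ z∈M₂
    ... | inj₂ z∈R with ∈⇒↭∷ z∈R
    ...   | R′ , r = λ xz → xz (M , R′ , hM , |M| , ↭-trans (↭-++⁺ˡ (cov M) (↭-prep x (↭-sym r))) pM)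
    separated : ∀ {y z} → y ∈ x ∷ cov M₁ → z ∈ cov M₂ ++ R → ¬ H y z
    separated y∈ z∈ h = not-linked z∈ (linked-trans (All.lookup inessential (∈-resp-↭ V↭ (∈-++⁺ˡ y∈)))
      (x-linked y∈) (adjacent⇒linked h))

  Placement : List B → List A → Set
  Placement L V = ∃₂ λ (P : List (B × A)) Q → map proj₁ P ↭ L × map proj₂ P ++ Q ↭ V ×
    (∀ {u x v y} → (u , x) ∈ P → (v , y) ∈ P → Adj u v → ¬ H x y)

  place-independent : ∀ L V → length L ≤ length V → (∀ {u v} → u ∈ L → v ∈ L → ¬ Adj u v) → Placement L V
  place-independent L V le indep with pairing L V le
  ... | P , Q , refl , refl = P , Q , ↭-refl , ↭-refl ,
    λ u∈ v∈ uv _ → indep (∈-map⁺ proj₁ u∈) (∈-map⁺ proj₁ v∈) uv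

  place-apart : ∀ {L L′ W W′ V} → W ++ W′ ↭ V → (∀ {y z} → y ∈ W → z ∈ W′ → ¬ H y z) →
    Placement L W → Placement L′ W′ → Placement (L ++ L′) V
  place-apart {L} {L′} {W} {W′} V↭ apart (P , Q , PL , PW , ok) (P′ , Q′ , PL′ , PW′ , ok′) =
    P ++ P′ , Q ++ Q′ , ↭-trans (↭-reflexive (map-++ proj₁ P P′)) (↭-++⁺ PL PL′) ,
    ↭-trans (↭-reflexive (cong (_++ Q ++ Q′) (map-++ proj₂ P P′)))
      (↭-trans (solve 4 (λ a b c d → (a ⊕ b) ⊕ (c ⊕ d) ⊜ (a ⊕ c) ⊕ (b ⊕ d)) ↭-refl (map proj₂ P) (map proj₂ P′) Q Q′)
        (↭-trans (↭-++⁺ PW PW′) V↭)) ,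
    compatible
    where
    inW : ∀ {u x} → (u , x) ∈ P → x ∈ W
    inW q = ∈-resp-↭ PW (∈-++⁺ˡ (∈-map⁺ proj₂ q))
    inW′ : ∀ {u x} → (u , x) ∈ P′ → x ∈ W′
    inW′ q = ∈-resp-↭ PW′ (∈-++⁺ˡ (∈-map⁺ proj₂ q))
    compatible : ∀ {u x v y} → (u , x) ∈ P ++ P′ → (v , y) ∈ P ++ P′ → Adj u v → ¬ H x y
    compatible q r uv h with ∈-++⁻ P q | ∈-++⁻ P r
    ... | inj₁ q₁ | inj₁ r₁ = ok q₁ r₁ uv h
    ... | inj₁ q₁ | inj₂ r₂ = apart (inW q₁) (inW′ r₂) h
    ... | inj₂ q₂ | inj₁ r₁ = apart (inW r₁) (inW′ q₂) (H-sym h)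
    ... | inj₂ q₂ | inj₂ r₂ = ok′ q₂ r₂ uv h

  place-resp-↭ : ∀ {L L′ V V′} → L ↭ L′ → V ↭ V′ → Placement L V → Placement L′ V′
  place-resp-↭ q r (P , Q , a , b , c) = P , Q , ↭-trans a q , ↭-trans b r , c

  -- For a 2-packing S this holds of every r: two neighbours of r in S would have r in both closed
  -- neighbourhoods.
  AtMostOneIn : List B → B → Set
  AtMostOneIn S r = ∀ u v → u ∈ S → v ∈ S → Adj r u → Adj r v → u ≡ v

  -- At most one vertex of S has to be avoided, and a < |S| leaves room for that.
  choose-nonadjacent : ∀ a S r → Unique S → AtMostOneIn S r → a < length S →
    ∃₂ λ S₁ S₂ → S ↭ S₁ ++ S₂ × length S₁ ≡ a × All (¬_ ∘ Adj r) S₁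
  choose-nonadjacent zero S r _ _ _ = [] , S , ↭-refl , refl , []
  choose-nonadjacent (suc a) (u ∷ S) r (u∉S ∷ uS) one (s≤s lt) with Adj? r u
  ... | no ¬ru with choose-nonadjacent a S r uS (λ u v x y → one u v (there x) (there y)) lt
  ...   | S₁ , S₂ , p , k , na = u ∷ S₁ , S₂ , ↭-prep u p , cong suc k , ¬ru ∷ na
  choose-nonadjacent (suc a) (u ∷ S) r (u∉S ∷ uS) one (s≤s lt) | yes ru =
    take (suc a) S , u ∷ drop (suc a) S ,
    ↭-trans (↭-prep u (↭-reflexive (≡-sym (take++drop≡id (suc a) S)))) (↭-sym (shift u (take (suc a) S) _)) ,
    trans (length-take (suc a) S) (m≤n⇒m⊓n≡m lt) ,
    All.tabulate (λ {v} v∈ rv → All.lookup u∉S (take-⊆ (suc a) S v∈) (one u v (here refl) (there (take-⊆ (suc a) S v∈)) ru rv))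
    where
    take-⊆ : ∀ k (L : List B) {v} → v ∈ take k L → v ∈ L
    take-⊆ (suc k) (x ∷ L) (here q) = here q
    take-⊆ (suc k) (x ∷ L) (there q) = there (take-⊆ k L q)

  -- A Gallai class with 2m + 1 vertices, m = |M|, receives an independent set of size m + 1: r and
  -- m vertices of S not adjacent to r. In the charge 2|S| + |R| a vertex of S counts twice and r
  -- once, so the class absorbs a charge equal to its size and the inequality passes to the rest of
  -- the host.
  pack-class : ∀ {V x M L S S₁ S₂} r R → Unique V → (x ∷ cov M) ++ L ↭ V → Edges M →
    (∀ {y z} → y ∈ x ∷ cov M → z ∈ L → ¬ H y z) →
    Unique S → (∀ {u v} → u ∈ S → v ∈ S → ¬ Adj u v) → All (AtMostOneIn S) R →
    S ↭ S₁ ++ S₂ → length S₁ ≡ length M → All (¬_ ∘ Adj r) S₁ →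
    length S + length S + suc (length R) ≤ length V → ¬ Matching (length S) V →
    (length S₂ + length S₂ + length R < length S + length S + suc (length R) →
      Unique L → Unique S₂ → (∀ {u v} → u ∈ S₂ → v ∈ S₂ → ¬ Adj u v) → All (AtMostOneIn S₂) R →
      length S₂ + length S₂ + length R ≤ length L → ¬ Matching (length S₂) L → Placement (S₂ ++ R) L) →
    Placement (S ++ r ∷ R) V
  pack-class {V} {x} {M} {L} {S} {S₁} {S₂} r R uV V↭ hM apart uS indep one S↭ |S₁| na big none rec =
    place-resp-↭ (↭-trans (solve 4 (λ r a b c → (r ⊕ a) ⊕ (b ⊕ c) ⊜ (a ⊕ b) ⊕ (r ⊕ c)) ↭-refl [ r ] S₁ S₂ R)
        (↭-++⁺ʳ (r ∷ R) (↭-sym S↭))) ↭-refl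
      (place-apart V↭ apart
        (place-independent (r ∷ S₁) (x ∷ cov M)
          (s≤s (≤-trans (≤-reflexive |S₁|) (≤-trans (m≤m+n _ _) (≤-reflexive (≡-sym (length-cov M)))))) indep₁)
        (rec size₂ (Unique-++⁻ʳ (x ∷ cov M) uV′) (Unique-++⁻ʳ S₁ uS′)
          (λ a b → indep (inS₂ a) (inS₂ b))
          (All.map (λ f u w a b → f u w (inS₂ a) (inS₂ b)) one)
          room none₂))
    where
    uV′ : Unique ((x ∷ cov M) ++ L)
    uV′ = Unique-resp-↭ (↭-sym V↭) uV
    uS′ : Unique (S₁ ++ S₂)
    uS′ = Unique-resp-↭ S↭ uS
    inS₁ : ∀ {u} → u ∈ S₁ → u ∈ S
    inS₁ a = ∈-resp-↭ (↭-sym S↭) (∈-++⁺ˡ a)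
    inS₂ : ∀ {u} → u ∈ S₂ → u ∈ S
    inS₂ a = ∈-resp-↭ (↭-sym S↭) (∈-++⁺ʳ S₁ a)
    |S| : length S ≡ length M + length S₂
    |S| = trans (↭-length S↭) (trans (length-++ S₁) (cong (_+ length S₂) |S₁|))
    indep₁ : ∀ {u w} → u ∈ r ∷ S₁ → w ∈ r ∷ S₁ → ¬ Adj u w
    indep₁ (here refl) (here refl) = Adj-irrefl
    indep₁ (here refl) (there w∈) = All.lookup na w∈
    indep₁ (there u∈) (here refl) = All.lookup na u∈ ∘ Adj-sym
    indep₁ (there u∈) (there w∈) = indep (inS₁ u∈) (inS₁ w∈)
    expand : ∀ a b c → (a + b) + (a + b) + suc c ≡ suc (a + a) + (b + b + c)
    expand = solve-∀
    sizes : length S + length S + suc (length R) ≡ suc (length M + length M) + (length S₂ + length S₂ + length R)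
    sizes = trans (cong (λ s → s + s + suc (length R)) |S|) (expand (length M) (length S₂) (length R))
    size₂ : suc (length S₂ + length S₂ + length R) ≤ length S + length S + suc (length R)
    size₂ = ≤-trans (s≤s (m≤n+m _ (length M + length M))) (≤-reflexive (≡-sym sizes))
    room : length S₂ + length S₂ + length R ≤ length L
    room = +-cancelˡ-≤ (suc (length M + length M)) _ _ (≤-trans (≤-reflexive (≡-sym sizes))
      (≤-trans big (≤-reflexive (trans (≡-sym (↭-length V↭)) (trans (length-++ (x ∷ cov M)) (cong (λ c → suc c + length L) (length-cov M)))))))
    -- Together with M, such a matching would have |S| edges.
    none₂ : ¬ Matching (length S₂) L
    none₂ (M′ , Q , hM′ , |M′| , p) = none (M ++ M′ , x ∷ Q , Allₚ.++⁺ hM hM′ ,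
      trans (length-++ M) (trans (cong (length M +_) |M′|) (≡-sym |S|)) ,
      ↭-trans (↭-reflexive (cong (_++ x ∷ Q) (cov-++ M)))
        (↭-trans (solve 4 (λ m m′ x q → (m ⊕ m′) ⊕ (x ⊕ q) ⊜ (x ⊕ m) ⊕ (m′ ⊕ q)) ↭-refl (cov M) (cov M′) [ x ] Q)
          (↭-trans (↭-++⁺ˡ (x ∷ cov M) p) V↭)))

  demote-size : ∀ s r → suc s + suc s + r ≡ suc (s + s + suc r)
  demote-size = solve-∀

  -- The charge 2|S| + |R| is both the number of host vertices asked for and the induction measure.
  -- With S the packing and R all other vertices of G it equals n + p - 1.
  Packable : ℕ → Set
  Packable k = ∀ S R {V} → length S + length S + length R ≤ k → Unique V → Unique S →
    (∀ {u v} → u ∈ S → v ∈ S → ¬ Adj u v) → All (AtMostOneIn S) R →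
    length S + length S + length R ≤ length V → ¬ Matching (length S) V → Placement (S ++ R) V

  pack-step : ∀ k → Packable k → Packable (suc k)
  pack-step k rec [] R {V} _ _ _ _ _ _ none = ⊥-elim (none ([] , V , [] , refl , ↭-refl))
  pack-step k rec (v ∷ S) R {V} le uV (v∉S ∷ uS) indep one big none
    with all? (λ t → matchingAvoiding? [ t ] (length S) uV) V
  -- Every matching of size |S|, for S the tail, covers t. Deleting t therefore lowers the bound on
  -- matchings by one; moving v from S to R lowers the charge by one, and v has no neighbour in S.
  ... | no ¬all with find (Allₚ.¬All⇒Any¬ (λ t → matchingAvoiding? [ t ] (length S) uV) V ¬all)
  ...   | t , t∈V , essential with ∈⇒↭∷ t∈V
  ...   | V′ , V↭ = grow (rec S (v ∷ R)
          (s≤s⁻¹ (subst (_≤ suc k) (demote-size (length S) (length R)) le))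
          (tail (Unique-resp-↭ V↭ uV)) uS (λ a b → indep (there a) (there b))
          ((λ _ _ a b va _ → ⊥-elim (indep (here refl) (there a) va)) ∷ All.map (λ f u w a b → f u w (there a) (there b)) one)
          (s≤s⁻¹ (subst₂ _≤_ (demote-size (length S) (length R)) (↭-length V↭) big))
          (λ (M , Q , hM , |M| , p) → essential (M , Q , hM , |M| ,
            ↭-trans (shift t (cov M) Q) (↭-trans (↭-prep t p) (↭-sym V↭)))))
    where
    tail : ∀ {x : A} {L} → Unique (x ∷ L) → Unique L
    tail (_ ∷ u) = u
    grow : Placement (S ++ v ∷ R) V′ → Placement (v ∷ S ++ R) V
    grow (P , Q , a , b , c) = P , t ∷ Q , ↭-trans a (shift v S R) ,
      ↭-trans (shift t (map proj₂ P) Q) (↭-trans (↭-prep t b) (↭-sym V↭)) , c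
  -- Only the independent set `v ∷ S` is left to place, so any injection will do.
  pack-step k rec (v ∷ S) [] {V} le uV uS indep one big none | yes _ =
    place-independent (v ∷ S ++ []) V (≤-trans (≤-reflexive (trans (length-++ (v ∷ S)) (+-identityʳ _)))
      (≤-trans (m≤m+n _ _) (≤-trans (≤-reflexive (≡-sym (+-identityʳ _))) big)))
      (λ a b → indep (un a) (un b))
    where
    un : ∀ {u} → u ∈ (v ∷ S) ++ [] → u ∈ v ∷ S
    un a with ∈-++⁻ (v ∷ S) a
    ... | inj₁ q = q
  -- No vertex is essential, so Gallai's lemma yields a class of odd size; r takes the odd place.
  pack-step k rec (v ∷ S) (r ∷ R) {x ∷ V} le uV uS indep (one-r ∷ one) big none | yes inessential
    = let M , L , hM , |M|≤ , V↭ , apart = gallai uV none inessential (here refl)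
          S₁ , S₂ , S↭ , |S₁| , na = choose-nonadjacent (length M) (v ∷ S) r uS one-r (s≤s |M|≤)
      in pack-class r R uV V↭ hM apart uS indep one S↭ |S₁| na big none
           (λ lt uL uS₂ i o b n → rec S₂ R (s≤s⁻¹ (≤-trans lt le)) uL uS₂ i o b n)

  pack : ∀ k → Packable k
  pack zero [] R _ _ _ _ _ _ none = ⊥-elim (none ([] , _ , [] , refl , ↭-refl))
  pack zero (v ∷ S) R () _ _ _ _ _ _
  pack (suc k) = pack-step k (pack k)

-- Disjoint non-monochromatic triangles

all-pairs : {A : Set} {P : A → A → Set} (Q : List A) →
  (∀ {q q′ R} → Q ↭ q ∷ q′ ∷ R → P q q′) → AllPairs P Q
all-pairs [] _ = []
all-pairs (q ∷ Q) pick = All.tabulate (λ q′∈ → pick (↭-prep q (proj₂ (∈⇒↭∷ q′∈)))) ∷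
  all-pairs Q (λ {a} {b} {R} p → pick (↭-trans (↭-prep q p)
    (solve 4 (λ q a b r → q ⊕ (a ⊕ (b ⊕ r)) ⊜ a ⊕ (b ⊕ (r ⊕ q))) ↭-refl [ q ] [ a ] [ b ] R)))
  where open ↭-Solver

-- Disjoint edges meet Z in distinct vertices.
cover-bound : {A : Set} (Z : List A) (M : List (A × A)) → Unique (cov M) →
  All (λ (x , y) → x ∈ Z ⊎ y ∈ Z) M → length M ≤ length Z
cover-bound {A} Z M uM covered with endpoints M uM covered
  where
  endpoints : ∀ M → Unique (cov M) → All (λ (x , y) → x ∈ Z ⊎ y ∈ Z) M →
    ∃ λ E → length E ≡ length M × Unique E × All (_∈ cov M) E × All (_∈ Z) E
  endpoints [] _ [] = [] , refl , [] , [] , []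
  endpoints ((x , y) ∷ M) ((_ ∷ x∉M) ∷ (y∉M ∷ uM)) (c ∷ cs) with endpoints M uM cs | c
  ... | E , k , uE , E⊆M , E⊆Z | inj₁ x∈Z = x ∷ E , cong suc k ,
    All.map (λ v∈M → All.lookup x∉M v∈M) E⊆M ∷ uE ,
    here refl ∷ All.map (there ∘ there) E⊆M , x∈Z ∷ E⊆Z
  ... | E , k , uE , E⊆M , E⊆Z | inj₂ y∈Z = y ∷ E , cong suc k ,
    All.map (λ v∈M → All.lookup y∉M v∈M) E⊆M ∷ uE ,
    there (here refl) ∷ All.map (there ∘ there) E⊆M , y∈Z ∷ E⊆Z
... | E , k , uE , _ , E⊆Z = subst (_≤ length Z) k (unique-⊆-length uE (All.lookup E⊆Z))

verts : {A : Set} → List (A × A × A) → List A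
verts [] = []
verts ((x , y , z) ∷ T) = x ∷ y ∷ z ∷ verts T

length-verts : {A : Set} (T : List (A × A × A)) → length (verts T) ≡ length T * 3
length-verts [] = refl
length-verts (_ ∷ T) = cong (3 +_) (length-verts T)

verts-++ : {A : Set} (T : List (A × A × A)) {T′ : List (A × A × A)} → verts (T ++ T′) ≡ verts T ++ verts T′
verts-++ [] = refl
verts-++ (_ ∷ T) = cong (λ l → _ ∷ _ ∷ _ ∷ l) (verts-++ T)

-- A cherry is a triangle that is not monochromatic, given by its three vertices.
module Cherries {A C : Set} (_≟_ : DecidableEquality A) (search : Searchable A)
  (_≟ᶜ_ : DecidableEquality C) (f : A → A → C) (f-sym : ∀ x y → f x y ≡ f y x) where

  open import Data.List.Membership.DecPropositional _≟_ using (_∈?_)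
  open import Data.List.Relation.Unary.Unique.DecPropositional _≟_ using (unique?)
  open ↭-Solver

  Mono : A → A → A → Set
  Mono x y z = f x y ≡ f x z × f x y ≡ f y z

  mono? : ∀ x y z → Dec (Mono x y z)
  mono? x y z = (f x y ≟ᶜ f x z) ×-dec (f x y ≟ᶜ f y z)

  Coloured : List (A × A × A) → Set
  Coloured = All (λ (x , y , z) → ¬ Mono x y z)

  CherriesIn : ℕ → List A → Set
  CherriesIn s V = ∃₂ λ T R → Coloured T × length T ≡ s × verts T ++ R ↭ V

  cherriesIn-resp-↭ : ∀ {s V V′} → V ↭ V′ → CherriesIn s V → CherriesIn s V′
  cherriesIn-resp-↭ q (T , R , a , b , c) = T , R , a , b , ↭-trans c q

  Monochromatic : C → List A → Set
  Monochromatic κ V = ∀ {x y} → x ∈ V → y ∈ V → x ≢ y → f x y ≡ κ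

  -- If every triangle is monochromatic, edges with a common vertex agree in colour, and passing
  -- through o compares any edge with oo′.
  cherry-or-mono : ∀ {V} → Unique V → 2 ≤ length V →
    (∃₂ λ x y → ∃₂ λ z R → ¬ Mono x y z × x ∷ y ∷ z ∷ R ↭ V) ⊎ ∃ λ κ → Monochromatic κ V
  cherry-or-mono {V@(o ∷ o′ ∷ _)} uV@((o≢o′ ∷ _) ∷ _) (s≤s (s≤s _))
    with search-× search (search-× search search)
      {P = λ (x , y , z) → ¬ Mono x y z × Unique (x ∷ y ∷ z ∷ []) × All (_∈ V) (x ∷ y ∷ z ∷ [])}
      (λ (x , y , z) → ¬? (mono? x y z) ×-dec unique? _ ×-dec all? (_∈? V) _)
  ... | yes ((x , y , z) , good , u , s) with complement (x ∷ y ∷ z ∷ []) V u (All.lookup s)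
  ...   | R , p = inj₁ (x , y , z , R , good , p)
  cherry-or-mono {V@(o ∷ o′ ∷ _)} uV@((o≢o′ ∷ _) ∷ _) (s≤s (s≤s _)) | no none = inj₂ (f o o′ , constant)
    where
    link : ∀ {a b c} → a ∈ V → b ∈ V → c ∈ V → a ≢ b → a ≢ c → f a b ≡ f a c
    link {a} {b} {c} a∈ b∈ c∈ a≢b a≢c with b ≟ c
    ... | yes refl = refl
    ... | no b≢c with mono? a b c
    ...   | yes (q , _) = q
    ...   | no ¬m = ⊥-elim (none ((a , b , c) , ¬m , (a≢b ∷ a≢c ∷ []) ∷ (b≢c ∷ []) ∷ [] ∷ [] , a∈ ∷ b∈ ∷ c∈ ∷ []))
    o∈ : o ∈ V
    o∈ = here refl
    o′∈ : o′ ∈ V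
    o′∈ = there (here refl)
    constant : Monochromatic (f o o′) V
    constant {x} {y} x∈ y∈ x≢y with x ≟ o
    ... | yes refl = link x∈ y∈ o′∈ x≢y o≢o′
    ... | no x≢o = trans (link x∈ y∈ o∈ x≢y x≢o) (trans (f-sym x o) (link o∈ x∈ o′∈ (x≢o ∘ ≡-sym) o≢o′))

  module Colour (κ : C) where

    H : A → A → Set
    H x y = f x y ≢ κ

    H? : ∀ x y → Dec (H x y)
    H? x y = ¬? (f x y ≟ᶜ κ)

    H-sym : ∀ {x y} → H x y → H y x
    H-sym {x} {y} h q = h (trans (f-sym x y) q)

    open Matchings _≟_ search H H? H-sym public

    ¬H⇒≡ : ∀ {x y} → ¬ H x y → f x y ≡ κ
    ¬H⇒≡ {x} {y} ¬h with f x y ≟ᶜ κ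
    ... | yes q = q
    ... | no h = ⊥-elim (¬h h)

    FewBad : List A → A × A → Set
    FewBad Q (x , y) = AllPairs (λ q q′ → ¬ (Mono x y q × Mono x y q′)) Q

    -- Were xyq and xyq′ both monochromatic, xq and yq′ would avoid κ like xy, and replacing xy by
    -- these two would enlarge the matching.
    few-bad : ∀ {M Q V} → Edges M → cov M ++ Q ↭ V → ¬ Matching (suc (length M)) V → All (FewBad Q) M
    few-bad {M} {Q} {V} hM p maximum = All.tabulate λ {e} e∈ → all-pairs Q (conflict e∈)
      where
      conflict : ∀ {x y q q′ R} → (x , y) ∈ M → Q ↭ q ∷ q′ ∷ R → ¬ (Mono x y q × Mono x y q′)
      conflict {x} {y} {q} {q′} {R} e∈ pQ ((m₁ , _) , (_ , m₂)) with ∈⇒↭∷ e∈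
      ... | M′ , pM with All-resp-↭ pM hM
      ... | h ∷ hM′ = maximum ((x , q) ∷ (y , q′) ∷ M′ , R ,
        (λ r → h (trans m₁ r)) ∷ (λ r → h (trans m₂ r)) ∷ hM′ ,
        cong suc (≡-sym (↭-length pM)) ,
        ↭-trans (solve 6 (λ x q y q′ m r → x ⊕ (q ⊕ (y ⊕ (q′ ⊕ (m ⊕ r)))) ⊜ (x ⊕ (y ⊕ m)) ⊕ (q ⊕ (q′ ⊕ r))) ↭-refl
            [ x ] [ q ] [ y ] [ q′ ] (cov M′) R)
          (↭-trans (↭-++⁺ (↭-sym (cov-↭ pM)) (↭-sym pQ)) p))

    unmatched-κ : ∀ {M V q q′ R} → Edges M → cov M ++ q ∷ q′ ∷ R ↭ V → ¬ Matching (suc (length M)) V → f q q′ ≡ κ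
    unmatched-κ {M} {V} {q} {q′} {R} hM p maximum = ¬H⇒≡ λ h → maximum ((q , q′) ∷ M , R , h ∷ hM , refl ,
      ↭-trans (solve 4 (λ q q′ m r → q ⊕ (q′ ⊕ (m ⊕ r)) ⊜ m ⊕ (q ⊕ (q′ ⊕ r))) ↭-refl [ q ] [ q′ ] (cov M) R) p)

    greedy : ∀ M Q → All (FewBad Q) M → length M < length Q →
      ∃₂ λ T q → ∃ λ Q′ → Coloured T × length T ≡ length M × verts T ++ q ∷ Q′ ↭ cov M ++ Q × q ∈ Q
    greedy [] (q ∷ Q) _ _ = [] , q , Q , [] , refl , ↭-refl , here refl
    greedy ((x , y) ∷ M) (q₁ ∷ q₂ ∷ Q) ((( ¬both ∷ _) ∷ _) ∷ few) (s≤s lt) with mono? x y q₁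
    ... | no good with greedy M (q₂ ∷ Q) (All.map (λ { (_ ∷ a) → a }) few) lt
    ...   | T , q , Q′ , cT , k , p , q∈ = (x , y , q₁) ∷ T , q , Q′ , good ∷ cT , cong suc k ,
      ↭-trans (↭-prep x (↭-prep y (↭-prep q₁ p)))
        (↭-prep x (↭-prep y (↭-sym (shift q₁ (cov M) (q₂ ∷ Q))))) , there q∈
    greedy ((x , y) ∷ M) (q₁ ∷ q₂ ∷ Q) (((¬both ∷ _) ∷ _) ∷ few) (s≤s lt) | yes bad₁
      with greedy M (q₁ ∷ Q) (All.map (λ { ((_ ∷ a) ∷ _ ∷ b) → a ∷ b }) few) lt
    ... | T , q , Q′ , cT , k , p , q∈ = (x , y , q₂) ∷ T , q , Q′ , (λ bad₂ → ¬both (bad₁ , bad₂)) ∷ cT , cong suc k ,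
      ↭-trans (↭-prep x (↭-prep y (↭-prep q₂ p)))
        (solve 6 (λ x y a b m r → x ⊕ (y ⊕ (b ⊕ (m ⊕ (a ⊕ r)))) ⊜ x ⊕ (y ⊕ (m ⊕ (a ⊕ (b ⊕ r))))) ↭-refl
          [ x ] [ y ] [ q₁ ] [ q₂ ] (cov M) Q) ,
      insert q∈
      where
      insert : ∀ {q} → q ∈ q₁ ∷ Q → q ∈ q₁ ∷ q₂ ∷ Q
      insert (here r) = here r
      insert (there r) = there (there r)

    zip-all : ∀ M Q → All (λ (x , y) → All (λ q → ¬ Mono x y q) Q) M → length M ≤ length Q →
      ∃₂ λ T Q′ → Coloured T × length T ≡ length M × verts T ++ Q′ ↭ cov M ++ Q
    zip-all [] Q _ _ = [] , Q , [] , refl , ↭-refl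
    zip-all ((x , y) ∷ M) (q ∷ Q) ((g ∷ _) ∷ gs) (s≤s le) with zip-all M Q (All.map (λ { (_ ∷ a) → a }) gs) le
    ... | T , Q′ , cT , k , p = (x , y , q) ∷ T , Q′ , g ∷ cT , cong suc k ,
      ↭-prep x (↭-prep y (↭-trans (↭-prep q p) (↭-sym (shift q (cov M) Q))))

module DisjointCherries {A C : Set} (_≟_ : DecidableEquality A) (search : Searchable A)
  (_≟ᶜ_ : DecidableEquality C) (f : A → A → C) (f-sym : ∀ x y → f x y ≡ f y x) where

  open Cherries _≟_ search _≟ᶜ_ f f-sym public
  open ↭-Solver

  module _ (κ : C) where

    open Colour κ

    delete-vertex : ∀ {k w W} → Matching k (w ∷ W) → Matching k W ⊎
      (∃₂ λ b N → ∃ λ P → H w b × Edges N × suc (length N) ≡ k × b ∷ cov N ++ P ↭ W)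
    delete-vertex {w = w} (M , R , hM , k , p) with ∈-++⁻ (cov M) (∈-resp-↭ (↭-sym p) (here refl))
    ... | inj₁ w∈M with extract H-sym hM w∈M
    ...   | b , N , h , hN , |M| , pM = inj₂ (b , N , R , h , hN , trans (≡-sym |M|) k ,
      drop-∷ (↭-trans (↭-++⁺ʳ R (↭-sym pM)) p))
    delete-vertex {w = w} (M , R , hM , k , p) | inj₂ w∈R with ∈⇒↭∷ w∈R
    ... | R′ , q = inj₁ (M , R′ , hM , k ,
      drop-∷ (↭-trans (↭-sym (shift w (cov M) R′)) (↭-trans (↭-++⁺ˡ (cov M) (↭-sym q)) p)))

    lose-edge : ∀ {k W} → Matching (suc k) W → Matching k W
    lose-edge (((x , y) ∷ M) , R , _ ∷ hM , k , p) = M , x ∷ y ∷ R , hM , suc-injective k ,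
      ↭-trans (solve 4 (λ x y m r → m ⊕ (x ⊕ (y ⊕ r)) ⊜ x ⊕ (y ⊕ (m ⊕ r))) ↭-refl [ x ] [ y ] (cov M) R) p

    lose-vertex : ∀ {k w W} → Matching (suc k) (w ∷ W) → Matching k W
    lose-vertex m with delete-vertex m
    ... | inj₁ m′ = lose-edge m′
    ... | inj₂ (b , N , P , _ , hN , k , p) = N , b ∷ P , hN , suc-injective k ,
      ↭-trans (shift b (cov N) P) p

    gain-vertex : ∀ {k w W V} → V ↭ w ∷ W → Matching k W → Matching k V
    gain-vertex {w = w} q (M , R , hM , k , p) = M , w ∷ R , hM , k ,
      ↭-trans (shift w (cov M) R) (↭-trans (↭-prep w p) (↭-sym q))

    -- A matching larger by two than every matching avoiding a₁, a₂, a₃ must join each aᵢ to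
    -- a separate vertex outside.
    three-partners : ∀ {a₁ a₂ a₃ V s} → Matching (2 + s) (a₁ ∷ a₂ ∷ a₃ ∷ V) → ¬ Matching s V →
      ∃₂ λ b₁ b₂ → ∃₂ λ b₃ N → ∃ λ Q → H a₁ b₁ × H a₂ b₂ × H a₃ b₃ × Edges N × suc (length N) ≡ s ×
        b₁ ∷ b₂ ∷ b₃ ∷ cov N ++ Q ↭ V
    three-partners {a₁} {a₂} {a₃} {V} {s} m none = first (delete-vertex m)
      where
      third : ∀ {V₁ V₂ b₁ b₂} → H a₁ b₁ → H a₂ b₂ → V ↭ b₁ ∷ V₁ → V₁ ↭ b₂ ∷ V₂ →
        Matching s V₂ ⊎ (∃₂ λ b N → ∃ λ P → H a₃ b × Edges N × suc (length N) ≡ s × b ∷ cov N ++ P ↭ V₂) → _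
      third h₁ h₂ p₁ p₂ (inj₁ m₃) = ⊥-elim (none (gain-vertex p₁ (gain-vertex p₂ m₃)))
      third {b₁ = b₁} {b₂} h₁ h₂ p₁ p₂ (inj₂ (b₃ , N , Q , h₃ , hN , k , p)) = b₁ , b₂ , b₃ , N , Q , h₁ , h₂ , h₃ , hN , k ,
        ↭-trans (↭-prep b₁ (↭-trans (↭-prep b₂ p) (↭-sym p₂))) (↭-sym p₁)
      second : ∀ {V₁ b₁} → H a₁ b₁ → V ↭ b₁ ∷ V₁ → Matching (suc s) (a₃ ∷ V₁) ⊎
        (∃₂ λ b N → ∃ λ P → H a₂ b × Edges N × suc (length N) ≡ suc s × b ∷ cov N ++ P ↭ a₃ ∷ V₁) → _
      second h₁ p₁ (inj₁ m₂) = ⊥-elim (none (gain-vertex p₁ (lose-vertex m₂)))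
      second h₁ p₁ (inj₂ (b₂ , N , P , h₂ , hN , k , p)) with ∈-resp-↭ p (here refl)
      ... | here refl = ⊥-elim (none (gain-vertex p₁ (N , P , hN , suc-injective k , drop-∷ p)))
      ... | there b₂∈ with ∈⇒↭∷ b₂∈
      ...   | V₂ , p₂ = third h₁ h₂ p₁ p₂ (delete-vertex (N , P , hN , suc-injective k ,
                drop-∷ (↭-trans p (↭-trans (↭-prep a₃ p₂) (↭-swap a₃ b₂ ↭-refl)))))
      first : Matching (2 + s) (a₂ ∷ a₃ ∷ V) ⊎
        (∃₂ λ b N → ∃ λ P → H a₁ b × Edges N × suc (length N) ≡ 2 + s × b ∷ cov N ++ P ↭ a₂ ∷ a₃ ∷ V) → _
      first (inj₁ m₁) = ⊥-elim (none (lose-vertex (lose-vertex m₁)))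
      first (inj₂ (b₁ , N , P , h₁ , hN , k , p)) with ∈-resp-↭ p (here refl)
      ... | here refl = ⊥-elim (none (lose-vertex (N , P , hN , suc-injective k , drop-∷ p)))
      ... | there (here refl) = ⊥-elim (none (lose-vertex (N , P , hN , suc-injective k ,
              drop-∷ (↭-trans p (↭-swap a₂ a₃ ↭-refl)))))
      ... | there (there b₁∈) with ∈⇒↭∷ b₁∈
      ...   | V₁ , p₁ = second h₁ p₁ (delete-vertex (N , P , hN , suc-injective k ,
                drop-∷ (↭-trans p (↭-trans (↭-prep a₂ (↭-prep a₃ p₁))
                  (solve 4 (λ a b c v → a ⊕ (b ⊕ (c ⊕ v)) ⊜ c ⊕ (a ⊕ (b ⊕ v))) ↭-refl [ a₂ ] [ a₃ ] [ b₁ ] V₁)))))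

    serve-hub : ∀ {V a b a′ b′ a″ b″ N Q} → a ∷ b ∷ a′ ∷ b′ ∷ a″ ∷ b″ ∷ cov N ++ Q ↭ V →
      H a″ b″ → All (λ q → f b″ q ≡ κ) (b ∷ Q) → All (FewBad (b ∷ Q)) N → length N ≤ length Q →
      ¬ Mono a a′ b′ → CherriesIn (2 + length N) V
    serve-hub {V} {a} {b} {a′} {b′} {a″} {b″} {N} {Q} p h b″κ few le good with greedy N (b ∷ Q) few (s≤s le)
    ... | T , q , Q′ , cT , k , pT , q∈ = (a , a′ , b′) ∷ (a″ , b″ , q) ∷ T , Q′ ,
      good ∷ (λ (_ , r) → h (trans r (All.lookup b″κ q∈))) ∷ cT , cong (2 +_) k ,
      ↭-trans (solve 8 (λ a a′ b′ a″ b″ q t r → a ⊕ (a′ ⊕ (b′ ⊕ (a″ ⊕ (b″ ⊕ (q ⊕ (t ⊕ r)))))) ⊜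
          a ⊕ (a′ ⊕ (b′ ⊕ (a″ ⊕ (b″ ⊕ (t ⊕ (q ⊕ r))))))) ↭-refl [ a ] [ a′ ] [ b′ ] [ a″ ] [ b″ ] [ q ] (verts T) Q′)
        (↭-trans (↭-prep a (↭-prep a′ (↭-prep b′ (↭-prep a″ (↭-prep b″ pT)))))
          (↭-trans (solve 8 (λ a b a′ b′ a″ b″ n q → a ⊕ (a′ ⊕ (b′ ⊕ (a″ ⊕ (b″ ⊕ (n ⊕ (b ⊕ q)))))) ⊜
              a ⊕ (b ⊕ (a′ ⊕ (b′ ⊕ (a″ ⊕ (b″ ⊕ (n ⊕ q))))))) ↭-refl [ a ] [ b ] [ a′ ] [ b′ ] [ a″ ] [ b″ ] (cov N) Q) p))

    -- Three new vertices raise the matching number by three, the most possible, so each has its own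
    -- partner bᵢ; as N is maximum in V, the bᵢ and Q are joined by κ only. Then some edge of the
    -- hub forms a cherry with a partner of one of its ends, and `serve-hub` supplies the others.
    cherries-through-hub : ∀ {a₁ a₂ a₃ V s} → ¬ Mono a₁ a₂ a₃ → (2 + s) * 3 ≤ 3 + length V →
      Matching (3 + s) (a₁ ∷ a₂ ∷ a₃ ∷ V) → ¬ Matching (suc s) V → CherriesIn (2 + s) (a₁ ∷ a₂ ∷ a₃ ∷ V)
    cherries-through-hub {a₁} {a₂} {a₃} {V} {s} ¬mono big m none
      with three-partners m none
    ... | b₁ , b₂ , b₃ , N , Q , h₁ , h₂ , h₃ , hN , k , p =
      subst (λ s → CherriesIn (2 + s) _) |N| (choose (mono? a₁ a₂ b₂) (mono? a₁ a₃ b₃) (mono? a₂ a₃ b₃) (mono? a₃ a₂ b₂))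
      where
      |N| : length N ≡ s
      |N| = suc-injective k
      |Q| : length N ≤ length Q
      |Q| = subst (_≤ length Q) (≡-sym |N|) (+-cancelˡ-≤ (s + s + 6) s (length Q)
        (≤-trans (≤-reflexive (lem₁ s)) (≤-trans big (≤-reflexive (trans (cong (3 +_) (trans (≡-sym (↭-length p))
          (cong (3 +_) (trans (length-++ (cov N)) (cong (_+ length Q) (trans (length-cov N) (cong (λ t → t + t) |N|)))))))
            (lem₂ s (length Q)))))))
        where
        lem₁ : ∀ s → s + s + 6 + s ≡ (2 + s) * 3
        lem₁ = solve-∀
        lem₂ : ∀ s q → 3 + (3 + (s + s + q)) ≡ s + s + 6 + q
        lem₂ = solve-∀
      p₁ : cov N ++ b₁ ∷ b₂ ∷ b₃ ∷ Q ↭ V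
      p₁ = ↭-trans (solve 5 (λ n a b c q → n ⊕ (a ⊕ (b ⊕ (c ⊕ q))) ⊜ a ⊕ (b ⊕ (c ⊕ (n ⊕ q)))) ↭-refl (cov N) [ b₁ ] [ b₂ ] [ b₃ ] Q) p
      maximum : ¬ Matching (suc (length N)) V
      maximum = subst (λ t → ¬ Matching t V) (≡-sym k) none
      free : ∀ {q q′ R} → b₁ ∷ b₂ ∷ b₃ ∷ Q ↭ q ∷ q′ ∷ R → f q q′ ≡ κ
      free r = unmatched-κ hN (↭-trans (↭-++⁺ˡ (cov N) (↭-sym r)) p₁) maximum
      few : All (FewBad (b₁ ∷ b₂ ∷ b₃ ∷ Q)) N
      few = few-bad hN p₁ maximum
      few₁ : All (FewBad (b₁ ∷ Q)) N
      few₁ = All.map (λ { ((_ ∷ _ ∷ a) ∷ _ ∷ _ ∷ b) → a ∷ b }) few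
      few₂ : All (FewBad (b₂ ∷ Q)) N
      few₂ = All.map (λ { (_ ∷ (_ ∷ a) ∷ _ ∷ b) → a ∷ b }) few
      few₃ : All (FewBad (b₃ ∷ Q)) N
      few₃ = All.map (λ { (_ ∷ _ ∷ b) → b }) few
      κ₁₂ : f b₁ b₂ ≡ κ
      κ₁₂ = free ↭-refl
      κ₁₃ : f b₁ b₃ ≡ κ
      κ₁₃ = free (↭-prep b₁ (↭-swap b₂ b₃ ↭-refl))
      κ₁ : All (λ q → f b₁ q ≡ κ) Q
      κ₁ = All.tabulate λ {q} q∈ → let Q′ , r = ∈⇒↭∷ q∈ in free (↭-trans (↭-prep b₁ (↭-prep b₂ (↭-prep b₃ r)))
        (solve 5 (λ a b c x q → a ⊕ (b ⊕ (c ⊕ (x ⊕ q))) ⊜ a ⊕ (x ⊕ (b ⊕ (c ⊕ q)))) ↭-refl [ b₁ ] [ b₂ ] [ b₃ ] [ q ] Q′))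
      κ₂ : All (λ q → f b₂ q ≡ κ) Q
      κ₂ = All.tabulate λ {q} q∈ → let Q′ , r = ∈⇒↭∷ q∈ in free (↭-trans (↭-prep b₁ (↭-prep b₂ (↭-prep b₃ r)))
        (solve 5 (λ a b c x q → a ⊕ (b ⊕ (c ⊕ (x ⊕ q))) ⊜ b ⊕ (x ⊕ (a ⊕ (c ⊕ q)))) ↭-refl [ b₁ ] [ b₂ ] [ b₃ ] [ q ] Q′))
      κ₃ : All (λ q → f b₃ q ≡ κ) Q
      κ₃ = All.tabulate λ {q} q∈ → let Q′ , r = ∈⇒↭∷ q∈ in free (↭-trans (↭-prep b₁ (↭-prep b₂ (↭-prep b₃ r)))
        (solve 5 (λ a b c x q → a ⊕ (b ⊕ (c ⊕ (x ⊕ q))) ⊜ c ⊕ (x ⊕ (a ⊕ (b ⊕ q)))) ↭-refl [ b₁ ] [ b₂ ] [ b₃ ] [ q ] Q′))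
      rev : ∀ {u v} → f u v ≡ κ → f v u ≡ κ
      rev {u} {v} = trans (f-sym v u)
      arrange : ∀ {L} → L ↭ a₁ ∷ a₂ ∷ a₃ ∷ b₁ ∷ b₂ ∷ b₃ ∷ cov N ++ Q → L ↭ a₁ ∷ a₂ ∷ a₃ ∷ V
      arrange r = ↭-trans r (↭-prep a₁ (↭-prep a₂ (↭-prep a₃ p)))
      choose : Dec (Mono a₁ a₂ b₂) → Dec (Mono a₁ a₃ b₃) → Dec (Mono a₂ a₃ b₃) → Dec (Mono a₃ a₂ b₂) →
        CherriesIn (2 + length N) (a₁ ∷ a₂ ∷ a₃ ∷ V)
      choose (no g) _ _ _ = serve-hub {a = a₁} {b = b₁} (arrange (solve 7 (λ a b c x y z n →
          a ⊕ (x ⊕ (b ⊕ (y ⊕ (c ⊕ (z ⊕ n))))) ⊜ a ⊕ (b ⊕ (c ⊕ (x ⊕ (y ⊕ (z ⊕ n)))))) ↭-refl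
          [ a₁ ] [ a₂ ] [ a₃ ] [ b₁ ] [ b₂ ] [ b₃ ] (cov N ++ Q))) h₃ (rev κ₁₃ ∷ κ₃) few₁ |Q| g
      choose _ (no g) _ _ = serve-hub {a = a₁} {b = b₁} (arrange (solve 7 (λ a b c x y z n →
          a ⊕ (x ⊕ (c ⊕ (z ⊕ (b ⊕ (y ⊕ n))))) ⊜ a ⊕ (b ⊕ (c ⊕ (x ⊕ (y ⊕ (z ⊕ n)))))) ↭-refl
          [ a₁ ] [ a₂ ] [ a₃ ] [ b₁ ] [ b₂ ] [ b₃ ] (cov N ++ Q))) h₂ (rev κ₁₂ ∷ κ₂) few₁ |Q| g
      choose _ _ (no g) _ = serve-hub {a = a₂} {b = b₂} (arrange (solve 7 (λ a b c x y z n →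
          b ⊕ (y ⊕ (c ⊕ (z ⊕ (a ⊕ (x ⊕ n))))) ⊜ a ⊕ (b ⊕ (c ⊕ (x ⊕ (y ⊕ (z ⊕ n)))))) ↭-refl
          [ a₁ ] [ a₂ ] [ a₃ ] [ b₁ ] [ b₂ ] [ b₃ ] (cov N ++ Q))) h₁ (κ₁₂ ∷ κ₁) few₂ |Q| g
      choose _ _ _ (no g) = serve-hub {a = a₃} {b = b₃} (arrange (solve 7 (λ a b c x y z n →
          c ⊕ (z ⊕ (b ⊕ (y ⊕ (a ⊕ (x ⊕ n))))) ⊜ a ⊕ (b ⊕ (c ⊕ (x ⊕ (y ⊕ (z ⊕ n)))))) ↭-refl
          [ a₁ ] [ a₂ ] [ a₃ ] [ b₁ ] [ b₂ ] [ b₃ ] (cov N ++ Q))) h₁ (κ₁₃ ∷ κ₁) few₃ |Q| g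
      -- If all four triangles were monochromatic, a₁a₂ and a₂a₃ would agree with a₂b₂, and a₁a₃ and
      -- a₂a₃ with a₃b₃, making the hub monochromatic.
      choose (yes (_ , q₁)) (yes (_ , q₂)) (yes (_ , q₃)) (yes (_ , q₄)) = ⊥-elim (¬mono
        ( trans q₁ (trans (≡-sym q₄) (trans (f-sym a₃ a₂) (trans q₃ (≡-sym q₂))))
        , trans q₁ (trans (≡-sym q₄) (f-sym a₃ a₂))))

module FullCherries {A C : Set} (_≟_ : DecidableEquality A) (search : Searchable A)
  (_≟ᶜ_ : DecidableEquality C) (f : A → A → C) (f-sym : ∀ x y → f x y ≡ f y x) where

  open DisjointCherries _≟_ search _≟ᶜ_ f f-sym public
  open ↭-Solver

  mono-swap : ∀ {x y q} → Mono x y q → Mono y x q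
  mono-swap {x} {y} (a , b) = trans (f-sym y x) b , trans (f-sym y x) a

  module _ (κ : C) where

    open Colour κ

    -- V has exactly 3|M| vertices and q is bad for every edge of M, so no assignment of unmatched
    -- vertices to edges works. In return `few-bad` makes all other unmatched vertices good for
    -- every edge, as recorded by `K`.
    module SharedBad {V M} {q : A} {Q : List A} (uV : Unique V) (hM : Edges M)
      (p : cov M ++ q ∷ Q ↭ V) (maximum : ¬ Matching (suc (length M)) V)
      (|M| : length M ≡ suc (length Q)) (bad : All (λ (x , y) → Mono x y q) M) where

      K : A → A → Set
      K x y = f x y ≢ κ × Mono x y q × All (λ q′ → ¬ Mono x y q′) Q

      K-sym : ∀ {x y} → K x y → K y x
      K-sym (h , m , g) = H-sym h , mono-swap m , All.map (λ a b → a (mono-swap b)) g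

      kM : All (uncurry K) M
      kM = All.tabulate λ {e} e∈ → All.lookup hM e∈ , All.lookup bad e∈ ,
        All.map (λ nb m → nb (All.lookup bad e∈ , m)) (AllPairs.head (All.lookup (few-bad hM p maximum) e∈))

      -- The edges uu′ and vv′ are broken up into u v v′ and u′ q q′: u′q has the colour of uu′,
      -- which is not κ, whereas qq′ has colour κ. The remaining edges take the remaining vertices
      -- in any order.
      reroute : ∀ {u u′ v v′ M″} → cov M ↭ u ∷ u′ ∷ v ∷ v′ ∷ cov M″ → suc (suc (length M″)) ≡ length M →
        K u u′ → All (uncurry K) M″ → ¬ Mono u v v′ → CherriesIn (length M) V
      reroute {u} {u′} {v} {v′} {M″} pM k (h , m , _) kM″ good = go Q refl
        where
        go : ∀ Q′ → Q ≡ Q′ → CherriesIn (length M) V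
        go [] refl = ⊥-elim (0≢1+n (suc-injective (trans (≡-sym |M|) (≡-sym k))))
        go (q′ ∷ Q′) refl with zip-all M″ Q′ (All.map (λ (_ , _ , g) → All.tail g) kM″)
            (≤-reflexive (suc-injective (suc-injective (trans k |M|))))
        ... | T , R , cT , |T| , pT = (u , v , v′) ∷ (u′ , q , q′) ∷ T , R ,
          good ∷ (λ (_ , b) → h (trans (proj₂ m) (trans b qq′))) ∷ cT ,
          trans (cong (2 +_) |T|) k ,
          ↭-trans (↭-prep u (↭-prep v (↭-prep v′ (↭-prep u′ (↭-prep q (↭-prep q′ pT))))))
            (↭-trans (solve 8 (λ u v v′ u′ q q′ m r → u ⊕ (v ⊕ (v′ ⊕ (u′ ⊕ (q ⊕ (q′ ⊕ (m ⊕ r)))))) ⊜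
                (u ⊕ (u′ ⊕ (v ⊕ (v′ ⊕ m)))) ⊕ (q ⊕ (q′ ⊕ r))) ↭-refl [ u ] [ v ] [ v′ ] [ u′ ] [ q ] [ q′ ] (cov M″) Q′)
              (↭-trans (↭-++⁺ʳ (q ∷ q′ ∷ Q′) (↭-sym pM)) p))
          where
          qq′ : f q q′ ≡ κ
          qq′ = unmatched-κ hM p maximum

      coloured? : ∀ c u v → Dec (u ≢ v → f u v ≡ c)
      coloured? c u v with u ≟ v | f u v ≟ᶜ c
      ... | yes q | _ = yes (λ r → ⊥-elim (r q))
      ... | no _ | yes q = yes (λ _ → q)
      ... | no r | no s = no (λ t → s (t r))

      -- If all edges within `cov M` have colour c, so do those to q, and every edge of another
      -- colour meets Q; since |Q| < |M|, the colour c gives the second alternative. Otherwise some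
      -- uv has another colour, and rerouting works because vv′ has colour c.
      one-colour : ∀ c → All (λ (x , y) → f x y ≡ c) M → CherriesIn (length M) V ⊎
        ∃ λ c → ¬ Colour.Matching c (length M) V
      one-colour c edges-c with all? (λ u → all? (coloured? c u) (cov M)) (cov M)
      ... | yes clique = inj₂ (c , λ (N , R , hN , |N| , pN) →
              <⇒≱ (≤-reflexive (≡-sym |M|)) (subst (_≤ length Q) |N| (cover-bound Q N
                (Unique-++⁻ˡ (cov N) (Unique-resp-↭ (↭-sym pN) uV)) (All.tabulate (touches hN pN)))))
        where
        kcM : All (λ e → uncurry K e × uncurry (λ x y → f x y ≡ c) e) M
        kcM = All.tabulate λ e∈ → All.lookup kM e∈ , All.lookup edges-c e∈
        to-q : ∀ {a} → a ∈ cov M → f a q ≡ c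
        to-q {a} a∈ with extract {H = λ x y → K x y × f x y ≡ c} (λ {x} {y} (k , r) → K-sym k , trans (f-sym y x) r) kcM a∈
        ... | _ , _ , ((_ , m , _) , r) , _ = trans (≡-sym (proj₁ m)) r
        data Place (a : A) : Set where
          inM : a ∈ cov M → Place a
          isq : a ≡ q → Place a
          inQ : a ∈ Q → Place a
        place : ∀ {a} → a ∈ V → Place a
        place a∈ with ∈-++⁻ (cov M) (∈-resp-↭ (↭-sym p) a∈)
        ... | inj₁ r = inM r
        ... | inj₂ (here r) = isq r
        ... | inj₂ (there r) = inQ r
        touches : ∀ {N R} → Colour.Edges c N → cov N ++ R ↭ V → ∀ {e} → e ∈ N → proj₁ e ∈ Q ⊎ proj₂ e ∈ Q
        touches {N} {R} hN pN {a , b} e∈ with ∈⇒↭∷ e∈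
        ... | N′ , r with ↭-trans (↭-++⁺ʳ R (cov-↭ (↭-sym r))) pN
        ... | r′ with Unique-resp-↭ (↭-sym r′) uV
        ... | (a≢b ∷ _) ∷ _ with place (∈-resp-↭ r′ (here refl)) | place (∈-resp-↭ r′ (there (here refl)))
        ...   | inQ a∈ | _ = inj₁ a∈
        ...   | _ | inQ b∈ = inj₂ b∈
        ...   | inM a∈ | inM b∈ = ⊥-elim (All.lookup hN e∈ (All.lookup (All.lookup clique a∈) b∈ a≢b))
        ...   | inM a∈ | isq refl = ⊥-elim (All.lookup hN e∈ (to-q a∈))
        ...   | isq refl | inM b∈ = ⊥-elim (All.lookup hN e∈ (trans (f-sym a b) (to-q b∈)))
        ...   | isq refl | isq refl = ⊥-elim (a≢b refl)
      ... | no ¬clique with find (Allₚ.¬All⇒Any¬ (λ u → all? (coloured? c u) (cov M)) (cov M) ¬clique)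
      ... | u , u∈ , ¬u with find (Allₚ.¬All⇒Any¬ (coloured? c u) (cov M) ¬u)
      ... | v , v∈ , ¬uv with extract {H = λ x y → K x y × f x y ≡ c} (λ {x} {y} (k , r) → K-sym k , trans (f-sym y x) r)
              (All.tabulate λ e∈ → All.lookup kM e∈ , All.lookup edges-c e∈) u∈
      ... | u′ , M₁ , (k , r) , kM₁ , |M₁| , p₁ with ∈-resp-↭ p₁ v∈
      ...   | here refl = ⊥-elim (¬uv (λ q → ⊥-elim (q refl)))
      ...   | there (here refl) = ⊥-elim (¬uv (λ _ → r))
      ...   | there (there v∈₁) with extract {H = λ x y → K x y × f x y ≡ c} (λ {x} {y} (k , r) → K-sym k , trans (f-sym y x) r) kM₁ v∈₁
      ...     | v′ , M₂ , (k′ , r′) , kM₂ , |M₂| , p₂ = inj₁ (reroute (↭-trans p₁ (↭-prep u (↭-prep u′ p₂)))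
                (≡-sym (trans |M₁| (cong suc |M₂|))) k (All.map proj₁ kM₂)
                (λ (_ , b) → ¬uv (λ _ → trans b r′)))

      shared-bad : CherriesIn (length M) V ⊎ ∃ λ c → ¬ Colour.Matching c (length M) V
      shared-bad = go M refl
        where
        go : ∀ M′ → M ≡ M′ → CherriesIn (length M) V ⊎ ∃ λ c → ¬ Colour.Matching c (length M) V
        go [] refl = ⊥-elim (0≢1+n |M|)
        go ((x₁ , y₁) ∷ M′) refl with all? (λ (x , y) → f x y ≟ᶜ f x₁ y₁) M′
        ... | yes same = one-colour (f x₁ y₁) (refl ∷ same)
        ... | no differ with find (Allₚ.¬All⇒Any¬ (λ (x , y) → f x y ≟ᶜ f x₁ y₁) M′ differ)
        ... | (x₂ , y₂) , e∈ , ≢₁ with ∈⇒↭∷ e∈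
        ... | M″ , r with kM
        ... | k₁ ∷ kM′ with All-resp-↭ r kM′
        ... | k₂ ∷ kM″ with mono? x₁ x₂ y₂ | mono? x₂ x₁ y₁
        ...   | no g | _ = inj₁ (reroute (↭-prep x₁ (↭-prep y₁ (cov-↭ r))) (cong suc (≡-sym (↭-length r))) k₁ kM″ g)
        ...   | yes _ | no g = inj₁ (reroute (↭-trans (↭-prep x₁ (↭-prep y₁ (cov-↭ r)))
                  (solve 5 (λ a b c d m → a ⊕ (b ⊕ (c ⊕ (d ⊕ m))) ⊜ c ⊕ (d ⊕ (a ⊕ (b ⊕ m)))) ↭-refl [ x₁ ] [ y₁ ] [ x₂ ] [ y₂ ] (cov M″)))
                  (cong suc (≡-sym (↭-length r))) k₂ kM″ g)
        -- Both triangles monochromatic would give x₁x₂ the colours of x₁y₁ and of x₂y₂, which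
        -- differ.
        ...   | yes (_ , b₂) | yes (_ , b₁) = ⊥-elim (≢₁ (trans (≡-sym b₂) (trans (f-sym x₁ x₂) b₁)))

    -- If q is good for some other edge, it is used there. The greedy assignment on the remaining
    -- edges leaves some q′ over, and q′ is good for xy because q is already the one bad vertex of
    -- xy.
    head-bad : ∀ {V x y M q Q} → Unique V → Edges ((x , y) ∷ M) → x ∷ y ∷ cov M ++ q ∷ Q ↭ V →
      ¬ Matching (2 + length M) V → length M ≡ length Q → Mono x y q →
      CherriesIn (suc (length M)) V ⊎ ∃ λ c → ¬ Colour.Matching c (suc (length M)) V
    head-bad {V} {x} {y} {M} {q} {Q} uV hM p maximum |M| m with all? (λ (x , y) → mono? x y q) M
    ... | yes bad = SharedBad.shared-bad uV hM p maximum (cong suc |M|) (m ∷ bad)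
    ... | no ¬bad with find (Allₚ.¬All⇒Any¬ (λ (x , y) → mono? x y q) M ¬bad)
    ... | (x₂ , y₂) , e∈ , good with ∈⇒↭∷ e∈ | few-bad hM p maximum
    ... | M″ , r | few₁ ∷ few with greedy M″ Q (All.map (λ { (_ ∷ a) → a }) (All.tail (All-resp-↭ r few)))
            (≤-reflexive (trans (≡-sym (↭-length r)) |M|))
    ... | T , q′ , R , cT , k , pT , q′∈ = inj₁ ((x , y , q′) ∷ (x₂ , y₂ , q) ∷ T , R ,
      (λ m′ → All.lookup (AllPairs.head few₁) q′∈ (m , m′)) ∷ good ∷ cT , cong suc (trans (cong suc k) (≡-sym (↭-length r))) ,
      ↭-trans (solve 8 (λ x y q′ x₂ y₂ q t r → x ⊕ (y ⊕ (q′ ⊕ (x₂ ⊕ (y₂ ⊕ (q ⊕ (t ⊕ r)))))) ⊜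
          x ⊕ (y ⊕ (x₂ ⊕ (y₂ ⊕ (q ⊕ (t ⊕ (q′ ⊕ r))))))) ↭-refl [ x ] [ y ] [ q′ ] [ x₂ ] [ y₂ ] [ q ] (verts T) R)
        (↭-trans (↭-prep x (↭-prep y (↭-prep x₂ (↭-prep y₂ (↭-prep q pT)))))
          (↭-trans (solve 7 (λ x y x₂ y₂ q m r → x ⊕ (y ⊕ (x₂ ⊕ (y₂ ⊕ (q ⊕ (m ⊕ r))))) ⊜
              x ⊕ (y ⊕ ((x₂ ⊕ (y₂ ⊕ m)) ⊕ (q ⊕ r)))) ↭-refl [ x ] [ y ] [ x₂ ] [ y₂ ] [ q ] (cov M″) Q)
            (↭-trans (↭-prep x (↭-prep y (↭-++⁺ʳ (q ∷ Q) (↭-sym (cov-↭ r))))) p))))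

    -- With one unmatched vertex more than edges, `greedy` suffices. With equally many, an edge xy
    -- without bad vertices is served last by the vertex left over; if xy has a bad vertex,
    -- `head-bad` takes over.
    tight-matching : ∀ {V x y M Q} → Unique V → Edges ((x , y) ∷ M) → x ∷ y ∷ cov M ++ Q ↭ V →
      ¬ Matching (2 + length M) V → suc (length M) ≤ length Q →
      CherriesIn (suc (length M)) V ⊎ ∃ λ c → ¬ Colour.Matching c (suc (length M)) V
    tight-matching {V} {x} {y} {M} {Q} uV hM p maximum |Q| with suc (suc (length M)) ℕ.≤? length Q
    ... | yes lt with greedy ((x , y) ∷ M) Q (few-bad hM p maximum) lt
    ...   | T , q , R , cT , k , pT , _ = inj₁ (T , q ∷ R , cT , k , ↭-trans pT p)
    tight-matching {V} {x} {y} {M} {Q} uV hM p maximum |Q| | no ≮ with any? (mono? x y) Q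
    ... | yes bad with find bad
    ...   | q , q∈ , m with ∈⇒↭∷ q∈
    ...   | Q′ , r = head-bad uV hM (↭-trans (↭-prep x (↭-prep y (↭-++⁺ˡ (cov M) (↭-sym r)))) p) maximum
              (suc-injective (trans (≤-antisym |Q| (≮⇒≥ ≮)) (↭-length r))) m
    tight-matching {V} {x} {y} {M} {Q} uV hM p maximum |Q| | no ≮ | no ¬bad
      with greedy M Q (All.tail (few-bad hM p maximum)) |Q|
    ... | T , q , R , cT , k , pT , q∈ = inj₁ ((x , y , q) ∷ T , R ,
      (λ m → ¬bad (lose q∈ m)) ∷ cT , cong suc k ,
      ↭-trans (↭-prep x (↭-prep y (↭-trans (↭-sym (shift q (verts T) R)) pT))) p)

  -- Induction splits off one cherry. If the rest lacks s disjoint edges off some κ, the matching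
  -- number off κ in all of V decides: at most s is the second alternative, s + 1 is
  -- `tight-matching`, and s + 2 means that the split-off cherry acts as a hub.
  cherries-or-small-matching : ∀ s {V} → Unique V → s * 3 ≤ length V →
    CherriesIn s V ⊎ ∃ λ κ → ¬ Colour.Matching κ s V
  cherries-or-small-matching zero {V} uV _ = inj₁ ([] , V , [] , refl , ↭-refl)
  cherries-or-small-matching (suc s) {V} uV big with cherry-or-mono uV (≤-trans (s≤s (s≤s z≤n)) big)
  ... | inj₂ (κ , mono) = inj₂ (κ , λ where
    ([] , _ , _ , () , _)
    (((x , y) ∷ M) , R , h ∷ _ , _ , p) → h (mono (∈-resp-↭ p (here refl)) (∈-resp-↭ p (there (here refl)))
      (distinct (Unique-resp-↭ (↭-sym p) uV))))
    where
    distinct : ∀ {x y : A} {L} → Unique (x ∷ y ∷ L) → x ≢ y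
    distinct ((x≢y ∷ _) ∷ _) = x≢y
  ... | inj₁ (x , y , z , V′ , good , pV) with cherries-or-small-matching s {V′}
      (Unique-++⁻ʳ (x ∷ y ∷ z ∷ []) (Unique-resp-↭ (↭-sym pV) uV))
      (+-cancelˡ-≤ 3 _ _ (≤-trans big (≤-reflexive (≡-sym (↭-length pV)))))
  ... | inj₁ (T , R , cT , k , p) = inj₁ ((x , y , z) ∷ T , R , good ∷ cT , cong suc k ,
    ↭-trans (↭-prep x (↭-prep y (↭-prep z p))) pV)
  ... | inj₂ (κ , none) = enlarge s none big (Colour.matchingAvoiding? κ [] (suc s) uV)
    where
    enlarge : ∀ s → ¬ Colour.Matching κ s V′ → suc s * 3 ≤ length V → Dec (Colour.Matching κ (suc s) V) →
      CherriesIn (suc s) V ⊎ ∃ λ κ → ¬ Colour.Matching κ (suc s) V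
    enlarge s none big (no ¬m) = inj₂ (κ , ¬m)
    enlarge s none big (yes m@(((a , b) ∷ M) , Q , hM , k , p)) with Colour.matchingAvoiding? κ [] (suc (suc s)) uV
    ... | no maximum = subst (λ t → CherriesIn (suc t) V ⊎ ∃ λ κ → ¬ Colour.Matching κ (suc t) V) |M|
      (tight-matching κ uV hM p (subst (λ t → ¬ Colour.Matching κ (2 + t) V) (≡-sym |M|) maximum) |Q|)
      where
      |M| : length M ≡ s
      |M| = suc-injective k
      |Q| : suc (length M) ≤ length Q
      |Q| = subst (λ t → suc t ≤ length Q) (≡-sym |M|) (+-cancelˡ-≤ (2 + (s + s)) _ _
        (≤-trans (≤-reflexive (lem s)) (≤-trans big (≤-reflexive (trans (≡-sym (↭-length p)) (cong (2 +_)
          (trans (length-++ (cov M)) (cong (_+ length Q) (trans (length-cov M) (cong (λ t → t + t) |M|))))))))))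
        where
        lem : ∀ s → 2 + (s + s) + suc s ≡ suc s * 3
        lem = solve-∀
    enlarge zero none big (yes m) | yes _ = ⊥-elim (none ([] , V′ , [] , refl , ↭-refl))
    enlarge (suc s) none big (yes m) | yes (M , Q , hM , k , p) = inj₁ (cherriesIn-resp-↭ pV
      (cherries-through-hub κ good (≤-trans big (≤-reflexive (≡-sym (↭-length pV))))
        (M , Q , hM , k , ↭-trans p (↭-sym pV)) none))

-- Sums over edges

sumFin-cong : ∀ {n} {g h : Fin n → ℕ} → (∀ i → g i ≡ h i) → sumFin g ≡ sumFin h
sumFin-cong {zero} q = refl
sumFin-cong {suc n} q = cong₂ _+_ (q Fin.zero) (sumFin-cong (q ∘ Fin.suc))

sumFin-0 : ∀ n → sumFin {n} (λ _ → 0) ≡ 0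
sumFin-0 zero = refl
sumFin-0 (suc n) = sumFin-0 n

+-interchange : ∀ a b c d → (a + b) + (c + d) ≡ (a + c) + (b + d)
+-interchange = solve-∀

sumFin-+ : ∀ {n} (g h : Fin n → ℕ) → sumFin (λ i → g i + h i) ≡ sumFin g + sumFin h
sumFin-+ {zero} g h = refl
sumFin-+ {suc n} g h = trans (cong (g Fin.zero + h Fin.zero +_) (sumFin-+ (g ∘ Fin.suc) (h ∘ Fin.suc)))
  (+-interchange (g Fin.zero) (h Fin.zero) (sumFin (g ∘ Fin.suc)) (sumFin (h ∘ Fin.suc)))

sumFin-*ʳ : ∀ {n} (g : Fin n → ℕ) k → sumFin (λ i → g i * k) ≡ sumFin g * k
sumFin-*ʳ {zero} g k = refl
sumFin-*ʳ {suc n} g k = trans (cong (g Fin.zero * k +_) (sumFin-*ʳ (g ∘ Fin.suc) k))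
  (≡-sym (*-distribʳ-+ k (g Fin.zero) (sumFin (g ∘ Fin.suc))))

sumPairs-cong : ∀ {n} {g h : Fin n → Fin n → ℕ} → (∀ i j → g i j ≡ h i j) → sumPairs g ≡ sumPairs h
sumPairs-cong q = sumFin-cong λ i → sumFin-cong λ j → cong (if toℕ i ℕ.<ᵇ toℕ j then_else 0) (q i j)

sumPairs-+ : ∀ {n} (g h : Fin n → Fin n → ℕ) → sumPairs (λ i j → g i j + h i j) ≡ sumPairs g + sumPairs h
sumPairs-+ g h = trans (sumFin-cong λ i → trans (sumFin-cong λ j → split (toℕ i ℕ.<ᵇ toℕ j) (g i j) (h i j))
    (sumFin-+ (λ j → if toℕ i ℕ.<ᵇ toℕ j then g i j else 0) (λ j → if toℕ i ℕ.<ᵇ toℕ j then h i j else 0)))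
  (sumFin-+ (λ i → sumFin λ j → if toℕ i ℕ.<ᵇ toℕ j then g i j else 0) (λ i → sumFin λ j → if toℕ i ℕ.<ᵇ toℕ j then h i j else 0))
  where
  split : ∀ b x y → (if b then x + y else 0) ≡ (if b then x else 0) + (if b then y else 0)
  split true x y = refl
  split false x y = refl

sumPairs-*ʳ : ∀ {n} (g : Fin n → Fin n → ℕ) k → sumPairs (λ i j → g i j * k) ≡ sumPairs g * k
sumPairs-*ʳ g k = trans (sumFin-cong λ i → trans (sumFin-cong λ j → pull (toℕ i ℕ.<ᵇ toℕ j) (g i j))
    (sumFin-*ʳ (λ j → if toℕ i ℕ.<ᵇ toℕ j then g i j else 0) k))
  (sumFin-*ʳ (λ i → sumFin λ j → if toℕ i ℕ.<ᵇ toℕ j then g i j else 0) k)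
  where
  pull : ∀ b x → (if b then x * k else 0) ≡ (if b then x else 0) * k
  pull true x = refl
  pull false x = refl

sumPairs-symmetrised : ∀ {n} (g : Fin n → Fin n → ℕ) → (∀ i → g i i ≡ 0) →
  sumPairs (λ i j → g i j + g j i) ≡ sumFin (λ i → sumFin (g i))
sumPairs-symmetrised {zero} g diag = refl
sumPairs-symmetrised {suc n} g diag = begin
  sumFin (λ j → g Fin.zero (Fin.suc j) + g (Fin.suc j) Fin.zero) + sumPairs (λ i j → g′ i j + g′ j i)
    ≡⟨ cong₂ _+_ (sumFin-+ row col) (sumPairs-symmetrised g′ (diag ∘ Fin.suc)) ⟩
  (sumFin row + sumFin col) + sumFin (λ i → sumFin (g′ i))
    ≡⟨ +-assoc (sumFin row) _ _ ⟩
  sumFin row + (sumFin col + sumFin (λ i → sumFin (g′ i)))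
    ≡⟨ cong₂ _+_ (cong (_+ sumFin row) (≡-sym (diag Fin.zero))) (≡-sym (sumFin-+ col (λ i → sumFin (g′ i)))) ⟩
  (g Fin.zero Fin.zero + sumFin row) + sumFin (λ i → col i + sumFin (g′ i)) ∎
  where
  open ≡.≡-Reasoning
  g′ : Fin n → Fin n → ℕ
  g′ i j = g (Fin.suc i) (Fin.suc j)
  row col : Fin n → ℕ
  row j = g Fin.zero (Fin.suc j)
  col j = g (Fin.suc j) Fin.zero

members : ∀ {n} → (Fin n → Bool) → List (Fin n)
members {n} b = filter (λ i → b i Bool.≟ true) (List.allFin n)

∈-members⁺ : ∀ {n} {b : Fin n → Bool} {i} → b i ≡ true → i ∈ members b
∈-members⁺ {b = b} q = ∈-filter⁺ (λ i → b i Bool.≟ true) (∈-allFin _) q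

∈-members⁻ : ∀ {n} {b : Fin n → Bool} {i} → i ∈ members b → b i ≡ true
∈-members⁻ {n} {b} q = proj₂ (∈-filter⁻ (λ i → b i Bool.≟ true) {xs = List.allFin n} q)

members-unique : ∀ {n} (b : Fin n → Bool) → Unique (members b)
members-unique {n} b = Uniqueₚ.filter⁺ (λ i → b i Bool.≟ true) (Uniqueₚ.allFin⁺ n)

sumFin-members : ∀ {n} (b : Fin n → Bool) (g : Fin n → ℕ) →
  sumFin (λ i → if b i then g i else 0) ≡ sum (map g (members b))
sumFin-members {n} b g = go id
  where
  go : ∀ {k} (ι : Fin k → Fin n) →
    sumFin (λ i → if b (ι i) then g (ι i) else 0) ≡ sum (map g (filter (λ i → b i Bool.≟ true) (List.tabulate ι)))
  go {zero} ι = refl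
  go {suc k} ι with b (ι Fin.zero)
  ... | true = cong (g (ι Fin.zero) +_) (go (ι ∘ Fin.suc))
  ... | false = go (ι ∘ Fin.suc)

sum-map-const : {A : Set} (L : List A) → sum (map (λ _ → 1) L) ≡ length L
sum-map-const [] = refl
sum-map-const (_ ∷ L) = cong suc (sum-map-const L)

count-members : ∀ {n} (b : Fin n → Bool) → count b ≡ length (members b)
count-members b = trans (sumFin-members b (λ _ → 1)) (sum-map-const (members b))

sum-map-cong : {A : Set} {g h : A → ℕ} (L : List A) → All (λ x → g x ≡ h x) L → sum (map g L) ≡ sum (map h L)
sum-map-cong [] [] = refl
sum-map-cong (_ ∷ L) (q ∷ qs) = cong₂ _+_ q (sum-map-cong L qs)

module _ {n : ℕ} (G : Graph n) where

  neighbours : Fin n → List (Fin n)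
  neighbours v = members (adj G v)

  -- Double counting: `h i` is added once for each edge at i.
  handshake : ∀ (h : Fin n → ℕ) →
    sumPairs (λ i j → if adj G i j then h i + h j else 0) ≡ sumFin (λ i → deg G i * h i)
  handshake h = begin
    sumPairs (λ i j → if adj G i j then h i + h j else 0)
      ≡⟨ sumPairs-cong (λ i j → trans (split (adj G i j) (h i) (h j))
          (cong (λ a → (if adj G i j then h i else 0) + (if a then h j else 0)) (sym G i j))) ⟩
    sumPairs (λ i j → (if adj G i j then h i else 0) + (if adj G j i then h j else 0))
      ≡⟨ sumPairs-symmetrised (λ i j → if adj G i j then h i else 0) (λ i → cong (if_then h i else 0) (irrefl G i)) ⟩
    sumFin (λ i → sumFin (λ j → if adj G i j then h i else 0))
      ≡⟨ sumFin-cong (λ i → trans (sumFin-cong λ j → unit (adj G i j) (h i))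
          (sumFin-*ʳ (λ j → if adj G i j then 1 else 0) (h i))) ⟩
    sumFin (λ i → deg G i * h i) ∎
    where
    open ≡.≡-Reasoning
    split : ∀ b x y → (if b then x + y else 0) ≡ (if b then x else 0) + (if b then y else 0)
    split true x y = refl
    split false x y = refl
    unit : ∀ b x → (if b then x else 0) ≡ (if b then 1 else 0) * x
    unit true x = ≡-sym (+-identityʳ x)
    unit false x = refl

  -- No edge joins two vertices of b, so each edge avoids b or lies in exactly one star centred in
  -- b.
  star-decomposition : (b : Fin n → Bool) → (∀ i j → b i ≡ true → b j ≡ true → adj G i j ≡ false) →
    (w : Fin n → Fin n → ℕ) → (∀ i j → w i j ≡ w j i) →
    sumPairs (λ i j → if adj G i j then w i j else 0) ≡
      sumPairs (λ i j → if b i ∨ b j then 0 else (if adj G i j then w i j else 0)) +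
      sum (map (λ v → sum (map (w v) (neighbours v))) (members b))
  star-decomposition b indep w w-sym = begin
    sumPairs a
      ≡⟨ sumPairs-cong (λ i j → split i j (b i) (b j) refl refl) ⟩
    sumPairs (λ i j → (if b i ∨ b j then 0 else a i j) + (g i j + g j i))
      ≡⟨ sumPairs-+ (λ i j → if b i ∨ b j then 0 else a i j) (λ i j → g i j + g j i) ⟩
    sumPairs (λ i j → if b i ∨ b j then 0 else a i j) + sumPairs (λ i j → g i j + g j i)
      ≡⟨ cong (sumPairs (λ i j → if b i ∨ b j then 0 else a i j) +_)
          (trans (sumPairs-symmetrised g diag) (trans (sumFin-cong λ i → pull i (b i)) (sumFin-members b star))) ⟩
    sumPairs (λ i j → if b i ∨ b j then 0 else a i j) + sum (map star (members b)) ∎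
    where
    open ≡.≡-Reasoning
    a g : Fin n → Fin n → ℕ
    a i j = if adj G i j then w i j else 0
    g i j = if b i then a i j else 0
    star : Fin n → ℕ
    star v = sum (map (w v) (neighbours v))
    a-sym : ∀ i j → a i j ≡ a j i
    a-sym i j = cong₂ (if_then_else 0) (sym G i j) (w-sym i j)
    a-irrefl : ∀ i → a i i ≡ 0
    a-irrefl i = cong (if_then w i i else 0) (irrefl G i)
    diag : ∀ i → g i i ≡ 0
    diag i with b i
    ... | true = a-irrefl i
    ... | false = refl
    split : ∀ i j x y → b i ≡ x → b j ≡ y → a i j ≡ (if x ∨ y then 0 else a i j) + ((if x then a i j else 0) + (if y then a j i else 0))
    split i j true true q r rewrite sym G j i | indep i j q r = refl
    split i j true false q r = ≡-sym (+-identityʳ _)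
    split i j false true q r = a-sym i j
    split i j false false q r = ≡-sym (+-identityʳ _)
    pull : ∀ i x → sumFin (λ j → if x then a i j else 0) ≡ (if x then star i else 0)
    pull i true = sumFin-members (adj G i) (w i)
    pull i false = sumFin-0 n

-- Switching one vertex of a copy

unique-keys : {A B : Set} {P : List (A × B)} → Unique (map proj₁ P) →
  ∀ {u x y} → (u , x) ∈ P → (u , y) ∈ P → x ≡ y
unique-keys {P = _ ∷ P} (u∉ ∷ uP) (here refl) (here refl) = refl
unique-keys {P = _ ∷ P} (u∉ ∷ uP) (here refl) (there q) = ⊥-elim (All.lookup u∉ (∈-map⁺ proj₁ q) refl)
unique-keys {P = _ ∷ P} (u∉ ∷ uP) (there q) (here refl) = ⊥-elim (All.lookup u∉ (∈-map⁺ proj₁ q) refl)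
unique-keys {P = _ ∷ P} (u∉ ∷ uP) (there q) (there r) = unique-keys uP q r

unique-values : {A B : Set} {P : List (A × B)} → Unique (map proj₂ P) →
  ∀ {u v x} → (u , x) ∈ P → (v , x) ∈ P → u ≡ v
unique-values {P = _ ∷ P} (x∉ ∷ uP) (here refl) (here refl) = refl
unique-values {P = _ ∷ P} (x∉ ∷ uP) (here refl) (there q) = ⊥-elim (All.lookup x∉ (∈-map⁺ proj₂ q) refl)
unique-values {P = _ ∷ P} (x∉ ∷ uP) (there q) (here refl) = ⊥-elim (All.lookup x∉ (∈-map⁺ proj₂ q) refl)
unique-values {P = _ ∷ P} (x∉ ∷ uP) (there q) (there r) = unique-values uP q r

Extends : {A B : Set} → (A → B) → List (A × B) → Set
Extends φ = All (λ (u , x) → φ u ≡ x)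

extends-map : {A B : Set} {φ : A → B} {P : List (A × B)} → Extends φ P → map φ (map proj₁ P) ≡ map proj₂ P
extends-map [] = refl
extends-map (q ∷ qs) = cong₂ _∷_ q (extends-map qs)

embedding : {A B : Set} (P : List (A × B)) → (∀ u → u ∈ map proj₁ P) →
  Unique (map proj₁ P) → Unique (map proj₂ P) → ∃ λ φ → Injective _≡_ _≡_ φ × Extends φ P
embedding {A} {B} P total uK uV = φ , injective , All.tabulate (λ q → unique-keys uK (graph _) q)
  where
  entry : ∀ u → ∃ λ x → (u , x) ∈ P
  entry u with ∈-map⁻ proj₁ (total u)
  ... | (_ , x) , q , refl = x , q
  φ : A → B
  φ u = proj₁ (entry u)
  graph : ∀ u → (u , φ u) ∈ P
  graph u = proj₂ (entry u)
  injective : Injective _≡_ _≡_ φ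
  injective {u} {v} q = unique-values uV (graph u) (subst (λ x → (v , x) ∈ P) (≡-sym q) (graph v))

module Switching (p : ℕ) (pp : Prime p) where

  open Residues p pp public
  open ↭-Solver

  module _ {A B : Set} where

    -- A vertex whose image is still open, its possible images, and what each of them contributes to
    -- the weight.
    Slot : Set
    Slot = A × List B × (B → ℕ)

    key : Slot → A
    key = proj₁

    options : Slot → List B
    options (_ , opts , _) = opts

    worths : Slot → List ℕ
    worths (_ , opts , val) = map val opts

    worth : (A → B) → Slot → ℕ
    worth φ (u , _ , val) = val (φ u)

    Fits : (A → B) → List (A × B) → List Slot → Set
    Fits φ P slots = Extends φ P × All (λ s → φ (key s) ∈ options s) slots

    select : ∀ slots {bs} → Pointwise _∈_ bs (map worths slots) → ∃₂ λ (P : List (A × B)) R →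
      map proj₁ P ≡ map key slots × map proj₂ P ++ R ↭ concatMap options slots ×
      (∀ φ → Extends φ P → All (λ s → φ (key s) ∈ options s) slots × sum (map (worth φ) slots) ≡ sum bs)
    select [] [] = [] , [] , refl , ↭-refl , λ _ _ → [] , refl
    select ((u , opts , val) ∷ slots) (b∈ ∷ bs∈) with select slots bs∈ | ∈-map⁻ val b∈
    ... | P , R , keys , values , ok | x , x∈ , refl with ∈⇒↭∷ x∈
    ... | opts′ , q = (u , x) ∷ P , opts′ ++ R , cong (u ∷_) keys ,
      ↭-trans (solve 4 (λ x p o r → x ⊕ (p ⊕ (o ⊕ r)) ⊜ (x ⊕ o) ⊕ (p ⊕ r)) ↭-refl [ x ] (map proj₂ P) opts′ R)
        (↭-++⁺ (↭-sym q) values) ,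
      λ { φ (refl ∷ ext) → let a , b = ok φ ext in x∈ ∷ a , cong (val x +_) b }

    -- By the last hypothesis, W minus the sum of worths is the same for all fitting maps. A
    -- reference map ψ is fixed, and φ is chosen with worths summing to Vψ - W ψ, which makes W φ
    -- zero.
    switch : (P : List (A × B)) (slots : List Slot) →
      (∀ u → u ∈ map key slots ++ map proj₁ P) → Unique (map key slots ++ map proj₁ P) →
      Unique (concatMap options slots ++ map proj₂ P) →
      All (λ s → Incongruent (worths s) × 1 ≤ length (worths s)) slots → p ∸ 1 ≤ excess (map worths slots) →
      (W : (A → B) → ℕ) →
      (∀ φ ψ → Injective _≡_ _≡_ φ → Injective _≡_ _≡_ ψ → Fits φ P slots → Fits ψ P slots →
        W φ + sum (map (worth ψ) slots) ≈ W ψ + sum (map (worth φ) slots)) →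
      ∃ λ φ → Injective _≡_ _≡_ φ × W φ ≈ 0
    switch P slots total uK uV varied enough W stable = φ , injective , Wφ≈0
      where
      realise : ∀ t → ∃ λ φ → Injective _≡_ _≡_ φ × Fits φ P slots × t ≈ sum (map (worth φ) slots)
      realise t with choices-hit-everything (map worths slots) (Allₚ.map⁺ varied) enough t
      ... | bs , bs∈ , t≈ with select slots bs∈
      ... | P′ , R , keys , values , ok with embedding (P′ ++ P)
          (λ u → subst (u ∈_) (≡-sym keys′) (total u))
          (subst Unique (≡-sym keys′) uK)
          (subst Unique (≡-sym (map-++ proj₂ P′ P)) (Unique-++⁻ˡ (map proj₂ P′ ++ map proj₂ P)
            (Unique-resp-↭ (↭-trans (↭-++⁺ʳ (map proj₂ P) (↭-sym values))
              (solve 3 (λ a b c → (a ⊕ b) ⊕ c ⊜ (a ⊕ c) ⊕ b) ↭-refl (map proj₂ P′) R (map proj₂ P))) uV)))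
        where
        keys′ : map proj₁ (P′ ++ P) ≡ map key slots ++ map proj₁ P
        keys′ = trans (map-++ proj₁ P′ P) (cong (_++ map proj₁ P) keys)
      ...   | φ , injective , ext = let a , b = ok φ (Allₚ.++⁻ˡ P′ ext) in
        φ , injective , (Allₚ.++⁻ʳ P′ ext , a) , ≈-trans t≈ (≡⇒≈ (≡-sym b))
      start = realise 0
      ψ = proj₁ start
      Vψ = sum (map (worth ψ) slots)
      goal = realise (neg (W ψ) + Vψ)
      φ = proj₁ goal
      injective = proj₁ (proj₂ goal)
      Wφ≈0 : W φ ≈ 0
      Wφ≈0 = +-cancelʳ-≈ Vψ (≈-trans (stable φ ψ injective (proj₁ (proj₂ start)) (proj₁ (proj₂ (proj₂ goal))) (proj₁ (proj₂ (proj₂ start))))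
        (≈-trans (+-cong (≈-refl {W ψ}) (≈-sym (proj₂ (proj₂ (proj₂ goal)))))
          (≈-trans (≡⇒≈ (≡-sym (+-assoc (W ψ) _ _))) (+-cong (neg-inverse (W ψ)) ≈-refl))))

  -- Gadgets: places at which a vertex can be switched with effect

  module Gadgets {X : Set} (F : X → X → ℕ) where

    star : X → List X → ℕ
    star x A = sum (map (F x) A)

    Gadget : ℕ → ℕ → List X → Set
    Gadget σ d core = ∀ pool → d ∸ 1 + σ ≤ length pool → ∃₂ λ x y → ∃₂ λ A rest → ∃ λ junk →
      length A ≡ d × star x A ≉ star y A × x ∷ y ∷ A ++ rest ++ junk ↭ core ++ pool ×
      length pool ≤ length rest + (d ∸ 1)

    -- If the stars agreed for both choices, subtracting the two congruences would cancel A and make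
    -- the alternating sum zero.
    two-ended : ∀ {x y a b} → F x a + F y b ≉ F x b + F y a → ∀ A →
      star x (a ∷ A) ≉ star y (a ∷ A) ⊎ star x (b ∷ A) ≉ star y (b ∷ A)
    two-ended {x} {y} {a} {b} switching A with star x (a ∷ A) ≈? star y (a ∷ A)
    ... | no q = inj₁ q
    ... | yes qa = inj₂ λ qb → switching (+-cancelʳ-≈ (star x A + star y A)
      (≈-trans (≡⇒≈ (+-interchange (F x a) (F y b) (star x A) (star y A)))
        (≈-trans (+-cong qa (≈-sym qb)) (≡⇒≈ (lem (F y a) (F x b) (star x A) (star y A))))))
      where
      lem : ∀ u v s t → (u + t) + (v + s) ≡ (v + u) + (s + t)
      lem = solve-∀

    split-pool : ∀ d (pool : List X) → d ≤ length pool → ∃₂ λ A rest → A ++ rest ≡ pool × length A ≡ d ×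
      length pool ≡ length rest + d
    split-pool d pool le = take d pool , drop d pool , take++drop≡id d pool ,
      trans (length-take d pool) (m≤n⇒m⊓n≡m le) ,
      trans (≡-sym (m∸n+n≡m le)) (cong (_+ d) (≡-sym (length-drop d pool)))

    two-ended-gadget : ∀ {σ d x y a b} → 1 ≤ d → F x a + F y b ≉ F x b + F y a → Gadget σ d (x ∷ y ∷ a ∷ b ∷ [])
    two-ended-gadget {σ} {suc d} {x} {y} {a} {b} _ switching pool le with split-pool d pool (≤-trans (m≤m+n d σ) le)
    ... | A , rest , refl , |A| , |pool| with two-ended switching A
    ...   | inj₁ ne = x , y , a ∷ A , rest , [ b ] , cong suc |A| , ne ,
      solve 6 (λ x y a b A r → x ⊕ (y ⊕ ((a ⊕ A) ⊕ (r ⊕ b))) ⊜ x ⊕ (y ⊕ (a ⊕ (b ⊕ (A ⊕ r))))) ↭-refl [ x ] [ y ] [ a ] [ b ] A rest ,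
      ≤-reflexive |pool|
    ...   | inj₂ ne = x , y , b ∷ A , rest , [ a ] , cong suc |A| , ne ,
      solve 6 (λ x y a b A r → x ⊕ (y ⊕ ((b ⊕ A) ⊕ (r ⊕ a))) ⊜ x ⊕ (y ⊕ (a ⊕ (b ⊕ (A ⊕ r))))) ↭-refl [ x ] [ y ] [ a ] [ b ] A rest ,
      ≤-reflexive |pool|

    -- For degree 1 the core already contains A, so σ may be 0.
    leaf-gadget : ∀ {σ x y a} → F x a ≉ F y a → Gadget σ 1 (x ∷ y ∷ a ∷ [])
    leaf-gadget {x = x} {y} {a} ne pool _ = x , y , [ a ] , pool , [] , refl ,
      (λ q → ne (subst₂ _≈_ (+-identityʳ (F x a)) (+-identityʳ (F y a)) q)) ,
      solve 4 (λ x y a r → x ⊕ (y ⊕ (a ⊕ (r ⊕ ε))) ⊜ x ⊕ (y ⊕ (a ⊕ r))) ↭-refl [ x ] [ y ] [ a ] pool ,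
      ≤-reflexive (≡-sym (+-identityʳ _))

    balanced-star : ∀ {x y u v} A → All (λ q → F x q + v ≈ F y q + u) A →
      star x A + length A * v ≈ star y A + length A * u
    balanced-star [] [] = ≈-refl
    balanced-star {x} {y} {u} {v} (q ∷ A) (b ∷ bs) =
      ≈-trans (≡⇒≈ (+-interchange (F x q) (star x A) v (length A * v)))
        (≈-trans (+-cong b (balanced-star A bs)) (≡⇒≈ (+-interchange (F y q) u (star y A) (length A * u))))

    -- If some pool vertex q is unbalanced against a, one of a and q goes into A and the other back
    -- to the pool; q is the spare vertex behind σ = 1. Otherwise each element of A contributes the
    -- same difference, so the stars differ by d (F x a - F y a), nonzero as p ∤ d.
    cherry-gadget : ∀ {d x y a} → ¬ p ∣ d → 1 ≤ d → F x a ≉ F y a → Gadget 1 d (x ∷ y ∷ a ∷ [])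
    cherry-gadget {suc d} {x} {y} {a} p∤d _ ne pool le with all? (λ q → F x q + F y a ≈? F y q + F x a) pool
    ... | no unbalanced with find (Allₚ.¬All⇒Any¬ (λ q → F x q + F y a ≈? F y q + F x a) pool unbalanced)
    ...   | q , q∈ , switching with ∈⇒↭∷ q∈
    ...   | pool′ , pq with split-pool d pool′ (s≤s⁻¹ (≤-trans (≤-reflexive (+-comm 1 d)) (≤-trans le (≤-reflexive (↭-length pq)))))
    ...   | A , rest , refl , |A| , |pool′| with two-ended (λ r → switching (≈-trans r (≡⇒≈ (+-comm (F x a) (F y q))))) A
    ...   | inj₁ ne′ = x , y , q ∷ A , a ∷ rest , [] , cong suc |A| , ne′ ,
      ↭-trans (solve 6 (λ x y a q A r → x ⊕ (y ⊕ ((q ⊕ A) ⊕ ((a ⊕ r) ⊕ ε))) ⊜ x ⊕ (y ⊕ (a ⊕ (q ⊕ (A ⊕ r))))) ↭-refl [ x ] [ y ] [ a ] [ q ] A rest)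
        (↭-prep x (↭-prep y (↭-prep a (↭-sym pq)))) ,
      ≤-reflexive (trans (↭-length pq) (cong suc |pool′|))
    ...   | inj₂ ne′ = x , y , a ∷ A , q ∷ rest , [] , cong suc |A| , ne′ ,
      ↭-trans (solve 6 (λ x y a q A r → x ⊕ (y ⊕ ((a ⊕ A) ⊕ ((q ⊕ r) ⊕ ε))) ⊜ x ⊕ (y ⊕ (a ⊕ (q ⊕ (A ⊕ r))))) ↭-refl [ x ] [ y ] [ a ] [ q ] A rest)
        (↭-prep x (↭-prep y (↭-prep a (↭-sym pq)))) ,
      ≤-reflexive (trans (↭-length pq) (cong suc |pool′|))
    cherry-gadget {suc d} {x} {y} {a} p∤d _ ne pool le | yes balanced
      with split-pool d pool (≤-trans (m≤m+n d 1) le)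
    ... | A , rest , refl , |A| , |pool| = x , y , a ∷ A , rest , [] , cong suc |A| ,
      (λ q → ne (*-cancelˡ-≈ p∤d (≈-sym (+-cancelˡ-≈ (star y (a ∷ A)) (≈-trans (+-cong (≈-sym q) ≈-refl)
        (subst (λ k → star x (a ∷ A) + suc k * F y a ≈ star y (a ∷ A) + suc k * F x a) |A|
          (balanced-star (a ∷ A) (≡⇒≈ (+-comm (F x a) (F y a)) ∷ Allₚ.++⁻ˡ A balanced)))))))) ,
      solve 5 (λ x y a A r → x ⊕ (y ⊕ ((a ⊕ A) ⊕ (r ⊕ ε))) ⊜ x ⊕ (y ⊕ (a ⊕ (A ⊕ r)))) ↭-refl [ x ] [ y ] [ a ] A rest ,
      ≤-reflexive |pool|

exact-pairing : {A B : Set} (L : List A) (V : List B) → length L ≡ length V →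
  ∃ λ P → map proj₁ P ≡ L × map proj₂ P ≡ V
exact-pairing [] [] _ = [] , refl , refl
exact-pairing (u ∷ L) (x ∷ V) q with exact-pairing L V (suc-injective q)
... | P , k , v = (u , x) ∷ P , cong (u ∷_) k , cong (x ∷_) v

-- Assembling a copy of G from gadgets

module GadgetCopies (p : ℕ) (pp : Prime p) {n : ℕ} (G : Graph n) {N : ℕ}
  (f : Fin N → Fin N → Fin p) (f-sym : IsColouring N p f) where

  open Switching p pp public
  open ↭-Solver

  F : Fin N → Fin N → ℕ
  F x y = toℕ (f x y)

  F-sym : ∀ x y → F x y ≡ F y x
  F-sym x y = cong toℕ (f-sym x y)

  open Gadgets F public

  -- A packing vertex, its two possible images, and the images of its neighbours.
  Block : Set
  Block = Fin n × (Fin N × Fin N) × List (Fin N)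

  leaves ends body : Block → List (Fin N)
  leaves (_ , _ , A) = A
  ends (_ , (x , y) , _) = x ∷ y ∷ []
  body B = ends B ++ leaves B

  Switchable : Block → Set
  Switchable (v , (x , y) , A) = length A ≡ deg G v × star x A ≉ star y A

  demand : Fin n × List (Fin N) → ℕ
  demand (v , _) = deg G v ∸ 1

  -- The r vertices reserved for the end serve as the σ spare ones at every stage, so the spare
  -- vertex is paid for once and not once per gadget.
  install : ∀ {σ} (cores : List (Fin n × List (Fin N))) → All (λ (v , core) → Gadget σ (deg G v) core) cores →
    ∀ pool r → σ ≤ r → sum (map demand cores) + r ≤ length pool →
    ∃₂ λ (Bs : List Block) rest → ∃ λ junk → map proj₁ Bs ≡ map proj₁ cores × All Switchable Bs × r ≤ length rest ×
      concatMap body Bs ++ rest ++ junk ↭ concatMap proj₂ cores ++ pool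
  install [] [] pool r _ le = [] , pool , [] , refl , [] , le ,
    solve 1 (λ a → a ⊕ ε ⊜ a) ↭-refl pool
  install {σ} ((v , core) ∷ cores) (g ∷ gs) pool r σ≤r le
    with g pool (≤-trans (+-monoʳ-≤ (deg G v ∸ 1) (≤-trans σ≤r (m≤n+m r (sum (map demand cores)))))
      (≤-trans (≤-reflexive (≡-sym (+-assoc (deg G v ∸ 1) _ r))) le))
  ... | x , y , A , rest₁ , junk₁ , |A| , ne , p₁ , |pool|
    with install cores gs rest₁ r σ≤r (+-cancelʳ-≤ (deg G v ∸ 1) _ _ (≤-trans (≤-reflexive
      (rearrange (sum (map demand cores)) r (deg G v ∸ 1))) (≤-trans le |pool|)))
    where
    rearrange : ∀ a b c → a + b + c ≡ c + a + b
    rearrange = solve-∀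
  ... | Bs , rest , junk , keys , ok , r≤ , p₂ = (v , (x , y) , A) ∷ Bs , rest , junk ++ junk₁ , cong (v ∷_) keys ,
    (|A| , ne) ∷ ok , r≤ ,
    ↭-trans (solve 5 (λ a b r j k → (a ⊕ b) ⊕ (r ⊕ (j ⊕ k)) ⊜ a ⊕ ((b ⊕ (r ⊕ j)) ⊕ k)) ↭-refl
        (x ∷ y ∷ A) (concatMap body Bs) rest junk junk₁)
      (↭-trans (↭-++⁺ˡ (x ∷ y ∷ A) (↭-++⁺ʳ junk₁ p₂))
        (↭-trans (solve 4 (λ a c r k → a ⊕ ((c ⊕ r) ⊕ k) ⊜ (a ⊕ (r ⊕ k)) ⊕ c) ↭-refl
            (x ∷ y ∷ A) (concatMap proj₂ cores) rest₁ junk₁)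
          (↭-trans (↭-++⁺ʳ (concatMap proj₂ cores) p₁)
            (solve 3 (λ a b c → (a ⊕ b) ⊕ c ⊜ (a ⊕ c) ⊕ b) ↭-refl core pool (concatMap proj₂ cores)))))

  slot : Block → Slot {Fin n} {Fin N}
  slot (v , (x , y) , A) = v , x ∷ y ∷ [] , λ z → star z A

  link : ∀ Bs → All Switchable Bs → ∃ λ (P : List (Fin n × Fin N)) →
    map proj₁ P ≡ concatMap (neighbours G) (map proj₁ Bs) × map proj₂ P ≡ concatMap leaves Bs ×
    (∀ {φ} → Extends φ P → All (λ B → map φ (neighbours G (proj₁ B)) ≡ leaves B) Bs)
  link [] [] = [] , refl , refl , λ _ → []
  link ((v , xy , A) ∷ Bs) ((|A| , _) ∷ ok)
    with link Bs ok | exact-pairing (neighbours G v) A (trans (≡-sym (count-members (adj G v))) (≡-sym |A|))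
  ... | P , keys , values , linked | P₁ , keys₁ , values₁ = P₁ ++ P ,
    trans (map-++ proj₁ P₁ P) (cong₂ _++_ keys₁ keys) , trans (map-++ proj₂ P₁ P) (cong₂ _++_ values₁ values) ,
    λ {φ} ext → trans (cong (map φ) (≡-sym keys₁)) (trans (extends-map (Allₚ.++⁻ˡ P₁ ext)) values₁) ∷
      linked (Allₚ.++⁻ʳ P₁ ext)

  bodies-↭ : ∀ Bs → concatMap ends Bs ++ concatMap leaves Bs ↭ concatMap body Bs
  bodies-↭ [] = ↭-refl
  bodies-↭ (B@(_ , (x , y) , A) ∷ Bs) = ↭-trans
    (solve 4 (λ e E a A → (e ⊕ E) ⊕ (a ⊕ A) ⊜ (e ⊕ a) ⊕ (E ⊕ A)) ↭-refl (ends B) (concatMap ends Bs) A (concatMap leaves Bs))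
    (↭-++⁺ˡ (body B) (bodies-↭ Bs))

  module _ (b : Fin n → Bool) (indep : ∀ i j → b i ≡ true → b j ≡ true → adj G i j ≡ false) where

    outside : (Fin n → Fin N) → ℕ
    outside φ = sumPairs (λ i j → if b i ∨ b j then 0 else (if adj G i j then F (φ i) (φ j) else 0))

    outside-cong : ∀ {φ ψ} → (∀ i → b i ≡ false → φ i ≡ ψ i) → outside φ ≡ outside ψ
    outside-cong {φ} {ψ} same = sumPairs-cong λ i j → go i j (b i) (b j) refl refl
      where
      go : ∀ i j x y → b i ≡ x → b j ≡ y →
        (if x ∨ y then 0 else (if adj G i j then F (φ i) (φ j) else 0)) ≡
        (if x ∨ y then 0 else (if adj G i j then F (ψ i) (ψ j) else 0))
      go i j true _ _ _ = refl
      go i j false true _ _ = refl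
      go i j false false q r = cong (if adj G i j then_else 0) (cong₂ F (same i q) (same j r))

    weight-of-blocks : ∀ Bs → map proj₁ Bs ↭ members b → ∀ {φ} →
      All (λ B → map φ (neighbours G (proj₁ B)) ≡ leaves B) Bs →
      copyWeight G f φ ≡ outside φ + sum (map (worth φ) (map slot Bs))
    weight-of-blocks Bs keys {φ} linked = trans
      (star-decomposition G b indep (λ i j → F (φ i) (φ j)) (λ i j → F-sym (φ i) (φ j)))
      (cong (outside φ +_) (trans (≡-sym (sum-↭ (↭-map⁺ _ keys))) (cong sum (go Bs linked))))
      where
      go : ∀ Bs → All (λ B → map φ (neighbours G (proj₁ B)) ≡ leaves B) Bs →
        map (λ v → sum (map (λ j → F (φ v) (φ j)) (neighbours G v))) (map proj₁ Bs) ≡ map (worth φ) (map slot Bs)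
      go [] [] = refl
      go ((v , _ , A) ∷ Bs) (q ∷ qs) = cong₂ _∷_
        (trans (cong sum (Listₚ.map-∘ (neighbours G v))) (cong (star (φ v)) q)) (go Bs qs)

    -- Each slot offers two ends of incongruent worth, so p - 1 slots have excess p - 1. The images
    -- of all vertices outside the packing are fixed, so the weight changes only through the stars
    -- at the packing.
    gadgets⇒zero-copy : ∀ {σ r} (cores : List (Fin n × List (Fin N))) Rest pool →
      map proj₁ cores ↭ members b → length cores ≡ p ∸ 1 →
      map proj₁ cores ++ concatMap (neighbours G) (map proj₁ cores) ++ Rest ↭ List.allFin n →
      All (λ (v , core) → Gadget σ (deg G v) core) cores → Unique (concatMap proj₂ cores ++ pool) →
      σ ≤ r → length Rest ≤ r → sum (map demand cores) + r ≤ length pool →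
      ∃ λ φ → Injective _≡_ _≡_ φ × copyWeight G f φ ≈ 0
    gadgets⇒zero-copy {σ} {r} cores Rest pool keys |cores| cover gs uX σ≤r |Rest| room
      with install cores gs pool r σ≤r room
    ... | Bs , rest , junk , keysB , ok , r≤ , pX with link Bs ok | pairing Rest rest (≤-trans |Rest| r≤)
    ... | P , keysP , valuesP , linked | P′ , Q , keysP′ , valuesP′ =
      switch (P ++ P′) (map slot Bs)
        (λ u → subst (u ∈_) (≡-sym keys-all) (∈-resp-↭ (↭-sym cover) (∈-allFin u)))
        (subst Unique (≡-sym keys-all) (Unique-resp-↭ (↭-sym cover) (Uniqueₚ.allFin⁺ n)))
        (Unique-++⁻ˡ _ (Unique-resp-↭ (↭-sym values-all) (Unique-++⁻ˡ _ (subst Unique (≡-sym (Listₚ.++-assoc (concatMap body Bs) rest junk))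
          (Unique-resp-↭ (↭-sym pX) uX)))))
        (Allₚ.map⁺ (All.map (λ (_ , ne) → ((ne ∷ []) ∷ [] ∷ []) , s≤s z≤n) ok))
        (≤-reflexive (trans (≡-sym |cores|) (trans |Bs| (≡-sym (excess-pairs Bs)))))
        (copyWeight G f) (λ φ ψ _ _ → stable φ ψ)
      where
      |Bs| : length cores ≡ length Bs
      |Bs| = trans (≡-sym (length-map proj₁ cores)) (trans (cong length (≡-sym keysB)) (length-map proj₁ Bs))
      excess-pairs : ∀ Bs → excess (map worths (map slot Bs)) ≡ length Bs
      excess-pairs [] = refl
      excess-pairs (_ ∷ Bs) = cong suc (excess-pairs Bs)
      slot-keys : ∀ Bs → map key (map slot Bs) ≡ map proj₁ Bs
      slot-keys [] = refl
      slot-keys (_ ∷ Bs) = cong (_ ∷_) (slot-keys Bs)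
      slot-options : ∀ Bs → concatMap options (map slot Bs) ≡ concatMap ends Bs
      slot-options [] = refl
      slot-options (_ ∷ Bs) = cong (λ l → _ ∷ _ ∷ l) (slot-options Bs)
      keys-all : map key (map slot Bs) ++ map proj₁ (P ++ P′) ≡
        map proj₁ cores ++ concatMap (neighbours G) (map proj₁ cores) ++ Rest
      keys-all = cong₂ _++_ (trans (slot-keys Bs) keysB) (trans (map-++ proj₁ P P′)
        (cong₂ _++_ (trans keysP (cong (concatMap (neighbours G)) keysB)) keysP′))
      values-all : (concatMap options (map slot Bs) ++ map proj₂ (P ++ P′)) ++ Q ↭ concatMap body Bs ++ rest
      values-all = ↭-trans (↭-reflexive (cong₂ (λ a b → (a ++ b) ++ Q) (slot-options Bs)
          (trans (map-++ proj₂ P P′) (cong (_++ map proj₂ P′) valuesP))))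
        (↭-trans (solve 4 (λ e l p q → (e ⊕ (l ⊕ p)) ⊕ q ⊜ (e ⊕ l) ⊕ (p ⊕ q)) ↭-refl
            (concatMap ends Bs) (concatMap leaves Bs) (map proj₂ P′) Q)
          (↭-++⁺ (bodies-↭ Bs) (↭-reflexive valuesP′)))
      fixed : ∀ {φ ψ} → Extends φ (P ++ P′) → Extends ψ (P ++ P′) → ∀ i → b i ≡ false → φ i ≡ ψ i
      fixed {φ} {ψ} ext ext′ i bi with ∈-++⁻ (map key (map slot Bs)) (subst (i ∈_) (≡-sym keys-all) (∈-resp-↭ (↭-sym cover) (∈-allFin i)))
      ... | inj₁ i∈ with trans (≡-sym bi) (∈-members⁻ {b = b} (∈-resp-↭ keys (subst (i ∈_) (trans (slot-keys Bs) keysB) i∈)))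
      ...   | ()
      fixed {φ} {ψ} ext ext′ i bi | inj₂ i∈ with ∈-map⁻ proj₁ i∈
      ... | (_ , x) , q , refl = trans (All.lookup ext q) (≡-sym (All.lookup ext′ q))
      swap-sums : ∀ o a b → o + a + b ≡ o + b + a
      swap-sums = solve-∀
      stable : ∀ φ ψ → Fits φ (P ++ P′) (map slot Bs) → Fits ψ (P ++ P′) (map slot Bs) →
        copyWeight G f φ + sum (map (worth ψ) (map slot Bs)) ≈ copyWeight G f ψ + sum (map (worth φ) (map slot Bs))
      stable φ ψ (ext , _) (ext′ , _) = ≡⇒≈ (trans (cong (_+ sum (map (worth ψ) (map slot Bs))) (weight φ ext))
        (trans (swap-sums (outside φ) _ _) (trans (cong (λ o → o + sum (map (worth ψ) (map slot Bs)) + sum (map (worth φ) (map slot Bs)))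
          (outside-cong (fixed ext ext′))) (cong (_+ sum (map (worth φ) (map slot Bs))) (≡-sym (weight ψ ext′))))))
        where
        weight : ∀ φ → Extends φ (P ++ P′) → copyWeight G f φ ≡ outside φ + sum (map (worth φ) (map slot Bs))
        weight φ ext = weight-of-blocks Bs (↭-trans (↭-reflexive keysB) keys) (linked (Allₚ.++⁻ˡ P ext))

-- Colourings of the form h x + h y + κ

greedy-disjoint : {X T : Set} (pts : T → List X) (Good : T → Set) (Exhausted : List X → Set) (c : ℕ) →
  (∀ t → length (pts t) ≡ c) →
  (∀ V → Unique V → (∃₂ λ t R → Good t × pts t ++ R ↭ V) ⊎ Exhausted V) →
  ∀ m V → Unique V →
  (∃₂ λ ts R → All Good ts × length ts ≡ m × concatMap pts ts ++ R ↭ V) ⊎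
  (∃₂ λ U k → k < m × Unique U × Exhausted U × length V ≤ length U + k * c)
greedy-disjoint pts Good Exhausted c size step zero V uV = inj₁ ([] , V , [] , refl , ↭-refl)
greedy-disjoint pts Good Exhausted c size step (suc m) V uV with step V uV
... | inj₂ stuck = inj₂ (V , 0 , s≤s z≤n , uV , stuck , ≤-reflexive (≡-sym (+-identityʳ _)))
... | inj₁ (t , R , good , p) with greedy-disjoint pts Good Exhausted c size step m R
    (Unique-++⁻ʳ (pts t) (Unique-resp-↭ (↭-sym p) uV))
...   | inj₁ (ts , R′ , goods , k , p′) = inj₁ (t ∷ ts , R′ , good ∷ goods , cong suc k ,
        ↭-trans (↭-reflexive (Listₚ.++-assoc (pts t) _ R′)) (↭-trans (↭-++⁺ˡ (pts t) p′) p))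
...   | inj₂ (U , k , k<m , uU , stuck , le) = inj₂ (U , suc k , s≤s k<m , uU , stuck ,
        ≤-trans (≤-reflexive (trans (≡-sym (↭-length p)) (trans (length-++ (pts t)) (cong (_+ length R) (size t)))))
          (≤-trans (+-monoʳ-≤ c le) (≤-reflexive (lem c (length U) (k * c)))))
  where
  lem : ∀ a b c → a + (b + c) ≡ b + (a + c)
  lem = solve-∀

module AdditiveCopies (p : ℕ) (pp : Prime p) {n : ℕ} (G : Graph n) {N : ℕ}
  (f : Fin N → Fin N → Fin p) (f-sym : IsColouring N p f) (p∣e : p ∣ e G) where

  open GadgetCopies p pp G f f-sym public
  open ↭-Solver

  sumFin-≈ : ∀ {m} {g h : Fin m → ℕ} → (∀ i → g i ≈ h i) → sumFin g ≈ sumFin h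
  sumFin-≈ {zero} q = ≈-refl
  sumFin-≈ {suc m} q = +-cong (q Fin.zero) (sumFin-≈ (q ∘ Fin.suc))

  sumPairs-≈ : ∀ {m} {g h : Fin m → Fin m → ℕ} → (∀ i j → g i j ≈ h i j) → sumPairs g ≈ sumPairs h
  sumPairs-≈ {g = g} {h} q = sumFin-≈ λ i → sumFin-≈ λ j → go (toℕ i ℕ.<ᵇ toℕ j) (q i j)
    where
    go : ∀ b {x y} → x ≈ y → (if b then x else 0) ≈ (if b then y else 0)
    go true r = r
    go false r = ≈-refl

  sum-≈ : {A : Set} {g h : A → ℕ} (L : List A) → All (λ x → g x ≈ h x) L → sum (map g L) ≈ sum (map h L)
  sum-≈ [] [] = ≈-refl
  sum-≈ (_ ∷ L) (q ∷ qs) = +-cong q (sum-≈ L qs)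

  constant-weight≈0 : ∀ k → sumPairs (λ i j → if adj G i j then k else 0) ≈ 0
  constant-weight≈0 k = ≈-trans (≡⇒≈ (trans (sumPairs-cong λ i j → unit (adj G i j))
      (sumPairs-*ʳ (λ i j → if adj G i j then 1 else 0) k)))
    (∣⇒≈0 (∣m⇒∣m*n k p∣e))
    where
    unit : ∀ b → (if b then k else 0) ≡ (if b then 1 else 0) * k
    unit true = ≡-sym (+-identityʳ k)
    unit false = refl

  degree-sum≈0 : ∀ k → sumFin (λ i → deg G i * k) ≈ 0
  degree-sum≈0 k = ≈-trans (≡⇒≈ (≡-sym (handshake G (λ _ → k)))) (constant-weight≈0 (k + k))

  p∤deg : Fin n → Bool
  p∤deg v = not (Relation.Nullary.does (p ∣? deg G v))

  p∤deg-sound : ∀ v → p∤deg v ≡ true → ¬ p ∣ deg G v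
  p∤deg-sound v q with p ∣? deg G v
  ... | no ¬d = ¬d

  p∣deg-sound : ∀ v → p∤deg v ≡ false → p ∣ deg G v
  p∣deg-sound v q with p ∣? deg G v
  ... | yes d = d

  -- Modulo p, only these vertices contribute to Σ deg(v) h(φ v).
  live : List (Fin n)
  live = members p∤deg

  live-sum : ∀ (g : Fin n → ℕ) → sumFin (λ i → deg G i * g i) ≈ sum (map (λ v → deg G v * g v) live)
  live-sum g = ≈-trans (sumFin-≈ λ i → go i (p∤deg i) refl) (≡⇒≈ (sumFin-members p∤deg (λ i → deg G i * g i)))
    where
    go : ∀ i x → p∤deg i ≡ x → deg G i * g i ≈ (if x then deg G i * g i else 0)
    go i true q = ≈-refl
    go i false q = ∣⇒≈0 (∣m⇒∣m*n (g i) (p∣deg-sound i q))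

  module _ (h : Fin N → ℕ) (κ : ℕ) {U : List (Fin N)} (uU : Unique U)
    (additive : ∀ {x y} → x ∈ U → y ∈ U → x ≢ y → F x y ≈ h x + h y + κ) where

    additive-weight : ∀ φ → Injective _≡_ _≡_ φ → (∀ u → φ u ∈ U) →
      copyWeight G f φ ≈ sum (map (λ v → deg G v * h (φ v)) live)
    additive-weight φ inj inU = begin
      copyWeight G f φ
        ≈⟨ sumPairs-≈ (λ i j → go i j (adj G i j) refl) ⟩
      sumPairs (λ i j → (if adj G i j then h (φ i) + h (φ j) else 0) + (if adj G i j then κ else 0))
        ≡⟨ sumPairs-+ (λ i j → if adj G i j then h (φ i) + h (φ j) else 0) (λ i j → if adj G i j then κ else 0) ⟩
      sumPairs (λ i j → if adj G i j then h (φ i) + h (φ j) else 0) + sumPairs (λ i j → if adj G i j then κ else 0)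
        ≈⟨ +-cong (≡⇒≈ (handshake G (h ∘ φ))) (constant-weight≈0 κ) ⟩
      sumFin (λ i → deg G i * h (φ i)) + 0
        ≡⟨ +-identityʳ _ ⟩
      sumFin (λ i → deg G i * h (φ i))
        ≈⟨ live-sum (h ∘ φ) ⟩
      sum (map (λ v → deg G v * h (φ v)) live) ∎
      where
      open import Relation.Binary.Reasoning.Setoid ≈-setoid
      go : ∀ i j b → adj G i j ≡ b → (if b then F (φ i) (φ j) else 0) ≈
        (if b then h (φ i) + h (φ j) else 0) + (if b then κ else 0)
      go i j true q = additive (inU i) (inU j) λ r → case trans (≡-sym q) (trans (cong (adj G i) (≡-sym (inj r))) (irrefl G i)) of λ ()
      go i j false q = ≈-refl

  module _ (h : Fin N → ℕ) where

    representatives : ∀ V → ∃₂ λ B R → B ++ R ↭ V × Incongruent (map h B) × (∀ {u} → u ∈ V → Any (λ b → h u ≈ h b) B)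
    representatives [] = [] , [] , ↭-refl , [] , λ ()
    representatives (u ∷ V) with representatives V
    ... | B , R , q , inc , rep with any? (λ b → h u ≈? h b) B
    ...   | yes r = B , u ∷ R , ↭-trans (shift u B R) (↭-prep u q) , inc , λ { (here refl) → r ; (there v∈) → rep v∈ }
    ...   | no ¬r = u ∷ B , R , ↭-prep u q , Allₚ.map⁺ (Allₚ.¬Any⇒All¬ B ¬r) ∷ inc ,
      λ { (here refl) → here ≈-refl ; (there v∈) → there (rep v∈) }

    OptionLists : List (Fin n) → List (Fin N) → ℕ → Set
    OptionLists vs V t = ∃₂ λ (Bs : List (Fin n × List (Fin N))) R → map proj₁ Bs ≡ vs ×
      All (λ (_ , B) → Incongruent (map h B) × 1 ≤ length B) Bs ×
      sum (map (λ (_ , B) → length B ∸ 1) Bs) ≡ t × concatMap proj₂ Bs ++ R ↭ V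

    singletons : ∀ vs V → length vs ≤ length V → OptionLists vs V 0
    singletons [] V _ = [] , V , refl , [] , refl , ↭-refl
    singletons (v ∷ vs) (x ∷ V) (s≤s le) with singletons vs V le
    ... | Bs , R , k , ok , t , q = (v , [ x ]) ∷ Bs , R , cong (v ∷_) k , (([] ∷ []) , s≤s z≤n) ∷ ok , t , ↭-prep x q

    -- Hand each vertex one representative of every h-value still present. If values remain
    -- at the end, then such a value was present in every round.
    distribute : ∀ vs V t → length vs + t ≤ length V → OptionLists vs V t ⊎
      (∃₂ λ u bs → ∃ λ R → length bs ≡ length vs × All (λ b → h b ≈ h u) bs × bs ++ R ↭ V × u ∈ V)
    distribute [] V zero le = inj₁ ([] , V , refl , [] , refl , ↭-refl)
    distribute [] (u ∷ V) (suc t) le = inj₂ (u , [] , u ∷ V , refl , [] , ↭-refl , here refl)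
    distribute (v ∷ vs) V@(_ ∷ _) t (s≤s le) with representatives V
    ... | [] , R , q , inc , rep with rep (here refl)
    ...   | ()
    distribute (v ∷ vs) V@(_ ∷ _) t (s≤s le) | B@(b₀ ∷ B₀) , R , q , inc , rep with suc t ℕ.≤? length B
    -- v alone takes t + 1 options and supplies the whole excess; one option each is enough for the
    -- others.
    ... | yes t<|B| with singletons vs (drop (suc t) B ++ R) (+-cancelʳ-≤ (suc t) (length vs) _
        (≤-trans (≤-reflexive (+-suc (length vs) t)) (≤-trans (s≤s le) (≤-reflexive (trans (≡-sym (↭-length q)) size)))))
      where
      size : length (B ++ R) ≡ length (drop (suc t) B ++ R) + suc t
      size = trans (cong length (trans (cong (_++ R) (≡-sym (take++drop≡id (suc t) B))) (Listₚ.++-assoc (take (suc t) B) (drop (suc t) B) R)))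
        (trans (length-++ (take (suc t) B)) (trans (+-comm (length (take (suc t) B)) _)
          (cong (length (drop (suc t) B ++ R) +_) (trans (length-take (suc t) B) (m≤n⇒m⊓n≡m t<|B|)))))
    ...   | Bs , R′ , k , ok , t≡ , q′ = inj₁ ((v , take (suc t) B) ∷ Bs , R′ , cong (v ∷_) k ,
      (subst Incongruent (Listₚ.take-map (suc t) B) (AllPairsₚ.take⁺ (suc t) inc) , s≤s z≤n) ∷ ok ,
      trans (cong₂ _+_ (cong (_∸ 1) (trans (length-take (suc t) B) (m≤n⇒m⊓n≡m t<|B|))) t≡) (+-identityʳ t) ,
      ↭-trans (↭-reflexive (Listₚ.++-assoc (take (suc t) B) _ R′)) (↭-trans (↭-++⁺ˡ (take (suc t) B) q′)
        (↭-trans (↭-reflexive (trans (≡-sym (Listₚ.++-assoc (take (suc t) B) _ R)) (cong (_++ R) (take++drop≡id (suc t) B)))) q)))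
    distribute (v ∷ vs) V@(_ ∷ _) t (s≤s le) | B@(b₀ ∷ B₀) , R , q , inc , rep | no t≮|B|
      with distribute vs R (t ∸ length B₀) (+-cancelˡ-≤ (suc (length B₀)) _ _ (≤-trans (≤-reflexive room)
        (≤-trans (s≤s le) (≤-reflexive (trans (≡-sym (↭-length q)) (length-++ B))))))
      where
      |B₀|≤t : length B₀ ≤ t
      |B₀|≤t = s≤s⁻¹ (≤-trans (≮⇒≥ t≮|B|) (n≤1+n t))
      comm : ∀ a b c → suc a + (b + c) ≡ suc b + (a + c)
      comm = solve-∀
      room : suc (length B₀) + (length vs + (t ∸ length B₀)) ≡ suc (length vs + t)
      room = trans (comm (length B₀) (length vs) _) (cong (λ x → suc (length vs) + x) (m+[n∸m]≡n |B₀|≤t))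
    ... | inj₁ (Bs , R′ , k , ok , t≡ , q′) = inj₁ ((v , B) ∷ Bs , R′ , cong (v ∷_) k ,
      (inc , s≤s z≤n) ∷ ok , trans (cong (length B₀ +_) t≡) (m+[n∸m]≡n (s≤s⁻¹ (≤-trans (≮⇒≥ t≮|B|) (n≤1+n t)))) ,
      ↭-trans (↭-reflexive (Listₚ.++-assoc B _ R′)) (↭-trans (↭-++⁺ˡ B q′) q))
    ... | inj₂ (u , bs , R′ , k , same , q′ , u∈) with find (rep (∈-resp-↭ q (∈-++⁺ʳ B u∈)))
    ...   | b , b∈ , u≈b with ∈⇒↭∷ b∈
    ...   | B′ , r = inj₂ (u , b ∷ bs , B′ ++ R′ , cong suc k , ≈-sym u≈b ∷ same ,
      ↭-trans (solve 4 (λ b s B R → b ⊕ (s ⊕ (B ⊕ R)) ⊜ (b ⊕ B) ⊕ (s ⊕ R)) ↭-refl [ b ] bs B′ R′)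
        (↭-trans (↭-++⁺ (↭-sym r) q′) q) , ∈-resp-↭ q (∈-++⁺ʳ B u∈))

module SwitchFreeCopies (p : ℕ) (pp : Prime p) {n : ℕ} (G : Graph n) {N : ℕ}
  (f : Fin N → Fin N → Fin p) (f-sym : IsColouring N p f) (p∣e : p ∣ e G) where

  open AdditiveCopies p pp G f f-sym p∣e public
  open ↭-Solver

  ZeroCopy : Set
  ZeroCopy = ∃ λ φ → Injective _≡_ _≡_ φ × copyWeight G f φ ≈ 0

  module _ (h : Fin N → ℕ) (κ : ℕ) {U : List (Fin N)} (uU : Unique U)
    (additive : ∀ {x y} → x ∈ U → y ∈ U → x ≢ y → F x y ≈ h x + h y + κ) where

    dead : ∃ λ R → live ++ R ↭ List.allFin n
    dead = complement live (List.allFin n) (members-unique p∤deg) (λ _ → ∈-allFin _)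

    |live|+|dead| : length live + length (proj₁ dead) ≡ n
    |live|+|dead| = trans (≡-sym (length-++ live)) (trans (↭-length (proj₂ dead)) (Listₚ.length-tabulate id))

    spread-slot : Fin n × List (Fin N) → Slot {Fin n} {Fin N}
    spread-slot (v , B) = v , B , λ z → deg G v * h z

    -- For live v the degree is invertible modulo p, so options with incongruent h-values have
    -- incongruent worths, and excess p - 1 reaches every weight.
    spread⇒zero-copy : n + (p ∸ 1) ≤ length U → OptionLists h live U (p ∸ 1) → ZeroCopy
    spread⇒zero-copy big (Bs , R , keys , ok , t , q) with pairing (proj₁ dead) R |dead|≤|R|
      where
      total-size : ∀ Bs → All (λ (_ , B) → Incongruent (map h B) × 1 ≤ length B) Bs →
        length (concatMap proj₂ Bs) ≡ length (map proj₁ Bs) + sum (map (λ (_ , B) → length B ∸ 1) Bs)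
      total-size [] [] = refl
      total-size ((v , x ∷ B) ∷ Bs) (_ ∷ ok) = cong suc (trans (length-++ B) (trans (cong (length B +_) (total-size Bs ok))
        (lem (length B) (length (map proj₁ Bs)) _)))
        where
        lem : ∀ a b c → a + (b + c) ≡ b + (a + c)
        lem = solve-∀
      |dead|≤|R| : length (proj₁ dead) ≤ length R
      |dead|≤|R| = +-cancelˡ-≤ (length live + (p ∸ 1)) _ _ (≤-trans (≤-reflexive (trans (lem (length live) (p ∸ 1) _)
          (cong (_+ (p ∸ 1)) |live|+|dead|))) (≤-trans big (≤-reflexive (trans (≡-sym (↭-length q)) (trans (length-++ (concatMap proj₂ Bs))
          (cong (_+ length R) (trans (total-size Bs ok) (cong₂ _+_ (cong length keys) t))))))))
        where
        lem : ∀ a b c → a + b + c ≡ a + c + b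
        lem = solve-∀
    ... | P , Q , keysP , valuesP = switch P (map spread-slot Bs)
      (λ u → subst (u ∈_) (≡-sym keys-all) (∈-resp-↭ (↭-sym (proj₂ dead)) (∈-allFin u)))
      (subst Unique (≡-sym keys-all) (Unique-resp-↭ (↭-sym (proj₂ dead)) (Uniqueₚ.allFin⁺ n)))
      (Unique-++⁻ˡ _ (Unique-resp-↭ (↭-sym values-all) uU))
      (Allₚ.map⁺ (varied Bs (λ v∈ → subst (_ ∈_) keys v∈) ok))
      (≤-reflexive (≡-sym (trans (excess-sizes Bs) t)))
      (copyWeight G f)
      (λ φ ψ iφ iψ fφ fψ → ≈-trans (+-cong (weight φ iφ fφ) (≈-sym (weight ψ iψ fψ))) (≡⇒≈ (+-comm (sum (map (worth φ) (map spread-slot Bs))) _)))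
      where
      slot-keys : ∀ Bs → map key (map spread-slot Bs) ≡ map proj₁ Bs
      slot-keys [] = refl
      slot-keys (_ ∷ Bs) = cong (_ ∷_) (slot-keys Bs)
      slot-options : ∀ Bs → concatMap options (map spread-slot Bs) ≡ concatMap proj₂ Bs
      slot-options [] = refl
      slot-options ((_ , B) ∷ Bs) = cong (B ++_) (slot-options Bs)
      keys-all : map key (map spread-slot Bs) ++ map proj₁ P ≡ live ++ proj₁ dead
      keys-all = cong₂ _++_ (trans (slot-keys Bs) keys) keysP
      values-all : (concatMap options (map spread-slot Bs) ++ map proj₂ P) ++ Q ↭ U
      values-all = ↭-trans (↭-reflexive (trans (Listₚ.++-assoc (concatMap options (map spread-slot Bs)) _ Q)
        (cong₂ _++_ (slot-options Bs) valuesP))) q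
      excess-sizes : ∀ Bs → excess (map worths (map spread-slot Bs)) ≡ sum (map (λ (_ , B) → length B ∸ 1) Bs)
      excess-sizes [] = refl
      excess-sizes ((_ , B) ∷ Bs) = cong₂ _+_ (cong (_∸ 1) (length-map _ B)) (excess-sizes Bs)
      varied : ∀ Bs → (∀ {v} → v ∈ map proj₁ Bs → v ∈ live) →
        All (λ (_ , B) → Incongruent (map h B) × 1 ≤ length B) Bs →
        All (λ B → Incongruent (worths (spread-slot B)) × 1 ≤ length (worths (spread-slot B))) Bs
      varied [] _ [] = []
      varied ((v , B) ∷ Bs) sub ((inc , 1≤) ∷ ok) =
        (AllPairsₚ.map⁺ (AllPairs.map (λ ne r → ne (*-cancelˡ-≈ (p∤deg-sound v (∈-members⁻ {b = p∤deg} (sub (here refl)))) r))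
          (AllPairsₚ.map⁻ inc)) , ≤-trans 1≤ (≤-reflexive (≡-sym (length-map _ B)))) ∷ varied Bs (sub ∘ there) ok
      in-options : ∀ (φ : Fin n → Fin N) {v} → (Bs′ : List (Slot {Fin n} {Fin N})) → All (λ s → φ (key s) ∈ options s) Bs′ → v ∈ map key Bs′ →
        φ v ∈ concatMap options Bs′
      in-options φ (s ∷ Bs′) (r ∷ _) (here refl) = ∈-++⁺ˡ r
      in-options φ (s ∷ Bs′) (_ ∷ rs) (there v∈) = ∈-++⁺ʳ (options s) (in-options φ Bs′ rs v∈)
      inU : ∀ φ → Fits φ P (map spread-slot Bs) → ∀ u → φ u ∈ U
      inU φ (ext , opt) u with ∈-++⁻ (map key (map spread-slot Bs))
          (subst (u ∈_) (≡-sym keys-all) (∈-resp-↭ (↭-sym (proj₂ dead)) (∈-allFin u)))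
      ... | inj₁ u∈ = ∈-resp-↭ values-all (∈-++⁺ˡ (∈-++⁺ˡ (in-options φ (map spread-slot Bs) opt u∈)))
      ... | inj₂ u∈ with ∈-map⁻ proj₁ u∈
      ...   | (_ , x) , r , refl = ∈-resp-↭ values-all (∈-++⁺ˡ (∈-++⁺ʳ (concatMap options (map spread-slot Bs))
              (subst (_∈ map proj₂ P) (≡-sym (All.lookup ext r)) (∈-map⁺ proj₂ r))))
      weight : ∀ φ → Injective _≡_ _≡_ φ → Fits φ P (map spread-slot Bs) →
        copyWeight G f φ ≈ sum (map (worth φ) (map spread-slot Bs))
      weight φ iφ fφ = ≈-trans (additive-weight h κ uU additive φ iφ (inU φ fφ))
        (≡⇒≈ (cong sum (trans (cong (map _) (≡-sym keys)) (go Bs))))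
        where
        go : ∀ Bs → map (λ v → deg G v * h (φ v)) (map proj₁ Bs) ≡ map (worth φ) (map spread-slot Bs)
        go [] = refl
        go (_ ∷ Bs) = cong (_ ∷_) (go Bs)

    -- With a single h-value on the live vertices, the weight is congruent to that value times Σ
    -- deg(v) = 2 e(G).
    constant⇒zero-copy : n ≤ length U → ∀ {u bs R} → length bs ≡ length live → All (λ b → h b ≈ h u) bs →
      bs ++ R ↭ U → ZeroCopy
    constant⇒zero-copy big {u} {bs} {R} |bs| same q with exact-pairing live bs (≡-sym |bs|)
      | pairing (proj₁ dead) R (+-cancelˡ-≤ (length live) _ _ (≤-trans (≤-reflexive |live|+|dead|)
          (≤-trans big (≤-reflexive (trans (≡-sym (↭-length q)) (trans (length-++ bs) (cong (_+ length R) |bs|)))))))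
    ... | P , keys , values | P′ , Q , keys′ , values′ with embedding (P ++ P′)
        (λ u → subst (u ∈_) (≡-sym keys-all) (∈-resp-↭ (↭-sym (proj₂ dead)) (∈-allFin u)))
        (subst Unique (≡-sym keys-all) (Unique-resp-↭ (↭-sym (proj₂ dead)) (Uniqueₚ.allFin⁺ n)))
        (Unique-++⁻ˡ _ (Unique-resp-↭ (↭-sym values-all) uU))
      where
      keys-all : map proj₁ (P ++ P′) ≡ live ++ proj₁ dead
      keys-all = trans (map-++ proj₁ P P′) (cong₂ _++_ keys keys′)
      values-all : map proj₂ (P ++ P′) ++ Q ↭ U
      values-all = ↭-trans (↭-reflexive (trans (cong (_++ Q) (map-++ proj₂ P P′))
        (trans (Listₚ.++-assoc (map proj₂ P) _ Q) (cong₂ _++_ values values′)))) q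
    ... | φ , inj , ext = φ , inj , ≈-trans (additive-weight h κ uU additive φ inj inU)
        (≈-trans (sum-≈ live (All.tabulate λ {v} v∈ → *-congˡ (deg G v) (equal v∈)))
          (≈-trans (≈-sym (live-sum (λ _ → h u))) (degree-sum≈0 (h u))))
      where
      equal : ∀ {v} → v ∈ live → h (φ v) ≈ h u
      equal {v} v∈ with ∈-map⁻ proj₁ (subst (v ∈_) (≡-sym keys) v∈)
      ... | (_ , x) , r , refl = subst (λ z → h z ≈ h u) (≡-sym (All.lookup ext (∈-++⁺ˡ r)))
        (All.lookup same (subst (x ∈_) values (∈-map⁺ proj₂ r)))
      inU : ∀ u → φ u ∈ U
      inU u with ∈-++⁻ (map proj₁ P) (subst (u ∈_) (≡-sym (cong₂ _++_ keys keys′)) (∈-resp-↭ (↭-sym (proj₂ dead)) (∈-allFin u)))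
      ... | inj₁ u∈ with ∈-map⁻ proj₁ u∈
      ...   | (_ , x) , r , refl = subst (_∈ U) (≡-sym (All.lookup ext (∈-++⁺ˡ r)))
        (∈-resp-↭ q (∈-++⁺ˡ (subst (x ∈_) values (∈-map⁺ proj₂ r))))
      inU u | inj₂ u∈ with ∈-map⁻ proj₁ u∈
      ... | (_ , x) , r , refl = subst (_∈ U) (≡-sym (All.lookup ext (∈-++⁺ʳ P r)))
        (∈-resp-↭ q (∈-++⁺ʳ bs (subst (x ∈_) values′ (∈-++⁺ˡ (∈-map⁺ proj₂ r)))))

    additive⇒zero-copy : n + (p ∸ 1) ≤ length U → ZeroCopy
    additive⇒zero-copy big with distribute h live U (p ∸ 1)
      (≤-trans (+-monoˡ-≤ (p ∸ 1) (≤-trans (m≤m+n _ _) (≤-reflexive |live|+|dead|))) big)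
    ... | inj₁ spread = spread⇒zero-copy big spread
    ... | inj₂ (_ , _ , _ , |bs| , same , q , _) = constant⇒zero-copy (≤-trans (m≤m+n n _) big) |bs| same q

  -- The alternating sum around the 4-cycle x a y b is nonzero.
  Switch : Fin N × Fin N × Fin N × Fin N → Set
  Switch (x , y , a , b) = F x a + F y b ≉ F x b + F y a

  corners : Fin N × Fin N × Fin N × Fin N → List (Fin N)
  corners (x , y , a , b) = x ∷ y ∷ a ∷ b ∷ []

  SwitchFree : List (Fin N) → Set
  SwitchFree V = ∀ t → Unique (corners t) → All (_∈ V) (corners t) → ¬ Switch t

  find-switch : ∀ V → Unique V → (∃₂ λ t R → Switch t × corners t ++ R ↭ V) ⊎ SwitchFree V
  find-switch V uV with search4 {P = λ t → Switch t × Unique (corners t) × All (_∈ V) (corners t)}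
      (λ t → switch? t ×-dec unique? (corners t) ×-dec all? (_∈? V) (corners t))
    where
    open import Data.List.Membership.DecPropositional (Fin._≟_ {N}) using (_∈?_)
    open import Data.List.Relation.Unary.Unique.DecPropositional (Fin._≟_ {N}) using (unique?)
    search1 : Searchable (Fin N)
    search1 = Finₚ.any?
    search4 : Searchable (Fin N × Fin N × Fin N × Fin N)
    search4 = search-× search1 (search-× search1 (search-× search1 search1))
    switch? : ∀ t → Dec (Switch t)
    switch? (x , y , a , b) = ¬? (F x a + F y b ≈? F x b + F y a)
  ... | yes (t , s , u , sub) = let R , q = complement (corners t) V u (All.lookup sub) in inj₁ (t , R , s , q)
  ... | no none = inj₂ λ t u sub s → none (t , s , u , sub)

  -- Vanishing alternating sums determine every F x y from the edges at two vertices o and o′, which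
  -- gives F the form h x + h y + κ away from o′. Dropping o′ is why n + p vertices are asked for
  -- instead of n + p - 1.
  switch-free⇒zero-copy : ∀ {V} → Unique V → SwitchFree V → 1 ≤ n → n + p ≤ length V → ZeroCopy
  switch-free⇒zero-copy {[]} uV free 1≤n big = ⊥-elim (<⇒≱ (≤-trans 1≤n (m≤m+n n p)) big)
  switch-free⇒zero-copy {o′ ∷ []} uV free 1≤n big = ⊥-elim (<⇒≱ (+-mono-≤ 1≤n (ℕ.>-nonZero⁻¹ p)) big)
  switch-free⇒zero-copy {o′ ∷ o ∷ []} uV free 1≤n big =
    ⊥-elim (<⇒≱ (+-mono-≤ 1≤n (ℕ.nonTrivial⇒n>1 p {{prime⇒nonTrivial pp}})) big)
  switch-free⇒zero-copy {V@(o′ ∷ o ∷ x₀ ∷ V′)} (u₁@(o′≢o ∷ o′≢x₀ ∷ _) ∷ uU@(u₂@(o≢x₀ ∷ _) ∷ uV)) free 1≤n big =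
    additive⇒zero-copy h κ uU additive (s≤s⁻¹ (≤-trans (≤-reflexive (≡-sym (trans (cong (n +_) (≡-sym (m+[n∸m]≡n (ℕ.>-nonZero⁻¹ p))))
      (+-suc n (p ∸ 1))))) big))
    where
    open import Relation.Binary.Reasoning.Setoid ≈-setoid
    h : Fin N → ℕ
    -- F x o′ - F x o has the same value τ for all x, so F x y = F x o′ + F o y - F o o′ becomes F x
    -- o + F y o + κ. Setting h o = -κ extends the formula to the edges at o.
    τ κ : ℕ
    τ = F x₀ o′ + neg (F x₀ o)
    κ = τ + neg (F o o′)
    h x with x Fin.≟ o
    ... | yes _ = neg κ
    ... | no _ = F x o
    exchange-o : ∀ {x y} → x ∈ x₀ ∷ V′ → y ∈ x₀ ∷ V′ → x ≢ y → F x y + F o o′ ≈ F x o′ + F o y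
    exchange-o {x} {y} x∈ y∈ x≢y with F x y + F o o′ ≈? F x o′ + F o y
    ... | yes q = q
    ... | no s = ⊥-elim (free (x , o , y , o′)
      (((All.lookup u₂ x∈ ∘ ≡-sym) ∷ x≢y ∷ (All.lookup u₁ (there x∈) ∘ ≡-sym) ∷ []) ∷
       (All.lookup u₂ y∈ ∷ (o′≢o ∘ ≡-sym) ∷ []) ∷ ((All.lookup u₁ (there y∈) ∘ ≡-sym) ∷ []) ∷ [] ∷ [])
      (there (there x∈) ∷ there (here refl) ∷ there (there y∈) ∷ here refl ∷ []) s)
    subtract : ∀ {a b c} → a + b ≈ c → a ≈ c + neg b
    subtract {a} {b} {c} q = +-cancelʳ-≈ b (≈-trans q (≈-trans (≡⇒≈ (≡-sym (+-identityʳ c)))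
      (≈-trans (+-cong (≈-refl {c}) (≈-sym (neg-inverse b))) (≡⇒≈ (lem c b (neg b))))))
      where
      lem : ∀ a b c → a + (b + c) ≡ a + c + b
      lem = solve-∀
    shift-τ : ∀ {x} → x ∈ x₀ ∷ V′ → F x o′ ≈ F x o + τ
    shift-τ {x} x∈ with x Fin.≟ x₀
    ... | yes refl = ≈-trans (subtract (≡⇒≈ (+-comm (F x o′) (F x o)))) (≡⇒≈ (+-assoc (F x o) _ _))
    ... | no x≢x₀ = ≈-trans (subtract (begin
      F x o′ + F x₀ o   ≡⟨ cong (F x o′ +_) (F-sym x₀ o) ⟩
      F x o′ + F o x₀   ≈⟨ ≈-sym (exchange-o x∈ (here refl) x≢x₀) ⟩
      F x x₀ + F o o′   ≡⟨ cong (_+ F o o′) (F-sym x x₀) ⟩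
      F x₀ x + F o o′   ≈⟨ exchange-o (here refl) x∈ (x≢x₀ ∘ ≡-sym) ⟩
      F x₀ o′ + F o x   ≡⟨ trans (cong (F x₀ o′ +_) (F-sym o x)) (+-comm (F x₀ o′) (F x o)) ⟩
      F x o + F x₀ o′ ∎)) (≡⇒≈ (+-assoc (F x o) _ _))
    h-other : ∀ {x} → x ∈ x₀ ∷ V′ → h x ≡ F x o
    h-other {x} x∈ with x Fin.≟ o
    ... | yes refl = ⊥-elim (All.lookup u₂ x∈ refl)
    ... | no _ = refl
    h-o : h o ≡ neg κ
    h-o with o Fin.≟ o
    ... | yes _ = refl
    ... | no o≢o = ⊥-elim (o≢o refl)
    through-o : ∀ {x} → x ∈ x₀ ∷ V′ → F x o ≈ h x + h o + κ
    through-o {x} x∈ = begin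
      F x o                  ≡⟨ ≡-sym (+-identityʳ (F x o)) ⟩
      F x o + 0              ≈⟨ +-cong ≈-refl (≈-sym (neg-inverse κ)) ⟩
      F x o + (κ + neg κ)    ≡⟨ cong (F x o +_) (+-comm κ (neg κ)) ⟩
      F x o + (neg κ + κ)    ≡⟨ ≡-sym (+-assoc (F x o) (neg κ) κ) ⟩
      F x o + neg κ + κ      ≡⟨ cong₂ (λ a b → a + b + κ) (≡-sym (h-other x∈)) (≡-sym h-o) ⟩
      h x + h o + κ ∎
    additive : ∀ {x y} → x ∈ o ∷ x₀ ∷ V′ → y ∈ o ∷ x₀ ∷ V′ → x ≢ y → F x y ≈ h x + h y + κ
    additive (here refl) (here refl) x≢y = ⊥-elim (x≢y refl)
    additive {x} {y} (here refl) (there y∈) _ = ≈-trans (≡⇒≈ (F-sym x y))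
      (≈-trans (through-o y∈) (≡⇒≈ (cong (_+ κ) (+-comm (h y) (h x)))))
    additive (there x∈) (here refl) _ = through-o x∈
    additive {x} {y} (there x∈) (there y∈) x≢y = begin
      F x y                                     ≈⟨ subtract (exchange-o x∈ y∈ x≢y) ⟩
      F x o′ + F o y + neg (F o o′)             ≈⟨ +-cong (+-cong (shift-τ x∈) (≡⇒≈ (F-sym o y))) ≈-refl ⟩
      F x o + τ + F y o + neg (F o o′)          ≡⟨ lem (F x o) τ (F y o) (neg (F o o′)) ⟩
      F x o + F y o + κ                         ≡⟨ cong₂ (λ a b → a + b + κ) (≡-sym (h-other x∈)) (≡-sym (h-other y∈)) ⟩
      h x + h y + κ ∎
      where
      lem : ∀ a b c d → a + b + c + d ≡ a + c + (b + d)
      lem = solve-∀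

-- The 2-packing and the upper bounds

allFin-intro : ∀ {n} {g : Fin n → Bool} → (∀ i → g i ≡ true) → allFin g ≡ true
allFin-intro {zero} q = refl
allFin-intro {suc n} q = cong₂ _∧_ (q Fin.zero) (allFin-intro (q ∘ Fin.suc))

allFin-elim : ∀ {n} {g : Fin n → Bool} → allFin g ≡ true → ∀ i → g i ≡ true
allFin-elim {suc n} {g} q i with g Fin.zero in g0
allFin-elim {suc n} {g} q Fin.zero | true = g0
allFin-elim {suc n} {g} q (Fin.suc i) | true = allFin-elim q i

anyFin-intro : ∀ {n} {g : Fin n → Bool} i → g i ≡ true → anyFin g ≡ true
anyFin-intro {suc n} {g} Fin.zero q = cong (_∨ anyFin (g ∘ Fin.suc)) q
anyFin-intro {suc n} {g} (Fin.suc i) q with g Fin.zero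
... | true = refl
... | false = anyFin-intro i q

count-subset : ∀ {n} (S : Subset n) → count (memb S) ≡ ∣ S ∣
count-subset [] = refl
count-subset (true ∷ S) = cong suc (count-subset S)
count-subset (false ∷ S) = count-subset S

memb⇒∈ : ∀ {n} (S : Subset n) v → memb S v ≡ true → v Subset.∈ S
memb⇒∈ S v q with v ∈ˢ? S
... | yes v∈ = v∈

module Packed {n : ℕ} (G : Graph n) (deg≥1 : ∀ v → 1 ≤ deg G v)
  (S : Subset n) (packing : Is2Packing G S) where

  b : Fin n → Bool
  b = memb S

  inN-self : ∀ v → inN[ G ] v v ≡ true
  inN-self v with v Fin.≟ v
  ... | yes _ = refl
  ... | no v≢v = ⊥-elim (v≢v refl)

  inN-adj : ∀ v w → adj G v w ≡ true → inN[ G ] v w ≡ true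
  inN-adj v w q with does (w Fin.≟ v)
  ... | true = refl
  ... | false = q

  independent : ∀ i j → b i ≡ true → b j ≡ true → adj G i j ≡ false
  independent i j bi bj with i Fin.≟ j
  ... | yes refl = irrefl G i
  ... | no i≢j with adj G i j in q
  ...   | false = refl
  ...   | true = ⊥-elim (packing i j (memb⇒∈ S i bi) (memb⇒∈ S j bj) i≢j j (inN-adj i j q , inN-self j))

  common-neighbour : ∀ i j w → b i ≡ true → b j ≡ true → adj G i w ≡ true → adj G j w ≡ true → i ≡ j
  common-neighbour i j w bi bj iw jw with i Fin.≟ j
  ... | yes q = q
  ... | no i≢j = ⊥-elim (packing i j (memb⇒∈ S i bi) (memb⇒∈ S j bj) i≢j w (inN-adj i w iw , inN-adj j w jw))

  surplus : List (Fin n) → ℕ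
  surplus K = sum (map (λ v → deg G v ∸ 1) K)

  neighbourhoods-unique : ∀ K → Unique K → (∀ {v} → v ∈ K → b v ≡ true) → Unique (concatMap (neighbours G) K)
  neighbourhoods-unique [] _ _ = []
  neighbourhoods-unique (v ∷ K) (v∉K ∷ uK) inS = Uniqueₚ.++⁺ (members-unique (adj G v))
    (neighbourhoods-unique K uK (inS ∘ there)) apart
    where
    apart : ∀ {w} → ¬ (w ∈ neighbours G v × w ∈ concatMap (neighbours G) K)
    apart {w} (w∈v , w∈K) with find (∈-concatMap⁻ (neighbours G) {xs = K} w∈K)
    ... | u , u∈K , w∈u = All.lookup v∉K u∈K (common-neighbour v u w (inS (here refl)) (inS (there u∈K))
      (∈-members⁻ {b = adj G v} w∈v) (∈-members⁻ {b = adj G u} w∈u))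

  length-neighbourhoods : ∀ K → length (concatMap (neighbours G) K) ≡ length K + surplus K
  length-neighbourhoods [] = refl
  length-neighbourhoods (v ∷ K) = trans (length-++ (neighbours G v))
    (trans (cong₂ _+_ (trans (≡-sym (count-members (adj G v))) (≡-sym (m+[n∸m]≡n (deg≥1 v)))) (length-neighbourhoods K))
      (lem (deg G v ∸ 1) (length K) (surplus K)))
    where
    lem : ∀ d k s → suc d + (k + s) ≡ suc k + (d + s)
    lem = solve-∀

  module Cover {K : List (Fin n)} (K↭ : K ↭ members b) where

    inS : ∀ {v} → v ∈ K → b v ≡ true
    inS v∈ = ∈-members⁻ {b = b} (∈-resp-↭ K↭ v∈)

    uncovered : ∃ λ R → (K ++ concatMap (neighbours G) K) ++ R ↭ List.allFin n
    uncovered = complement (K ++ concatMap (neighbours G) K) (List.allFin n)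
      (Uniqueₚ.++⁺ uK (neighbourhoods-unique K uK inS) apart) (λ _ → ∈-allFin _)
      where
      uK : Unique K
      uK = Unique-resp-↭ (↭-sym K↭) (members-unique b)
      apart : ∀ {w} → ¬ (w ∈ K × w ∈ concatMap (neighbours G) K)
      apart {w} (w∈K , w∈) with find (∈-concatMap⁻ (neighbours G) {xs = K} w∈)
      ... | u , u∈K , w∈u = case trans (≡-sym (∈-members⁻ {b = adj G u} w∈u)) (independent u w (inS u∈K) (inS w∈K)) of λ ()

    Rest : List (Fin n)
    Rest = proj₁ uncovered

    cover : K ++ concatMap (neighbours G) K ++ Rest ↭ List.allFin n
    cover = ↭-trans (↭-reflexive (≡-sym (Listₚ.++-assoc K _ Rest))) (proj₂ uncovered)

    size : length K + length K + surplus K + length Rest ≡ n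
    size = trans (trans (cong (_+ length Rest) (trans (+-assoc (length K) _ _)
        (trans (cong (length K +_) (≡-sym (length-neighbourhoods K))) (≡-sym (length-++ K))))) (≡-sym (length-++ (K ++ concatMap (neighbours G) K))))
      (trans (↭-length (proj₂ uncovered)) (Listₚ.length-tabulate id))

    -- The purpose of c. If `Rest` is empty, the closed neighbourhoods cover G, and a degree other
    -- than 1 makes c = 1; so one spare vertex is available in either case.
    slack : ∀ {v} → v ∈ K → deg G v ≢ 1 → 1 ≤ length Rest + cS G S
    slack {v} v∈ d≢1 with Rest in eq
    ... | _ ∷ _ = s≤s z≤n
    ... | [] = ≤-reflexive (≡-sym (cong₂ (λ x y → if x ∧ not y then 1 else 0) (allFin-intro covered) some-large))
      where
      covered : ∀ w → anyFin (λ u → b u ∧ inN[ G ] u w) ≡ true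
      covered w with ∈-++⁻ K (∈-resp-↭ (↭-sym cover) (∈-allFin w))
      ... | inj₁ w∈ = anyFin-intro w (cong₂ _∧_ (inS w∈) (inN-self w))
      ... | inj₂ w∈ with ∈-++⁻ (concatMap (neighbours G) K) w∈
      ...   | inj₂ w∈R = case subst (w ∈_) eq w∈R of λ ()
      ...   | inj₁ w∈N with find (∈-concatMap⁻ (neighbours G) {xs = K} w∈N)
      ...     | u , u∈K , w∈u = anyFin-intro u (cong₂ _∧_ (inS u∈K) (inN-adj u w (∈-members⁻ {b = adj G u} w∈u)))
      some-large : allFin (λ u → not (b u) ∨ (deg G u ℕ.≡ᵇ 1)) ≡ false
      some-large with allFin (λ u → not (b u) ∨ (deg G u ℕ.≡ᵇ 1)) in q
      ... | false = refl
      ... | true = ⊥-elim (d≢1 (≡ᵇ⇒≡ (deg G v) 1 (subst Bool.T (≡-sym (trans (≡-sym (cong (λ x → not x ∨ (deg G v ℕ.≡ᵇ 1)) (inS v∈)))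
          (allFin-elim q v))) _)))

module UpperBound (p : ℕ) (pp : Prime p) {n : ℕ} (G : Graph n) (p∣e : p ∣ e G) (deg≥1 : ∀ v → 1 ≤ deg G v)
  (S : Subset n) (packing : Is2Packing G S) (|S| : ∣ S ∣ ≡ p ∸ 1)
  {N : ℕ} (f : Fin N → Fin N → Fin p) (f-sym : IsColouring N p f) where

  open SwitchFreeCopies p pp G f f-sym p∣e
  open Packed G deg≥1 S packing
  open FullCherries Fin._≟_ Finₚ.any? Fin._≟_ f f-sym using
    (Mono; Coloured; cherriesIn-resp-↭; cherry-or-mono; Monochromatic; module Colour; cherries-or-small-matching)
  open ↭-Solver

  Core : Set
  Core = Fin n × List (Fin N)

  IsGadget : ℕ → Core → Set
  IsGadget σ (v , core) = Gadget σ (deg G v) core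

  |Sl| : length (members b) ≡ p ∸ 1
  |Sl| = trans (≡-sym (count-members b)) (trans (count-subset S) |S|)

  F-distinct : ∀ {x y z w} → f x y ≢ f z w → F x y ≉ F z w
  F-distinct ne q = ne (toℕ-injective (≈⇒≡ (toℕ<n _) (toℕ<n _) q))

  -- Some vertex of a non-monochromatic triangle sees the other two in different colours; it becomes
  -- a in the gadget, and they become the ends.
  cherry-core : ∀ {σ v x y z} → ¬ p ∣ deg G v → σ ≡ 1 ⊎ deg G v ≡ 1 → ¬ Mono x y z →
    ∃ λ core → core ↭ x ∷ y ∷ z ∷ [] × IsGadget σ (v , core)
  cherry-core {σ} {v} {x} {y} {z} p∤d kind good = go (f x y Fin.≟ f x z)
    where
    gadget : ∀ {x y a} → F x a ≉ F y a → σ ≡ 1 ⊎ deg G v ≡ 1 → IsGadget σ (v , x ∷ y ∷ a ∷ [])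
    gadget ne (inj₁ refl) = cherry-gadget p∤d (deg≥1 v) ne
    gadget {x} {y} {a} ne (inj₂ d≡1) = subst (λ d → Gadget σ d (x ∷ y ∷ a ∷ [])) (≡-sym d≡1) (leaf-gadget ne)
    go : Dec (f x y ≡ f x z) → ∃ λ core → core ↭ x ∷ y ∷ z ∷ [] × IsGadget σ (v , core)
    go (no ne) = y ∷ z ∷ x ∷ [] ,
      solve 3 (λ x y z → y ⊕ (z ⊕ (x ⊕ ε)) ⊜ x ⊕ (y ⊕ (z ⊕ ε))) ↭-refl [ x ] [ y ] [ z ] ,
      gadget (F-distinct (λ q → ne (trans (f-sym x y) (trans q (f-sym z x))))) kind
    go (yes q) = x ∷ z ∷ y ∷ [] , ↭-prep x (↭-swap z y ↭-refl) ,
      gadget (F-distinct (λ r → good (q , trans r (f-sym z y)))) kind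

  cherry-cores : ∀ {σ} vs T → All (λ v → ¬ p ∣ deg G v × (σ ≡ 1 ⊎ deg G v ≡ 1)) vs → Coloured T → length vs ≡ length T →
    ∃ λ (cores : List Core) → map proj₁ cores ≡ vs × All (IsGadget σ) cores × concatMap proj₂ cores ↭ verts T
  cherry-cores [] [] _ _ _ = [] , refl , [] , ↭-refl
  cherry-cores (v ∷ vs) ((x , y , z) ∷ T) ((p∤d , kind) ∷ ks) (good ∷ goods) k
    with cherry-core {v = v} p∤d kind good | cherry-cores vs T ks goods (suc-injective k)
  ... | core , q , g | cores , keys , gs , r = (v , core) ∷ cores , cong (v ∷_) keys , g ∷ gs , ↭-++⁺ q r

  switch-cores : ∀ {σ} vs T → All Switch T → length vs ≡ length T →
    ∃ λ (cores : List Core) → map proj₁ cores ≡ vs × All (IsGadget σ) cores × concatMap proj₂ cores ≡ concatMap corners T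
  switch-cores [] [] _ _ = [] , refl , [] , refl
  switch-cores (v ∷ vs) ((x , y , a , b) ∷ T) (s ∷ ss) k with switch-cores vs T ss (suc-injective k)
  ... | cores , keys , gs , r = (v , x ∷ y ∷ a ∷ b ∷ []) ∷ cores , cong (v ∷_) keys , two-ended-gadget (deg≥1 v) s ∷ gs ,
    cong (λ l → x ∷ y ∷ a ∷ b ∷ l) r

  demands : ∀ (cores : List Core) → sum (map demand cores) ≡ surplus (map proj₁ cores)
  demands [] = refl
  demands ((v , _) ∷ cores) = cong (deg G v ∸ 1 +_) (demands cores)

  -- The reserve is |Rest| + c: it holds the images of `Rest` and acts as the spare vertex in the
  -- meantime.
  finish : ∀ {σ} (cores : List Core) pool → (keys : map proj₁ cores ↭ members b) → All (IsGadget σ) cores →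
    Unique (concatMap proj₂ cores ++ pool) → σ ≤ length (Cover.Rest keys) + cS G S →
    surplus (map proj₁ cores) + (length (Cover.Rest keys) + cS G S) ≤ length pool → ZeroCopy
  finish cores pool keys gs uX σ≤ room = gadgets⇒zero-copy b independent cores (Cover.Rest keys) pool keys
    (trans (≡-sym (length-map proj₁ cores)) (trans (↭-length keys) |Sl|)) (Cover.cover keys) gs uX σ≤ (m≤m+n _ _)
    (subst (λ s → s + (length (Cover.Rest keys) + cS G S) ≤ length pool) (≡-sym (demands cores)) room)

  size-of : ∀ {K} (keys : K ↭ members b) → (p ∸ 1) + (p ∸ 1) + surplus K + length (Cover.Rest keys) ≡ n
  size-of {K} keys = subst (λ k → k + k + surplus K + length (Cover.Rest keys) ≡ n) (trans (↭-length keys) |Sl|) (Cover.size keys)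

  V : List (Fin N)
  V = List.allFin N

  |V| : length V ≡ N
  |V| = Listₚ.length-tabulate id

  -- All edges of G land on colour κ, so the weight is κ e(G).
  matching-poor⇒zero-copy : ∀ κ → ¬ Colour.Matching κ (p ∸ 1) V → n + (p ∸ 1) ≤ N → ZeroCopy
  matching-poor⇒zero-copy κ none big = build (pack k (members b) R {V} ≤-refl (Uniqueₚ.allFin⁺ N) (members-unique b)
      (λ {u} {v} u∈ v∈ uv → case trans (≡-sym uv) (independent u v (∈-members⁻ {b = b} u∈) (∈-members⁻ {b = b} v∈)) of λ ())
      (All.tabulate (λ {r} _ u v u∈ v∈ ru rv → common-neighbour u v r (∈-members⁻ {b = b} u∈) (∈-members⁻ {b = b} v∈)
        (trans (sym G u r) ru) (trans (sym G v r) rv)))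
      (≤-trans (≤-reflexive count-all) (≤-trans big (≤-reflexive (≡-sym |V|))))
      (subst (λ s → ¬ Colour.Matching κ s V) (≡-sym |Sl|) none))
    where
    open Packing Fin._≟_ Finₚ.any? (Colour.H κ) (Colour.H? κ) (Colour.H-sym κ)
      (λ u v → adj G u v ≡ true) (λ u v → adj G u v Bool.≟ true)
      (λ {u} {v} q → trans (sym G v u) q) (λ {u} q → case trans (≡-sym q) (irrefl G u) of λ ())
    others : ∃ λ R → members b ++ R ↭ List.allFin n
    others = complement (members b) (List.allFin n) (members-unique b) (λ _ → ∈-allFin _)
    R : List (Fin n)
    R = proj₁ others
    k : ℕ
    k = length (members b) + length (members b) + length R
    count-all : k ≡ n + (p ∸ 1)
    count-all = trans (+-assoc (length (members b)) _ _) (trans (+-comm (length (members b)) _)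
      (cong₂ _+_ (trans (≡-sym (length-++ (members b))) (trans (↭-length (proj₂ others)) (Listₚ.length-tabulate id))) |Sl|))
    build : Placement (members b ++ R) V → ZeroCopy
    build (P , Q , keys , values , ok) with embedding P
        (λ u → ∈-resp-↭ (↭-sym (↭-trans keys (proj₂ others))) (∈-allFin u))
        (Unique-resp-↭ (↭-sym (↭-trans keys (proj₂ others))) (Uniqueₚ.allFin⁺ n))
        (Unique-++⁻ˡ _ (Unique-resp-↭ (↭-sym values) (Uniqueₚ.allFin⁺ N)))
    ... | φ , inj , ext = φ , inj , ≈-trans (≡⇒≈ (sumPairs-cong λ i j → edge i j (adj G i j) refl)) (constant-weight≈0 (toℕ κ))
      where
      placed : ∀ u → (u , φ u) ∈ P
      placed u with ∈-map⁻ proj₁ (∈-resp-↭ (↭-sym (↭-trans keys (proj₂ others))) (∈-allFin u))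
      ... | (_ , x) , q , refl = subst (λ z → (u , z) ∈ P) (≡-sym (All.lookup ext q)) q
      edge : ∀ i j a → adj G i j ≡ a → (if a then F (φ i) (φ j) else 0) ≡ (if a then toℕ κ else 0)
      edge i j true q = cong toℕ (Colour.¬H⇒≡ κ (ok (placed i) (placed j) q))
      edge i j false q = refl

  -- The 3(p - 1) triangle vertices leave a pool of exactly Σ (deg v - 1) + |Rest| + c vertices. If
  -- all degrees in S are 1, leaf gadgets with σ = 0 do; otherwise σ = 1 is covered by `slack`.
  no-zero-degree⇒zero-copy : All (λ v → ¬ p ∣ deg G v) (members b) → N ≡ n + (p ∸ 1) + cS G S → ZeroCopy
  no-zero-degree⇒zero-copy p∤d N≡ with cherries-or-small-matching (p ∸ 1) {V} (Uniqueₚ.allFin⁺ N) enough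
    where
    enough : (p ∸ 1) * 3 ≤ length V
    enough = ≤-trans (≤-trans (≤-reflexive (lem₁ (p ∸ 1))) (m≤m+n _ (surplus (members b) + length (Cover.Rest ↭-refl) + cS G S)))
      (≤-reflexive (≡-sym (trans |V| (trans N≡ (trans (cong (λ m → m + (p ∸ 1) + cS G S) (≡-sym (size-of ↭-refl)))
        (lem₂ (p ∸ 1) (surplus (members b)) (length (Cover.Rest ↭-refl)) (cS G S)))))))
      where
      lem₁ : ∀ t → t * 3 ≡ t + t + t
      lem₁ = solve-∀
      lem₂ : ∀ t d r c → t + t + d + r + t + c ≡ t + t + t + (d + r + c)
      lem₂ = solve-∀
  ... | inj₂ (κ , none) = matching-poor⇒zero-copy κ none (≤-trans (m≤m+n _ (cS G S)) (≤-reflexive (≡-sym N≡)))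
  ... | inj₁ (T , pool , cT , |T| , pT) = choose (all? (λ v → deg G v ℕ.≟ 1) (members b))
    where
    with-slack : ∀ σ → All (λ v → σ ≡ 1 ⊎ deg G v ≡ 1) (members b) →
      (∀ {K} (keys : K ↭ members b) → σ ≤ length (Cover.Rest keys) + cS G S) → ZeroCopy
    with-slack σ kinds enough with cherry-cores (members b) T (All.tabulate (λ v∈ → All.lookup p∤d v∈ , All.lookup kinds v∈)) cT
        (trans |Sl| (≡-sym |T|))
    ... | cores , keys , gs , q = finish cores pool (↭-reflexive keys) gs
      (Unique-resp-↭ (↭-sym (↭-trans (↭-++⁺ʳ pool q) pT)) (Uniqueₚ.allFin⁺ N)) (enough (↭-reflexive keys))
      (≤-reflexive (+-cancelˡ-≡ ((p ∸ 1) * 3) _ _ (≡-sym (trans pool-size (trans N≡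
        (trans (cong (λ m → m + (p ∸ 1) + cS G S) (≡-sym (size-of (↭-reflexive keys))))
          (lem (p ∸ 1) (surplus (map proj₁ cores)) (length (Cover.Rest (↭-reflexive keys))) (cS G S))))))))
      where
      pool-size : (p ∸ 1) * 3 + length pool ≡ N
      pool-size = trans (cong (λ t → t * 3 + length pool) (≡-sym |T|)) (trans (cong (_+ length pool) (≡-sym (length-verts T)))
        (trans (≡-sym (length-++ (verts T))) (trans (↭-length pT) |V|)))
      lem : ∀ t d r c → t + t + d + r + t + c ≡ t * 3 + (d + (r + c))
      lem = solve-∀
    choose : Dec (All (λ v → deg G v ≡ 1) (members b)) → ZeroCopy
    choose (yes ones) = with-slack 0 (All.map inj₂ ones) (λ _ → z≤n)
    choose (no ¬ones) with find (Allₚ.¬All⇒Any¬ (λ v → deg G v ℕ.≟ 1) (members b) ¬ones)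
    ... | v , v∈ , d≢1 = with-slack 1 (All.tabulate (λ _ → inj₁ refl)) (λ keys → Cover.slack keys (∈-resp-↭ (↭-sym keys) v∈) d≢1)

-- Packings containing a vertex of degree divisible by p

members-split : ∀ {n} (b c : Fin n → Bool) →
  members (λ v → b v ∧ c v) ++ members (λ v → b v ∧ not (c v)) ↭ members b
members-split {n} b c = go (List.allFin n)
  where
  sel : (Fin n → Bool) → List (Fin n) → List (Fin n)
  sel d = filter (λ v → d v Bool.≟ true)
  go : ∀ L → sel (λ v → b v ∧ c v) L ++ sel (λ v → b v ∧ not (c v)) L ↭ sel b L
  go [] = ↭-refl
  go (v ∷ L) with b v | c v
  ... | true | true = ↭-prep v (go L)
  ... | true | false = ↭-trans (shift v (sel (λ v → b v ∧ c v) L) _) (↭-prep v (go L))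
  ... | false | _ = go L

∧-true : ∀ {a b} → a ∧ b ≡ true → a ≡ true × b ≡ true
∧-true {true} q = refl , q

module ZeroDegrees (p : ℕ) (pp : Prime p) {n : ℕ} (G : Graph n) (p∣e : p ∣ e G) (deg≥1 : ∀ v → 1 ≤ deg G v)
  (S : Subset n) (packing : Is2Packing G S) (|S| : ∣ S ∣ ≡ p ∸ 1)
  {N : ℕ} (f : Fin N → Fin N → Fin p) (f-sym : IsColouring N p f) where

  open SwitchFreeCopies p pp G f f-sym p∣e
  open Packed G deg≥1 S packing
  open UpperBound p pp G p∣e deg≥1 S packing |S| f f-sym
  open FullCherries Fin._≟_ Finₚ.any? Fin._≟_ f f-sym using (Mono; Coloured; cherry-or-mono; Monochromatic)
  open ↭-Solver

  p≡ : p ≡ suc (p ∸ 1)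
  p≡ = ≡-sym (m+[n∸m]≡n (ℕ.>-nonZero⁻¹ p))

  1≤p∸1 : 1 ≤ p ∸ 1
  1≤p∸1 = s≤s⁻¹ (≤-trans (ℕ.nonTrivial⇒n>1 p {{prime⇒nonTrivial pp}}) (≤-reflexive p≡))

  zeros nonzeros : List (Fin n)
  zeros = members (λ v → b v ∧ does (p ∣? deg G v))
  nonzeros = members (λ v → b v ∧ not (does (p ∣? deg G v)))

  parts : zeros ++ nonzeros ↭ members b
  parts = members-split b (λ v → does (p ∣? deg G v))

  |parts| : length zeros + length nonzeros ≡ p ∸ 1
  |parts| = trans (≡-sym (length-++ zeros)) (trans (↭-length parts) |Sl|)

  nonzero-degrees : All (λ v → ¬ p ∣ deg G v) nonzeros
  nonzero-degrees = All.tabulate λ {v} v∈ → p∤deg-sound v (proj₂ (∧-true {b v} (∈-members⁻ {b = λ v → b v ∧ not (does (p ∣? deg G v))} v∈)))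

  zero-degree-large : ∀ {v} → v ∈ zeros → deg G v ≢ 1
  zero-degree-large {v} v∈ d≡1 = <⇒≱ (ℕ.nonTrivial⇒n>1 p {{prime⇒nonTrivial pp}})
    (∣⇒≤ (subst (p ∣_) d≡1 (divides-of v (proj₂ (∧-true {b v} (∈-members⁻ {b = λ v → b v ∧ does (p ∣? deg G v)} v∈))))))
    where
    divides-of : ∀ v → does (p ∣? deg G v) ≡ true → p ∣ deg G v
    divides-of v q with p ∣? deg G v
    ... | yes d = d

  1≤n : 1 ≤ n
  1≤n = ≤-trans 1≤p∸1 (≤-trans (≤-trans (≤-trans (m≤m+n _ (p ∸ 1)) (m≤m+n _ (surplus (members b))))
    (m≤m+n _ (length (Cover.Rest ↭-refl)))) (≤-reflexive (size-of ↭-refl)))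

  MonoSet : List (Fin N) → Set
  MonoSet U = 2 ≤ length U → ∃ λ κ → Monochromatic κ U

  triple : Fin N × Fin N × Fin N → List (Fin N)
  triple (x , y , z) = x ∷ y ∷ z ∷ []

  concatMap-triple : ∀ T → concatMap triple T ≡ verts T
  concatMap-triple [] = refl
  concatMap-triple ((x , y , z) ∷ T) = cong (λ l → x ∷ y ∷ z ∷ l) (concatMap-triple T)

  find-cherry : ∀ W → Unique W → (∃₂ λ t R → (λ (x , y , z) → ¬ Mono x y z) t × triple t ++ R ↭ W) ⊎ MonoSet W
  find-cherry W uW with 2 ℕ.≤? length W
  ... | no small = inj₂ (λ big → ⊥-elim (small big))
  ... | yes big with cherry-or-mono uW big
  ...   | inj₁ (x , y , z , R , good , q) = inj₁ ((x , y , z) , R , good , q)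
  ...   | inj₂ mono = inj₂ (λ _ → mono)

  mono⇒zero-copy : ∀ {U} → Unique U → MonoSet U → n + (p ∸ 1) ≤ length U → ZeroCopy
  mono⇒zero-copy uU mono big with mono (≤-trans (+-mono-≤ 1≤n 1≤p∸1) big)
  ... | κ , constant = additive⇒zero-copy (λ _ → 0) (toℕ κ) uU (λ x∈ y∈ x≢y → ≡⇒≈ (cong toℕ (constant x∈ y∈ x≢y))) big

  -- This is N = n + 5p - 9 + s + c, with 4 moved to the left to avoid truncated subtraction.
  module _ {c s : ℕ} (|N| : N + 4 ≡ n + 5 * (p ∸ 1) + s + c) (|zeros| : length zeros ≡ s) (c≡ : c ≡ cS G S) where

    t : ℕ
    t = p ∸ 1

    -- At most 4(s - 1) vertices have been removed; since s ≤ p - 1, at least n + 2(p - 1) + c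
    -- remain.
    few-switches : ∀ {u k} → k < s → N ≤ u + k * 4 → n + p ≤ u
    few-switches {u} {k} k<s le = ≤-trans (≤-trans (≤-reflexive (cong (n +_) p≡)) (≤-trans (+-monoʳ-≤ n (+-monoˡ-≤ t 1≤p∸1)) (m≤m+n _ c)))
      (+-cancelʳ-≤ (s + t * 3) _ _ (≤-trans (≤-reflexive (≡-sym (trans |N| (lem₁ n t s c))))
        (≤-trans (+-monoˡ-≤ 4 le) (≤-trans (≤-reflexive (lem₂ u k)) (≤-trans (+-monoʳ-≤ u (*-monoˡ-≤ 4 k<s))
          (≤-trans (≤-reflexive (cong (u +_) (lem₃ s))) (+-monoʳ-≤ u (+-monoʳ-≤ s (*-monoˡ-≤ 3 s≤t)))))))))
      where
      s≤t : s ≤ t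
      s≤t = ≤-trans (≤-reflexive (≡-sym |zeros|)) (≤-trans (m≤m+n _ _) (≤-reflexive |parts|))
      lem₁ : ∀ n t s c → n + 5 * t + s + c ≡ (n + (t + t) + c) + (s + t * 3)
      lem₁ = solve-∀
      lem₂ : ∀ u k → u + k * 4 + 4 ≡ u + (1 + k) * 4
      lem₂ = solve-∀
      lem₃ : ∀ s → s * 4 ≡ s + s * 3
      lem₃ = solve-∀

    -- After s four-cycles and fewer than |nonzeros| triangles, at least n + 2(p - 1) + c - 1
    -- vertices remain.
    few-cherries : ∀ {u k r} → s * 4 + r ≡ N → k < length nonzeros → r ≤ u + k * 3 → n + (p ∸ 1) ≤ u
    few-cherries {u} {k} {r} |R| k<z le = +-cancelʳ-≤ (s + t * 3 + 1) _ _ (≤-trans (≤-reflexive (lem₀ n t s))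
      (≤-trans (+-monoʳ-≤ (n + s + t * 4) 1≤p∸1) (≤-trans (m≤m+n _ c) (≤-trans (≤-reflexive (≡-sym (trans |N| (lem₁ n t s c))))
        (≤-trans (≤-reflexive (cong (_+ 4) (≡-sym |R|))) (≤-trans (+-monoˡ-≤ 4 (+-monoʳ-≤ (s * 4) le))
          (≤-trans (≤-reflexive (lem₂ s u k)) (≤-trans (+-monoʳ-≤ (s * 4 + u + 1) (*-monoˡ-≤ 3 k<z))
            (≤-reflexive (trans (lem₃ s u (length nonzeros)) (cong (λ m → u + (s + m * 3 + 1)) |st|)))))))))))
      where
      |st| : s + length nonzeros ≡ t
      |st| = trans (cong (_+ length nonzeros) (≡-sym |zeros|)) |parts|
      lem₀ : ∀ n t s → n + t + (s + t * 3 + 1) ≡ n + s + t * 4 + 1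
      lem₀ = solve-∀
      lem₁ : ∀ n t s c → n + 5 * t + s + c ≡ n + s + t * 4 + t + c
      lem₁ = solve-∀
      lem₂ : ∀ s u k → s * 4 + (u + k * 3) + 4 ≡ s * 4 + u + 1 + (1 + k) * 3
      lem₂ = solve-∀
      lem₃ : ∀ s u z → s * 4 + u + 1 + z * 3 ≡ u + (s + (s + z) * 3 + 1)
      lem₃ = solve-∀

    -- The pool has n + 2(p - 1) + c - 4 vertices, against a need of n - 2(p - 1) + c; the two agree
    -- for p = 2.
    room : ∀ {d r q} → s * 4 + (length nonzeros * 3 + q) ≡ N → t + t + d + r ≡ n → d + (r + c) ≤ q
    room {d} {r} {q} |pool| |G| = +-cancelʳ-≤ (s + t * 3 + 4) _ _ (≤-trans (+-monoʳ-≤ (d + (r + c)) (+-monoʳ-≤ (s + t * 3) (*-monoˡ-≤ 4 1≤p∸1)))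
      (≤-reflexive (≡-sym (trans (lem₁ q s t (length nonzeros) |st|) (trans (cong (_+ 4) |pool|) (trans |N|
        (trans (cong (λ m → m + 5 * t + s + c) (≡-sym |G|)) (lem₂ t d r s c))))))))
      where
      |st| : s + length nonzeros ≡ t
      |st| = trans (cong (_+ length nonzeros) (≡-sym |zeros|)) |parts|
      lem₁ : ∀ q s t z → s + z ≡ t → q + (s + t * 3 + 4) ≡ s * 4 + (z * 3 + q) + 4
      lem₁ q s _ z refl = go q s z
        where
        go : ∀ q s z → q + (s + (s + z) * 3 + 4) ≡ s * 4 + (z * 3 + q) + 4
        go = solve-∀
      lem₂ : ∀ t d r s c → t + t + d + r + 5 * t + s + c ≡ d + (r + c) + (s + t * 3 + t * 4)
      lem₂ = solve-∀

    length-corners : ∀ (T : List (Fin N × Fin N × Fin N × Fin N)) → length (concatMap corners T) ≡ length T * 4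
    length-corners [] = refl
    length-corners (_ ∷ T) = cong (4 +_) (length-corners T)

    -- Four-cycles are collected for `zeros`, then triangles for `nonzeros`. Getting stuck leaves a
    -- large set that is switch-free or monochromatic, and both are additive colourings. A vertex of
    -- `zeros` has degree above 1, so `slack` provides the spare.
    zero-degree⇒zero-copy : 1 ≤ s → ZeroCopy
    zero-degree⇒zero-copy 1≤s with greedy-disjoint corners Switch SwitchFree 4 (λ _ → refl) find-switch s V (Uniqueₚ.allFin⁺ N)
    ... | inj₂ (U , k , k<s , uU , free , le) = switch-free⇒zero-copy uU free 1≤n (few-switches k<s (subst (_≤ length U + k * 4) |V| le))
    ... | inj₁ (T₄ , R , switches , |T₄| , p₄) = continue (greedy-disjoint triple (λ (x , y , z) → ¬ Mono x y z) MonoSet 3 (λ _ → refl) find-cherry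
        (length nonzeros) R (Unique-++⁻ʳ (concatMap corners T₄) (Unique-resp-↭ (↭-sym p₄) (Uniqueₚ.allFin⁺ N))))
      where
      |R| : s * 4 + length R ≡ N
      |R| = trans (cong (λ m → m * 4 + length R) (≡-sym |T₄|)) (trans (cong (_+ length R) (≡-sym (length-corners T₄)))
        (trans (≡-sym (length-++ (concatMap corners T₄))) (trans (↭-length p₄) |V|)))
      continue : (∃₂ λ T pool → Coloured T × length T ≡ length nonzeros × concatMap triple T ++ pool ↭ R) ⊎
        (∃₂ λ U k → k < length nonzeros × Unique U × MonoSet U × length R ≤ length U + k * 3) → ZeroCopy
      continue (inj₂ (U , k , k<z , uU , mono , le)) = mono⇒zero-copy uU mono (few-cherries |R| k<z le)
      continue (inj₁ (T₃ , pool , cT , |T₃| , p₃))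
        with switch-cores zeros T₄ switches (trans |zeros| (≡-sym |T₄|))
           | cherry-cores nonzeros T₃ (All.map (λ p∤d → p∤d , inj₁ refl) nonzero-degrees) cT (≡-sym |T₃|)
      ... | cores₄ , keys₄ , gs₄ , q₄ | cores₃ , keys₃ , gs₃ , q₃ =
        finish (cores₄ ++ cores₃) pool keys (Allₚ.++⁺ gs₄ gs₃)
          (Unique-resp-↭ (↭-sym all-vertices) (Uniqueₚ.allFin⁺ N)) enough
          (subst (λ c → surplus (map proj₁ (cores₄ ++ cores₃)) + (length (Cover.Rest keys) + c) ≤ length pool) c≡
            (room |pool| (size-of keys)))
        where
        keys≡ : map proj₁ (cores₄ ++ cores₃) ≡ zeros ++ nonzeros
        keys≡ = trans (map-++ proj₁ cores₄ cores₃) (cong₂ _++_ keys₄ keys₃)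
        keys : map proj₁ (cores₄ ++ cores₃) ↭ members b
        keys = ↭-trans (↭-reflexive keys≡) parts
        enough : 1 ≤ length (Cover.Rest keys) + cS G S
        enough = let v , v∈ = nonempty⇒∈ (≤-trans 1≤s (≤-reflexive (≡-sym |zeros|))) in
          Cover.slack keys (subst (v ∈_) (≡-sym keys≡) (∈-++⁺ˡ v∈)) (zero-degree-large v∈)
        all-vertices : concatMap proj₂ (cores₄ ++ cores₃) ++ pool ↭ V
        all-vertices = ↭-trans (↭-reflexive (trans (cong (_++ pool) (Listₚ.concatMap-++ proj₂ cores₄ cores₃))
            (Listₚ.++-assoc (concatMap proj₂ cores₄) _ pool)))
          (↭-trans (↭-++⁺ (↭-reflexive q₄) (↭-++⁺ʳ pool (↭-trans q₃ (↭-reflexive (≡-sym (concatMap-triple T₃))))))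
            (↭-trans (↭-++⁺ˡ (concatMap corners T₄) p₃) p₄))
        |pool| : s * 4 + (length nonzeros * 3 + length pool) ≡ N
        |pool| = trans (cong (s * 4 +_) (trans (cong (λ m → m * 3 + length pool) (≡-sym |T₃|))
          (trans (cong (_+ length pool) (trans (≡-sym (length-verts T₃)) (cong length (≡-sym (concatMap-triple T₃)))))
            (trans (≡-sym (length-++ (concatMap triple T₃))) (↭-length p₃))))) |R|

-- Decidability and the lower bound

search-Vec : {A : Set} → Searchable A → ∀ m → Searchable (Vec A m)
search-Vec sA zero P? = map′ (λ q → [] , q) (λ { ([] , q) → q }) (P? [])
search-Vec sA (suc m) P? = map′ (λ (a , v , q) → a ∷ v , q) (λ { (a ∷ v , q) → a , v , q })
  (sA (λ a → search-Vec sA m (λ v → P? (a ∷ v))))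

least : {P : ℕ → Set} → (∀ k → Dec (P k)) → ∀ m → P m → ∃ λ r → P r × (∀ k → P k → r ≤ k)
least {P} P? m Pm = climb m 0 (λ _ ()) (subst P (≡-sym (+-identityʳ m)) Pm)
  where
  climb : ∀ j k → (∀ i → i < k → ¬ P i) → P (j + k) → ∃ λ r → P r × (∀ i → P i → r ≤ i)
  climb zero k none Pk = k , Pk , λ i Pi → ≮⇒≥ (λ i<k → none i i<k Pi)
  climb (suc j) k none Pj with P? k
  ... | yes Pk = k , Pk , λ i Pi → ≮⇒≥ (λ i<k → none i i<k Pi)
  ... | no ¬Pk = climb j (suc k) below (subst P (≡-sym (+-suc j k)) Pj)
    where
    below : ∀ i → i < suc k → ¬ P i
    below i i≤k Pi with m≤n⇒m<n∨m≡n (s≤s⁻¹ i≤k)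
    ... | inj₁ i<k = none i i<k Pi
    ... | inj₂ refl = ¬Pk Pi

module _ {n : ℕ} (G : Graph n) (p : ℕ) where

  copyWeight-cong : ∀ {N} {f g : Fin N → Fin N → Fin p} {φ ψ : Fin n → Fin N} →
    (∀ x y → f x y ≡ g x y) → (∀ i → φ i ≡ ψ i) → copyWeight G f φ ≡ copyWeight G g ψ
  copyWeight-cong {f = f} {g} {φ} {ψ} fg φψ = sumPairs-cong λ i j → cong (if adj G i j then_else 0)
    (cong toℕ (trans (fg (φ i) (φ j)) (cong₂ g (φψ i) (φψ j))))

  copy? : ∀ {N} (f : Fin N → Fin N → Fin p) →
    Dec (∃ λ (φ : Fin n → Fin N) → Injective _≡_ _≡_ φ × p ∣ copyWeight G f φ)
  copy? {N} f = map′ (λ (v , inj , d) → lookupᵛ v , (λ {i} {j} → inj i j) , d)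
    (λ (φ , inj , d) → tabulate φ ,
      (λ i j q → inj (trans (≡-sym (lookup∘tabulate φ i)) (trans q (lookup∘tabulate φ j)))) ,
      subst (p ∣_) (copyWeight-cong {f = f} (λ _ _ → refl) (≡-sym ∘ lookup∘tabulate φ)) d)
    (search-Vec Finₚ.any? n
      (λ v → (Finₚ.all? λ i → Finₚ.all? λ j → (lookupᵛ v i Fin.≟ lookupᵛ v j) →-dec (i Fin.≟ j)) ×-dec (p ∣? copyWeight G f (lookupᵛ v))))

  -- R is found by searching for a least number. Colourings are enumerated as tables, and the weight
  -- depends on a colouring only through its values.
  zeroSumProperty? : ∀ N → Dec (ZeroSumProperty G p N)
  zeroSumProperty? N = map′ property refute (¬? (search-Vec (search-Vec Finₚ.any? N) N bad?))
    where
    table : Vec (Vec (Fin p) N) N → Fin N → Fin N → Fin p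
    table v x y = lookupᵛ (lookupᵛ v x) y
    bad? : ∀ v → Dec (IsColouring N p (table v) × ¬ (∃ λ φ → Injective _≡_ _≡_ φ × p ∣ copyWeight G (table v) φ))
    bad? v = (Finₚ.all? λ x → Finₚ.all? λ y → table v x y Fin.≟ table v y x) ×-dec ¬? (copy? (table v))
    property : _ → ZeroSumProperty G p N
    property none f f-sym with copy? f
    ... | yes c = c
    ... | no ¬c = ⊥-elim (none (v , (λ x y → trans (same x y) (trans (f-sym x y) (≡-sym (same y x)))) ,
            λ (φ , inj , d) → ¬c (φ , inj , subst (p ∣_) (copyWeight-cong same (λ _ → refl)) d)))
      where
      v : Vec (Vec (Fin p) N) N
      v = tabulate (λ x → tabulate (f x))
      same : ∀ x y → table v x y ≡ f x y
      same x y = trans (cong (λ r → lookupᵛ r y) (lookup∘tabulate (λ x → tabulate (f x)) x)) (lookup∘tabulate (f x) y)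
    refute : ZeroSumProperty G p N → _
    refute all (v , sym-v , none) = none (all (table v) sym-v)

-- The extremal colouring

module LowerBound (p : ℕ) (pp : Prime p) {n : ℕ} (G : Graph n) (p∣e : p ∣ e G) (v₀ : Fin n) where

  open Residues p pp

  high : ℕ → ∀ {N} → Fin N → Bool
  high m x = not (toℕ x ℕ.<ᵇ m)

  count-high : ∀ m N → count (high m {N}) ≡ N ∸ m
  count-high zero zero = refl
  count-high zero (suc N) = cong suc (count-high zero N)
  count-high (suc m) zero = refl
  count-high (suc m) (suc N) = count-high m N

  -- With n − 1 vertices of height 0 and at most p − 1 of height 1, the heights along a copy
  -- sum to a number strictly between 0 and p.
  height : ∀ {N} → Fin N → ℕ
  height x = if high (n ∸ 1) x then 1 else 0

  colouring : ∀ {N} → Fin N → Fin N → Fin p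
  colouring x y = fromℕ< (m%n<n (height x + height y) p)

  colouring-sym : ∀ {N} → IsColouring N p colouring
  colouring-sym x y = cong (λ k → fromℕ< (m%n<n k p)) (+-comm (height x) (height y))

  -- As all degrees agree modulo p, the weight is congruent to J deg(v₀), where J counts the
  -- vertices of the copy at height 1. Weight 0 forces p ∣ J, whereas 0 < J < p.
  lower-bound : (∀ v → deg G v ≈ deg G v₀) → ¬ p ∣ deg G v₀ → ∀ N → ZeroSumProperty G p N → n + (p ∸ 1) ≤ N
  lower-bound regular p∤d N property with n + (p ∸ 1) ℕ.≤? N
  ... | yes q = q
  ... | no small with property colouring colouring-sym
  ... | φ , inj , d = ⊥-elim (<⇒≱ upper (∣⇒≤ {{ℕ.>-nonZero positive}} p∣J))
    where
    open AdditiveCopies p pp G (colouring {N}) colouring-sym p∣e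
      using (sumPairs-≈; sumFin-≈; F)
    n≡ : n ≡ suc (n ∸ 1)
    n≡ = ≡-sym (m+[n∸m]≡n (≤-trans (s≤s z≤n) (toℕ<n v₀)))
    J : ℕ
    J = count (high (n ∸ 1) ∘ φ)
    p∣J : p ∣ J
    p∣J with euclidsLemma J (deg G v₀) pp (≈0⇒∣ (≈-trans (≈-sym total) (∣⇒≈0 d)))
      where
      open import Relation.Binary.Reasoning.Setoid ≈-setoid
      edge : ∀ a x y → (if a then F x y else 0) ≈ (if a then height x + height y else 0)
      edge true x y = mod≡ (trans (cong (_% p) (Finₚ.toℕ-fromℕ< (m%n<n (height x + height y) p))) (m%n%n≡m%n (height x + height y) p))
      edge false x y = ≈-refl
      total : copyWeight G colouring φ ≈ J * deg G v₀
      total = begin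
        copyWeight G colouring φ ≈⟨ sumPairs-≈ (λ i j → edge (adj G i j) (φ i) (φ j)) ⟩
        sumPairs (λ i j → if adj G i j then height (φ i) + height (φ j) else 0) ≡⟨ handshake G (height ∘ φ) ⟩
        sumFin (λ i → deg G i * height (φ i)) ≈⟨ sumFin-≈ (λ i → ≈-trans (≡⇒≈ (*-comm (deg G i) _)) (*-congˡ (height (φ i)) (regular i))) ⟩
        sumFin (λ i → height (φ i) * deg G v₀) ≡⟨ sumFin-*ʳ (height ∘ φ) (deg G v₀) ⟩
        J * deg G v₀ ∎
    ... | inj₁ q = q
    ... | inj₂ q = ⊥-elim (p∤d q)
    J≡ : J ≡ length (members (high (n ∸ 1) ∘ φ))
    J≡ = count-members (high (n ∸ 1) ∘ φ)
    upper : J < p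
    upper = ≤-trans (s≤s (≤-trans (≤-reflexive (trans J≡ (≡-sym (length-map φ (members (high (n ∸ 1) ∘ φ)))))) (≤-trans
        (unique-⊆-length (Uniqueₚ.map⁺ inj (members-unique (high (n ∸ 1) ∘ φ))) (λ {x} x∈ → high-image x∈))
        (≤-trans (≤-reflexive (trans (≡-sym (count-members (high (n ∸ 1) {N}))) (count-high (n ∸ 1) N))) room))))
      (≤-reflexive (m+[n∸m]≡n (ℕ.>-nonZero⁻¹ p)))
      where
      high-image : ∀ {x} → x ∈ map φ (members (high (n ∸ 1) ∘ φ)) → x ∈ members (high (n ∸ 1))
      high-image x∈ with ∈-map⁻ φ x∈
      ... | i , i∈ , refl = ∈-members⁺ {b = high (n ∸ 1)} (∈-members⁻ {b = high (n ∸ 1) ∘ φ} i∈)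
      room : N ∸ (n ∸ 1) ≤ p ∸ 1
      room = ≤-trans (∸-monoˡ-≤ (n ∸ 1) (s≤s⁻¹ (≤-trans (≰⇒> small) (≤-reflexive (cong (λ m → m + (p ∸ 1)) n≡)))))
        (≤-reflexive (m+n∸m≡n (n ∸ 1) (p ∸ 1)))
    positive : 1 ≤ J
    positive with 1 ℕ.≤? J
    ... | yes q = q
    ... | no none = ⊥-elim (<⇒≱ (≤-reflexive (≡-sym n≡)) (≤-trans (≤-reflexive (≡-sym (trans (length-map (toℕ ∘ φ) (List.allFin n)) (Listₚ.length-tabulate id))))
      (≤-trans (unique-⊆-length (Uniqueₚ.map⁺ (λ q → inj (toℕ-injective q)) (Uniqueₚ.allFin⁺ n)) (λ {x} x∈ → low x∈))
        (≤-reflexive (Listₚ.length-upTo (n ∸ 1))))))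
      where
      low : ∀ {k} → k ∈ map (toℕ ∘ φ) (List.allFin n) → k ∈ List.upTo (n ∸ 1)
      low k∈ with ∈-map⁻ (toℕ ∘ φ) k∈
      ... | i , _ , refl with high (n ∸ 1) (φ i) in q
      ...   | true = ⊥-elim (none (≤-trans (∈⇒nonempty (∈-members⁺ {b = high (n ∸ 1) ∘ φ} q)) (≤-reflexive (≡-sym J≡))))
      ...   | false = ∈-upTo⁺ (<ᵇ⇒< _ _ (subst Bool.T (≡-sym (not-injective q)) _))

-- Here p = t + 1 is at least 2, so 5p ≥ 10 and subtracting 9 does not truncate.
upper-bound-size : ∀ t n s c → 1 ≤ t → (n + 5 * suc t ∸ 9) + s + c + 4 ≡ n + 5 * t + s + c
upper-bound-size (suc u) n s c _ = trans (cong (λ m → (m ∸ 9) + s + c + 4) (expand n u))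
  (trans (cong (λ m → m + s + c + 4) (m+n∸m≡n 9 (n + 1 + 5 * u))) (collect n u s c))
  where
  expand : ∀ n u → n + 5 * suc (suc u) ≡ 9 + (n + 1 + 5 * u)
  expand = solve-∀
  collect : ∀ n u s c → n + 1 + 5 * u + s + c + 4 ≡ n + 5 * suc u + s + c
  collect = solve-∀

-- Integer congruences and the final assembly

open import Data.Integer using (ℤ; +_; _-_)
open import Data.Integer.Divisibility using () renaming (_∣_ to _∣ℤ_)
import Data.Integer as ℤ
import Data.Integer.Properties as ℤₚ
import Data.Integer.Divisibility.Signed as Signed
import Data.Integer.Tactic.RingSolver as ℤSolver

module _ (p : ℕ) (pp : Prime p) where

  open Residues p pp

  private
    ordered : ∀ {a b} → p ∣ ℤ.∣ + b - + a ∣ → a ≤ b → b ≈ a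
    ordered {a} {b} d a≤b = ≈-trans (≡⇒≈ (≡-sym (m+[n∸m]≡n a≤b))) (≈-trans (+-cong (≈-refl {a}) (∣⇒≈0 (subst (p ∣_)
      (cong ℤ.∣_∣ (trans (ℤₚ.m-n≡m⊖n b a) (ℤₚ.⊖-≥ a≤b))) d))) (≡⇒≈ (+-identityʳ a)))

  ℤ-congruent : ∀ {a b} → (+ p) ∣ℤ (+ a - + b) → a ≈ b
  ℤ-congruent {a} {b} d with ≤-total a b
  ... | inj₁ a≤b = ≈-sym (ordered (subst (p ∣_) (ℤₚ.∣i-j∣≡∣j-i∣ (+ a) (+ b)) d) a≤b)
  ... | inj₂ b≤a = ordered d b≤a

  ℤ-subtract : ∀ {i j} → (+ p) ∣ℤ i → (+ p) ∣ℤ j → (+ p) ∣ℤ (i - j)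
  ℤ-subtract {i} {j} d d′ = Signed.∣⇒∣ᵤ (Signed.∣m∣n⇒∣m-n (Signed.∣ᵤ⇒∣ {+ p} {i} d) (Signed.∣ᵤ⇒∣ {+ p} {j} d′))

theorem1p1 : (p : ℕ) → (pp : Prime p) → (n : ℕ) → (G : Graph n) →
    p ∣ e G → (∀ v → 1 ≤ deg G v) →
    (S : Subset n) → Is2Packing G S → ∣ S ∣ ≡ p ∸ 1 →
    (Σ ℕ λ R → IsZRamseyNumber G p R ×
    ((s₀ G S p ≡ 0 → R ≤ n + p ∸ 1 + cS G S) ×
    (s₀ G S p ≢ 0 → R ≤ n + 5 * p ∸ 9 + s₀ G S p + cS G S)))
    × (s₀ G S p ≡ 0 → cS G S ≡ 0 →
    (Σ ℤ λ d → ¬ ((+ p) ∣ℤ d) × (∀ v → (+ p) ∣ℤ ((+ deg G v) - d))) →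
    Σ ℕ λ R → IsZRamseyNumber G p R × R ≡ n + p ∸ 1)
theorem1p1 p pp n G p∣e deg≥1 S packing |S| = bounds , equality
  where
  open Residues p pp
  open Packed G deg≥1 S packing using (b)

  1≤p : 1 ≤ p
  1≤p = ℕ.>-nonZero⁻¹ p
  p≡ : suc (p ∸ 1) ≡ p
  p≡ = m+[n∸m]≡n 1≤p
  1≤p∸1 : 1 ≤ p ∸ 1
  1≤p∸1 = s≤s⁻¹ (≤-trans (ℕ.nonTrivial⇒n>1 p {{prime⇒nonTrivial pp}}) (≤-reflexive (≡-sym p≡)))
  n+p∸1 : n + p ∸ 1 ≡ n + (p ∸ 1)
  n+p∸1 = +-∸-assoc n 1≤p

  zero-sum : ∀ {N} → (∀ f f-sym → SwitchFreeCopies.ZeroCopy p pp G {N} f f-sym p∣e) → ZeroSumProperty G p N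
  zero-sum copies f f-sym = let φ , inj , w = copies f f-sym in φ , inj , ≈0⇒∣ w

  ramsey : ∀ {B} → ZeroSumProperty G p B → ∃ λ R → IsZRamseyNumber G p R × R ≤ B
  ramsey {B} prop = let R , holds , minimal = least (zeroSumProperty? G p) B prop in
    R , (holds , minimal) , minimal B prop

  |zeros| : length (members (λ v → b v ∧ does (p ∣? deg G v))) ≡ s₀ G S p
  |zeros| = ≡-sym (count-members (λ v → b v ∧ does (p ∣? deg G v)))

  no-zeros : s₀ G S p ≡ 0 → All (λ v → ¬ p ∣ deg G v) (members b)
  no-zeros s≡0 = All.tabulate λ {v} v∈ d → <⇒≱ (∈⇒nonempty {x = v} (∈-members⁺ {b = λ v → b v ∧ does (p ∣? deg G v)}
    (cong₂ _∧_ (∈-members⁻ {b = b} v∈) (dec-true (p ∣? deg G v) d)))) (≤-reflexive (trans |zeros| s≡0))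

  property₀ : s₀ G S p ≡ 0 → ZeroSumProperty G p (n + p ∸ 1 + cS G S)
  property₀ s≡0 = zero-sum λ f f-sym → UpperBound.no-zero-degree⇒zero-copy p pp G p∣e deg≥1 S packing |S| f f-sym
    (no-zeros s≡0) (cong (λ m → m + cS G S) n+p∸1)

  property₁ : s₀ G S p ≢ 0 → ZeroSumProperty G p (n + 5 * p ∸ 9 + s₀ G S p + cS G S)
  property₁ s≢0 = zero-sum λ f f-sym → ZeroDegrees.zero-degree⇒zero-copy p pp G p∣e deg≥1 S packing |S| f f-sym
    (trans (cong (λ q → (n + 5 * q ∸ 9) + s₀ G S p + cS G S + 4) (≡-sym p≡)) (upper-bound-size (p ∸ 1) n (s₀ G S p) (cS G S) 1≤p∸1))
    |zeros| refl (n≢0⇒n>0 s≢0)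

  bounds : Σ ℕ λ R → IsZRamseyNumber G p R ×
    ((s₀ G S p ≡ 0 → R ≤ n + p ∸ 1 + cS G S) ×
    (s₀ G S p ≢ 0 → R ≤ n + 5 * p ∸ 9 + s₀ G S p + cS G S))
  bounds with s₀ G S p ℕ.≟ 0
  ... | yes s≡0 = let R , isR , le = ramsey (property₀ s≡0) in R , isR , (λ _ → le) , λ s≢0 → ⊥-elim (s≢0 s≡0)
  ... | no s≢0 = let R , isR , le = ramsey (property₁ s≢0) in R , isR , (λ s≡0 → ⊥-elim (s≢0 s≡0)) , λ _ → le

  equality : s₀ G S p ≡ 0 → cS G S ≡ 0 →
    (Σ ℤ λ d → ¬ ((+ p) ∣ℤ d) × (∀ v → (+ p) ∣ℤ ((+ deg G v) - d))) →
    Σ ℕ λ R → IsZRamseyNumber G p R × R ≡ n + p ∸ 1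
  equality s≡0 c≡0 (d , p∤d , regular) = let R , isR , le = ramsey (property₀ s≡0) in
    R , isR , ≤-antisym (≤-trans le (≤-reflexive (trans (cong (λ c → n + p ∸ 1 + c) c≡0) (+-identityʳ _))))
      (≤-trans (≤-reflexive n+p∸1) (LowerBound.lower-bound p pp G p∣e v₀ same-degree p∤deg R (proj₁ isR)))
    where
    -- p - 1 ≥ 1, so the packing supplies a reference vertex, whose degree replaces the integer d.
    v₀ : Fin n
    v₀ = proj₁ (nonempty⇒∈ {L = members b} (≤-trans 1≤p∸1 (≤-reflexive (≡-sym (trans (≡-sym (count-members b)) (trans (count-subset S) |S|))))))
    same-degree : ∀ v → deg G v ≈ deg G v₀
    same-degree v = ℤ-congruent p pp (subst ((+ p) ∣ℤ_) (cancel (+ deg G v) (+ deg G v₀) d)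
      (ℤ-subtract p pp {(+ deg G v) - d} {(+ deg G v₀) - d} (regular v) (regular v₀)))
      where
      cancel : ∀ x y d → (x - d) - (y - d) ≡ x - y
      cancel = ℤSolver.solve-∀
    p∤deg : ¬ p ∣ deg G v₀
    p∤deg q = p∤d (subst ((+ p) ∣ℤ_) (cancel (+ deg G v₀) d) (ℤ-subtract p pp {+ deg G v₀} {(+ deg G v₀) - d} q (regular v₀)))
      where
      cancel : ∀ x d → x - (x - d) ≡ d
      cancel = ℤSolver.solve-∀
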